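{- Let $n\ge 1$. On each of the following seven Catalan families, the map $h$ of that family sends the first pair of statistics to the second; that is, for every object $t$ of size $n$, if the pairs are $(a,b)$ and $(a',b')$, then $a'(h(t))=a(t)$ and $b'(h(t))=b(t)$ (and $h$ is an involution preserving size, so the two pairs have the same joint distribution on objects of size $n$): (1) Dyck paths: $(\mathrm{comp},\mathrm{peak})$ to $(\mathrm{rcomp},\mathrm{nonpeak})$; (2) triangulations: $(\mathrm{comp},\mathrm{tr})$ to $(\mathrm{rcomp},\mathrm{nontr})$; (3) $231$-avoiding permutations: $(\mathrm{comp},\mathrm{rmin})$ to $(\mathrm{rmax},\mathrm{nonrmin})$; (4) $321$-avoiding permutations: $(\mathrm{comp},\mathrm{rmin})$ to $(\mathrm{rcomp},\mathrm{nonrmin})$; (5) binary trees: $(\mathrm{comp},\mathrm{redge})$ to $(\mathrm{rcomp},\mathrm{ledge})$; (6) $2\times n$ standard Young tableaux: $(\mathrm{comp},\mathrm{noncons})$ to $(\mathrm{rcomp},\mathrm{cons})$; (7) non-crossing partitions: $(\mathrm{comp},\mathrm{blocks})$ to $(\mathrm{rcomp},\mathrm{nonmin})$.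
   Context: A Catalan structure is a quadruple $(C,e,\lambda,\oplus)$ where $C=\bigsqcup_{n\ge 0}C_n$ with $C_0=\{e\}$ ($|t|=n$ for $t\in C_n$), $\lambda\colon C_n\to C_{n+1}$, $\oplus\colon C_m\times C_n\to C_{m+n}$, $\oplus$ is associative with two-sided identity $e$, and every $t\in C$ can be written uniquely in exactly one of three forms: $t=e$; $t=\lambda(s)$ (indecomposable); $t=u\oplus v$ with $u$ indecomposable and $v\neq e$ (decomposable). Every nonempty $t$ is then uniquely $\lambda(u)\oplus v$. Put $\gamma(t)=t\oplus\lambda(e)$ and define $\ominus$ by $e\ominus v=v$, $\lambda(u)\ominus v=\lambda(u\ominus v)$, $(t\oplus u)\ominus v=t\oplus(u\ominus v)$ for $t,u\ne e$. The map $h$ is defined by $h(e)=e$, $h(\lambda(u)\oplus v)=h(v)\ominus\gamma(h(u))$. Each family below is a Catalan structure with the stated $e,\lambda,\oplus$. (1) Dyck paths of semilength $n$ as words in $u,d$: $e=\epsilon$, $\lambda(w)=uwd$, $w_1\oplus w_2=w_1w_2$. comp = number of returns to the $x$-axis; rcomp = length of the final run of $d$'s; peak = number of factors $ud$; nonpeak = $1$ + number of factors $uu$. (2) Triangulations of the convex $(n+2)$-gon with vertices labeled $1,\dots,n+2$ clockwise (size $n$; size $0$ is the single edge $(1,2)$, which is $e$). $\lambda(T)$: relabel $i\mapsto i+1$ in $T$ (size $n$) and add a new vertex $1$ adjacent to $2$ and $n+3$. $T_1\oplus T_2$ (with $|T_1|=n_1$): identify the edge $(1,n_1+2)$ of $T_1$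 with the edge $(1,2)$ of $T_2$, so vertex $1$ of $T_2$ stays $1$ and vertex $j\ge 2$ of $T_2$ becomes $n_1+j$. Edges include boundary edges. comp = (number of edges incident to $1$) $-1$; rcomp = (number of edges incident to $n+2$) $-1$; tr = number of $i\in\{2,\dots,n+1\}$ such that some $j<i$ is adjacent to both $i$ and $i+1$; nontr $=n+1-\mathrm{tr}$. (3) $231$-avoiding permutations of $[n]$: $e=\epsilon$, $\lambda(\pi)=(n+1)\pi$ (prepend a new maximum), $\oplus$ = direct sum ($\pi_1\oplus\pi_2=\pi_1\pi_2'$ with $\pi_2'(i)=\pi_2(i)+|\pi_1|$). comp = number of direct-sum components; rmax = number of right-to-left maxima; rmin = number of right-to-left minima; nonrmin = $1$ + number of entries that are not right-to-left minima. (4) $321$-avoiding permutations of $[n]$: $e=\epsilon$, $\oplus$ = direct sum, $\lambda(\epsilon)=1$, and for $n\ge 1$, $\lambda(\pi)$ is obtained as follows: let $i$ be the position of $1$ in $\pi$; box the positions to the right of $i$ that are left-to-right maxima but not right-to-left minima of $\pi$; insert $n+1$ at position $i$ (shifting later entries, and boxes, one place right) and box this position too; then cyclically shift the values at the boxed positions one step to the left (each boxed value moves to the previous boxed position, the first wraps to the last). comp = number of direct-sum components; rcomp $=n-\pi(n)+1$; rmin, nonrmin as in (3). (5) Binary trees with $n$ nodes: either $\varnothing$ or $(L,R)$ with $L,R$ binary trees. $e=\varnothing$, $\lambda(T)=(T,\varnothing)$, $\varnothing\oplus B=B$, $(T,B_1)\oplus B_2=(T,B_1\oplus B_2)$. The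 right spine is the maximal sequence of nodes reached from the root along right edges. comp = number of nodes on the right spine; rcomp = number of iterations needed to reach $\varnothing$ when repeatedly replacing the tree by the left subtree of the last node of its right spine; redge = $1$ + number of edges from a node to a nonempty right child; ledge $=n+1-\mathrm{redge}$. (6) $2\times n$ standard Young tableaux: $e$ = empty tableau; $\lambda(T)$ ($T$ of size $n$): increase all entries by $1$, prepend $1$ to the top row and append $2n+2$ to the bottom row; $T_1\oplus T_2$: add $2|T_1|$ to all entries of $T_2$ and adjoin its columns to the right of $T_1$. comp = number of $k\in\{1,\dots,n\}$ such that the first $k$ columns contain exactly $\{1,\dots,2k\}$; rcomp = largest $k$ such that the last $k$ bottom-row entries, read right to left, are $2n,2n-1,\dots,2n-k+1$; cons = $1$ + number of top-row entries $i$ with $i+1$ in the top row; noncons = number of top-row entries $i$ with $i+1$ in the bottom row. (7) Non-crossing partitions of $[n]$: $e$ = empty partition; $\lambda(P)$: add $n+1$ to the block containing $1$ (and $\lambda(e)=\{\{1\}\}$); $P_1\oplus P_2=P_1\cup(P_2+|P_1|)$. comp = number of indecomposable summands (equivalently, number of $k\in\{1,\dots,n\}$ such that $[k]$ is a union of blocks); rcomp = number of right-to-left maxima of the flattened form, i.e. the word listing each block in decreasing order, with blocks sorted by minimal element; blocks = number of blocks; nonmin $=n+1-\mathrm{blocks}$. -}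

module Defs where

open import Data.Bool using (Bool; true; false; if_then_else_; _∧_)
open import Data.Empty using (⊥-elim)
open import Data.List
  using (List; []; _∷_; _++_; map; length; filter; concat; take; takeWhile; reverse;
         upTo; cartesianProduct)
open import Data.List.Membership.Propositional using (_∈_)
open import Data.List.Relation.Binary.Permutation.Propositional using (_↭_)
open import Data.List.Relation.Binary.Pointwise using (Pointwise)
open import Data.List.Relation.Binary.Sublist.Propositional using (_⊆_)
open import Data.List.Relation.Unary.All using (All; all?)
open import Data.List.Relation.Unary.AllPairs using (AllPairs)
open import Data.List.Relation.Unary.Any using (any?)
open import Data.List.Relation.Unary.Unique.Propositional using (Unique)
open import Data.Nat using (ℕ; zero; suc; _+_; _*_; _∸_; _≤_; _<_; _>_; s≤s; _≟_; _≤?_; _<?_)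
open import Data.Nat.Induction using (Acc; acc; <-wellFounded)
open import Data.Nat.Properties using (≤-reflexive; m≤m+n; m≤n+m; m+n≡0⇒m≡0; m+n≡0⇒n≡0)
open import Data.Product using (Σ-syntax; ∃-syntax; _×_; _,_; proj₁; proj₂)
open import Data.Product.Properties using (≡-dec)
open import Data.Sum using (_⊎_)
open import Data.Unit using (⊤)
open import Function using (_∘_)
open import Level using (0ℓ)
open import Relation.Binary.Definitions using (DecidableEquality)
open import Relation.Binary.PropositionalEquality
open import Relation.Nullary using (¬_; Dec; yes; no; does)
open import Relation.Nullary.Decidable using (_×-dec_; _⊎-dec_; ¬?)
open import Relation.Unary using (Pred; Decidable)
import Data.List.Membership.DecPropositional as DecMembership
import Data.List.Properties as List

open DecMembership _≟_ using (_∈?_)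

------------------------------------------------------------------------
-- Catalan structures

-- The objects may live inside a larger type of representations (words, lists
-- of edges, …); C_n is the set of t with IsObject t and ∣ t ∣ ≡ n.  The
-- operations are arbitrary on non-objects, and no law mentions those.
record RawCatalan : Set₁ where
  infixr 6 _⊕_
  field
    Carrier  : Set
    IsObject : Carrier → Set
    ∣_∣      : Carrier → ℕ
    e        : Carrier
    lam      : Carrier → Carrier
    _⊕_      : Carrier → Carrier → Carrier

  Indecomposable : Carrier → Set
  Indecomposable u = ∃[ s ] (IsObject s × u ≡ lam s)

  data Form (t : Carrier) : Set where
    empty          : t ≡ e → Form t
    indecomposable : ∀ s → IsObject s → t ≡ lam s → Form t
    decomposable   : ∀ u v → Indecomposable u → IsObject v → v ≢ e → t ≡ u ⊕ v → Form t

  record Object : Set where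
    constructor object
    field
      elem     : Carrier
      isObject : IsObject elem

  open Object public

  infix 4 _≋_
  _≋_ : Object → Object → Set
  t ≋ u = elem t ≡ elem u

record IsCatalan (R : RawCatalan) : Set where
  open RawCatalan R
  field
    e-isObject   : IsObject e
    lam-isObject : ∀ {t} → IsObject t → IsObject (lam t)
    ⊕-isObject   : ∀ {t u} → IsObject t → IsObject u → IsObject (t ⊕ u)

    ∣e∣   : ∣ e ∣ ≡ 0
    ∣t∣≡0 : ∀ {t} → IsObject t → ∣ t ∣ ≡ 0 → t ≡ e
    ∣lam∣ : ∀ {t} → IsObject t → ∣ lam t ∣ ≡ suc ∣ t ∣
    ∣⊕∣   : ∀ {t u} → IsObject t → IsObject u → ∣ t ⊕ u ∣ ≡ ∣ t ∣ + ∣ u ∣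

    ⊕-assoc     : ∀ {t u v} → IsObject t → IsObject u → IsObject v →
                  (t ⊕ u) ⊕ v ≡ t ⊕ (u ⊕ v)
    ⊕-identityˡ : ∀ {t} → IsObject t → e ⊕ t ≡ t
    ⊕-identityʳ : ∀ {t} → IsObject t → t ⊕ e ≡ t

    form : ∀ {t} → IsObject t → Form t

    lam≢e : ∀ {s} → IsObject s → lam s ≢ e
    ⊕≢e   : ∀ {u v} → Indecomposable u → IsObject v → v ≢ e → u ⊕ v ≢ e
    lam≢⊕ : ∀ {s u v} → IsObject s → Indecomposable u → IsObject v → v ≢ e → lam s ≢ u ⊕ v

    lam-injective : ∀ {s s′} → IsObject s → IsObject s′ → lam s ≡ lam s′ → s ≡ s′
    ⊕-unique      : ∀ {u v u′ v′} →
                    Indecomposable u → IsObject v → v ≢ e →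
                    Indecomposable u′ → IsObject v′ → v′ ≢ e →
                    u ⊕ v ≡ u′ ⊕ v′ → u ≡ u′ × v ≡ v′

module CatalanMap {R : RawCatalan} (cat : IsCatalan R) where
  open RawCatalan R hiding (e; lam; _⊕_)
  open RawCatalan R using () renaming (e to e₀; lam to lam₀; _⊕_ to _⊕₀_)
  open IsCatalan cat

  infixr 6 _⊕_ _⊖_

  size : Object → ℕ
  size t = ∣ elem t ∣

  e : Object
  e = object e₀ e-isObject

  lam : Object → Object
  lam (object t p) = object (lam₀ t) (lam-isObject p)

  _⊕_ : Object → Object → Object
  object t p ⊕ object u q = object (t ⊕₀ u) (⊕-isObject p q)

  γ : Object → Object
  γ t = t ⊕ lam e

  private
    lam-< : ∀ {s t} → IsObject s → t ≡ lam₀ s → ∣ s ∣ < ∣ t ∣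
    lam-< p refl = ≤-reflexive (sym (∣lam∣ p))

    ind-isObject : ∀ {u} → Indecomposable u → IsObject u
    ind-isObject (_ , p , refl) = lam-isObject p

    ⊕ʳ-< : ∀ {u v t} → Indecomposable u → IsObject v → t ≡ u ⊕₀ v → ∣ v ∣ < ∣ t ∣
    ⊕ʳ-< {v = v} i@(s , p , refl) q refl
      rewrite ∣⊕∣ (ind-isObject i) q | ∣lam∣ p = s≤s (m≤n+m ∣ v ∣ ∣ s ∣)

    ⊕ˡ-< : ∀ {s v t} → IsObject s → IsObject v → t ≡ lam₀ s ⊕₀ v → ∣ s ∣ < ∣ t ∣
    ⊕ˡ-< {s} {v} p q refl
      rewrite ∣⊕∣ (lam-isObject p) q | ∣lam∣ p = s≤s (m≤m+n ∣ s ∣ ∣ v ∣)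

  -- The clause (t ⊕ u) ⊖ v = t ⊕ (u ⊖ v) is applied with t indecomposable,
  -- where it is a recursion; ⊖-⊕ below gives it for every t ≢ e.
  ominus : (t : Object) → Acc _<_ (size t) → Object → Object
  ominus (object t p) (acc rs) v with form p
  ... | empty _ = v
  ... | indecomposable s q eq = lam (ominus (object s q) (rs (lam-< q eq)) v)
  ... | decomposable u w i q _ eq =
          object u (ind-isObject i) ⊕ ominus (object w q) (rs (⊕ʳ-< i q eq)) v

  _⊖_ : Object → Object → Object
  t ⊖ v = ominus t (<-wellFounded (size t)) v

  -- An indecomposable lam s is lam s ⊕ e.
  h-acc : (t : Object) → Acc _<_ (size t) → Object
  h-acc (object t p) (acc rs) with form p
  ... | empty _ = e
  ... | indecomposable s q eq = e ⊖ γ (h-acc (object s q) (rs (lam-< q eq)))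
  ... | decomposable _ v (s , r , refl) q _ eq =
          h-acc (object v q) (rs (⊕ʳ-< (s , r , refl) q eq))
            ⊖ γ (h-acc (object s r) (rs (⊕ˡ-< r q eq)))

  h : Object → Object
  h t = h-acc t (<-wellFounded (size t))

  -- The defining equations of ⊖ and h.

  private
    ominus-cong : ∀ t t′ v v′ (a : Acc _<_ (size t)) (a′ : Acc _<_ (size t′)) →
                  t ≋ t′ → v ≋ v′ → ominus t a v ≋ ominus t′ a′ v′
    ominus-cong (object t p) (object .t p′) v v′ (acc rs) (acc rs′) refl eq with form p | form p′
    ... | empty _ | empty _ = eq
    ... | empty x | indecomposable s q y = ⊥-elim (lam≢e q (trans (sym y) x))
    ... | empty x | decomposable u w i q n y = ⊥-elim (⊕≢e i q n (trans (sym y) x))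
    ... | indecomposable s q y | empty x = ⊥-elim (lam≢e q (trans (sym y) x))
    ... | indecomposable s q x | indecomposable s′ q′ y =
            cong lam₀ (ominus-cong (object s q) (object s′ q′) v v′
              (rs (lam-< q x)) (rs′ (lam-< q′ y)) (lam-injective q q′ (trans (sym x) y)) eq)
    ... | indecomposable s q x | decomposable u w i r n y =
            ⊥-elim (lam≢⊕ q i r n (trans (sym x) y))
    ... | decomposable u w i q n y | empty x = ⊥-elim (⊕≢e i q n (trans (sym y) x))
    ... | decomposable u w i r n y | indecomposable s q x =
            ⊥-elim (lam≢⊕ q i r n (trans (sym x) y))
    ... | decomposable u w i q n x | decomposable u′ w′ i′ q′ n′ y =
            let (u≡ , w≡) = ⊕-unique i q n i′ q′ n′ (trans (sym x) y)
            in cong₂ _⊕₀_ u≡ (ominus-cong (object w q) (object w′ q′) v v′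
                 (rs (⊕ʳ-< i q x)) (rs′ (⊕ʳ-< i′ q′ y)) w≡ eq)

  ⊖-cong : ∀ t t′ v v′ → t ≋ t′ → v ≋ v′ → t ⊖ v ≋ t′ ⊖ v′
  ⊖-cong t t′ v v′ = ominus-cong t t′ v v′ (<-wellFounded _) (<-wellFounded _)

  private
    h-acc-cong : ∀ t t′ (a : Acc _<_ (size t)) (a′ : Acc _<_ (size t′)) →
                 t ≋ t′ → h-acc t a ≋ h-acc t′ a′
    h-acc-cong (object t p) (object .t p′) (acc rs) (acc rs′) refl with form p | form p′
    ... | empty _ | empty _ = refl
    ... | empty x | indecomposable s q y = ⊥-elim (lam≢e q (trans (sym y) x))
    ... | empty x | decomposable u w i q n y = ⊥-elim (⊕≢e i q n (trans (sym y) x))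
    ... | indecomposable s q y | empty x = ⊥-elim (lam≢e q (trans (sym y) x))
    ... | indecomposable s q x | indecomposable s′ q′ y =
            let a = rs (lam-< q x) ; a′ = rs′ (lam-< q′ y)
            in ⊖-cong e e (γ (h-acc (object s q) a)) (γ (h-acc (object s′ q′) a′)) refl
                 (cong (_⊕₀ lam₀ e₀) (h-acc-cong (object s q) (object s′ q′) a a′
                   (lam-injective q q′ (trans (sym x) y))))
    ... | indecomposable s q x | decomposable u w i r n y =
            ⊥-elim (lam≢⊕ q i r n (trans (sym x) y))
    ... | decomposable u w i q n y | empty x = ⊥-elim (⊕≢e i q n (trans (sym y) x))
    ... | decomposable u w i r n y | indecomposable s q x =
            ⊥-elim (lam≢⊕ q i r n (trans (sym x) y))
    ... | decomposable _ w (s , r , refl) q n x | decomposable _ w′ (s′ , r′ , refl) q′ n′ y =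
            let (u≡ , w≡) = ⊕-unique (s , r , refl) q n (s′ , r′ , refl) q′ n′ (trans (sym x) y)
                a = rs (⊕ˡ-< r q x) ; a′ = rs′ (⊕ˡ-< r′ q′ y)
                b = rs (⊕ʳ-< (s , r , refl) q x) ; b′ = rs′ (⊕ʳ-< (s′ , r′ , refl) q′ y)
            in ⊖-cong (h-acc (object w q) b) (h-acc (object w′ q′) b′)
                      (γ (h-acc (object s r) a)) (γ (h-acc (object s′ r′) a′))
                 (h-acc-cong (object w q) (object w′ q′) b b′ w≡)
                 (cong (_⊕₀ lam₀ e₀) (h-acc-cong (object s r) (object s′ r′) a a′
                   (lam-injective r r′ u≡)))

  h-cong : ∀ t t′ → t ≋ t′ → h t ≋ h t′
  h-cong t t′ = h-acc-cong t t′ (<-wellFounded _) (<-wellFounded _)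

  private
    ominus-e : ∀ v (a : Acc _<_ (size e)) → ominus e a v ≋ v
    ominus-e v (acc rs) with form e-isObject
    ... | empty _ = refl
    ... | indecomposable s q x = ⊥-elim (lam≢e q (sym x))
    ... | decomposable u w i q n x = ⊥-elim (⊕≢e i q n (sym x))

    ominus-lam : ∀ u v (a : Acc _<_ (size (lam u))) → ominus (lam u) a v ≋ lam (u ⊖ v)
    ominus-lam (object u p) v (acc rs) with form (lam-isObject p)
    ... | empty x = ⊥-elim (lam≢e p x)
    ... | indecomposable s q x =
            cong lam₀ (ominus-cong (object s q) (object u p) v v (rs (lam-< q x))
              (<-wellFounded _) (sym (lam-injective p q x)) refl)
    ... | decomposable u′ w i q n x = ⊥-elim (lam≢⊕ p i q n x)

    ominus-⊕ : ∀ {u w} (i : Indecomposable u) (q : IsObject w) → w ≢ e₀ → ∀ v →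
               let U = object u (ind-isObject i) ; W = object w q in
               (a : Acc _<_ (size (U ⊕ W))) → ominus (U ⊕ W) a v ≋ U ⊕ (W ⊖ v)
    ominus-⊕ {u} {w} i q n v (acc rs) with form (⊕-isObject (ind-isObject i) q)
    ... | empty x = ⊥-elim (⊕≢e i q n x)
    ... | indecomposable s r x = ⊥-elim (lam≢⊕ r i q n (sym x))
    ... | decomposable u′ w′ i′ q′ n′ x =
            let (u≡ , w≡) = ⊕-unique i q n i′ q′ n′ x
            in cong₂ _⊕₀_ (sym u≡) (ominus-cong (object w′ q′) (object w q) v v
                 (rs (⊕ʳ-< i′ q′ x)) (<-wellFounded _) (sym w≡) refl)

    ⊕≡e⇒ˡ : ∀ {t u} → IsObject t → IsObject u → t ⊕₀ u ≡ e₀ → t ≡ e₀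
    ⊕≡e⇒ˡ {t} p q eq = ∣t∣≡0 p (m+n≡0⇒m≡0 ∣ t ∣
      (trans (sym (∣⊕∣ p q)) (trans (cong ∣_∣ eq) ∣e∣)))

    ⊕≡e⇒ʳ : ∀ {t u} → IsObject t → IsObject u → t ⊕₀ u ≡ e₀ → u ≡ e₀
    ⊕≡e⇒ʳ {t} p q eq = ∣t∣≡0 q (m+n≡0⇒n≡0 ∣ t ∣
      (trans (sym (∣⊕∣ p q)) (trans (cong ∣_∣ eq) ∣e∣)))

    ⊖-⊕-acc : ∀ t u v → Acc _<_ (size t) → elem t ≢ e₀ → elem u ≢ e₀ →
              (t ⊕ u) ⊖ v ≋ t ⊕ (u ⊖ v)
    ⊖-⊕-acc (object t p) u v (acc rs) t≢ u≢ with form p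
    ... | empty x = ⊥-elim (t≢ x)
    ... | indecomposable s q refl = trans
            (⊖-cong (object t p ⊕ u) (object t (lam-isObject q) ⊕ u) v v refl refl)
            (ominus-⊕ (s , q , refl) (isObject u) u≢ v (<-wellFounded _))
    ... | decomposable a w i q n refl =
            let A = object a (ind-isObject i) ; W = object w q
            in trans (⊖-cong (object t p ⊕ u) (A ⊕ (W ⊕ u)) v v
                        (⊕-assoc (ind-isObject i) q (isObject u)) refl)
              (trans (ominus-⊕ i (isObject (W ⊕ u)) (u≢ ∘ ⊕≡e⇒ʳ q (isObject u)) v
                        (<-wellFounded _))
              (trans (cong (a ⊕₀_) (⊖-⊕-acc W u v (rs (⊕ʳ-< i q refl)) n u≢))
                     (sym (⊕-assoc (ind-isObject i) q (isObject (u ⊖ v))))))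

    h-acc-e : (a : Acc _<_ (size e)) → h-acc e a ≋ e
    h-acc-e (acc rs) with form e-isObject
    ... | empty _ = refl
    ... | indecomposable s q x = ⊥-elim (lam≢e q (sym x))
    ... | decomposable u w i q n x = ⊥-elim (⊕≢e i q n (sym x))

    -- The two cases v ≡ e and v ≢ e of h-lam-⊕, for any t representing lam u ⊕ v.
    h-acc-lam : ∀ u t (a : Acc _<_ (size t)) → t ≋ lam u → h-acc t a ≋ e ⊖ γ (h u)
    h-acc-lam (object u p) (object _ r) (acc rs) refl with form r
    ... | empty x = ⊥-elim (lam≢e p x)
    ... | indecomposable s q x =
            ⊖-cong e e (γ (h-acc (object s q) a)) (γ (h (object u p))) refl
              (cong (_⊕₀ lam₀ e₀) (h-acc-cong (object s q) (object u p) a (<-wellFounded _)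
                (sym (lam-injective p q x))))
            where a = rs (lam-< q x)
    ... | decomposable u′ w i q n x = ⊥-elim (lam≢⊕ p i q n x)

    h-acc-⊕ : ∀ u v → elem v ≢ e₀ → (a : Acc _<_ (size (lam u ⊕ v))) →
              h-acc (lam u ⊕ v) a ≋ h v ⊖ γ (h u)
    h-acc-⊕ (object u p) (object v q) n (acc rs) with form (⊕-isObject (lam-isObject p) q)
    ... | empty x = ⊥-elim (⊕≢e (u , p , refl) q n x)
    ... | indecomposable s r x = ⊥-elim (lam≢⊕ r (u , p , refl) q n (sym x))
    ... | decomposable _ v′ (s , r , refl) q′ n′ x =
            let (u≡ , v≡) = ⊕-unique (u , p , refl) q n (s , r , refl) q′ n′ x
            in ⊖-cong (h-acc (object v′ q′) b) (h (object v q))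
                      (γ (h-acc (object s r) a)) (γ (h (object u p)))
                 (h-acc-cong (object v′ q′) (object v q) b (<-wellFounded _) (sym v≡))
                 (cong (_⊕₀ lam₀ e₀) (h-acc-cong (object s r) (object u p) a (<-wellFounded _)
                   (sym (lam-injective p r u≡))))
            where a = rs (⊕ˡ-< r q′ x) ; b = rs (⊕ʳ-< (s , r , refl) q′ x)

  ⊖-e : ∀ v → e ⊖ v ≋ v
  ⊖-e v = ominus-e v (<-wellFounded _)

  ⊖-lam : ∀ u v → lam u ⊖ v ≋ lam (u ⊖ v)
  ⊖-lam u v = ominus-lam u v (<-wellFounded _)

  ⊖-⊕ : ∀ t u v → elem t ≢ e₀ → elem u ≢ e₀ → (t ⊕ u) ⊖ v ≋ t ⊕ (u ⊖ v)
  ⊖-⊕ t u v = ⊖-⊕-acc t u v (<-wellFounded _)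

  h-e : h e ≋ e
  h-e = h-acc-e (<-wellFounded _)

  h-lam-⊕ : ∀ u v → h (lam u ⊕ v) ≋ h v ⊖ γ (h u)
  h-lam-⊕ u v with size v ≟ 0
  ... | no v≢0 = h-acc-⊕ u v (λ { refl → v≢0 ∣e∣ }) (<-wellFounded _)
  ... | yes v≡0 = trans
          (h-acc-lam u (lam u ⊕ v) (<-wellFounded _)
            (trans (cong (elem (lam u) ⊕₀_) v≡e) (⊕-identityʳ (isObject (lam u)))))
          (⊖-cong e (h v) (γ (h u)) (γ (h u)) (sym (trans (h-cong v e v≡e) h-e)) refl)
    where v≡e = ∣t∣≡0 (isObject v) v≡0

------------------------------------------------------------------------
-- Counting and joint distributions

count : ∀ {A : Set} {P : Pred A 0ℓ} → Decidable P → List A → ℕ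
count P? xs = length (filter P? xs)

module _ (R : RawCatalan) where
  open RawCatalan R

  Statistics : Set
  Statistics = (Carrier → ℕ) × (Carrier → ℕ)

  record Enumeration (n : ℕ) : Set where
    field
      objects  : List Carrier
      unique   : Unique objects
      sound    : ∀ {t} → t ∈ objects → IsObject t × ∣ t ∣ ≡ n
      complete : ∀ {t} → IsObject t → ∣ t ∣ ≡ n → t ∈ objects

  SameJointDistribution : ℕ → Statistics → Statistics → Set
  SameJointDistribution n (a , b) (a′ , b′) =
    Σ[ C ∈ Enumeration n ] (∀ i j →
      count (λ t → (a t ≟ i) ×-dec (b t ≟ j)) (Enumeration.objects C) ≡
      count (λ t → (a′ t ≟ i) ×-dec (b′ t ≟ j)) (Enumeration.objects C))

  record HSends (cat : IsCatalan R) (n : ℕ) (p p′ : Statistics) : Set where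
    open CatalanMap cat
    field
      first      : ∀ t → size t ≡ n → proj₁ p′ (elem (h t)) ≡ proj₁ p (elem t)
      second     : ∀ t → size t ≡ n → proj₂ p′ (elem (h t)) ≡ proj₂ p (elem t)
      h-size     : ∀ t → size t ≡ n → size (h t) ≡ n
      involutive : ∀ t → size t ≡ n → h (h t) ≋ t
      joint      : SameJointDistribution n p p′

  -- h only exists once the family is known to be a Catalan structure, so that
  -- is part of the claim.
  HSendsPair : ℕ → Statistics → Statistics → Set
  HSendsPair n p p′ = Σ[ cat ∈ IsCatalan R ] HSends cat n p p′

------------------------------------------------------------------------
-- Lists of numbers

[1⋯_] : ℕ → List ℕ
[1⋯ n ] = map suc (upTo n)

-- All ways of writing a list as l ++ x ∷ r.
splits : List ℕ → List (List ℕ × ℕ × List ℕ)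
splits []       = []
splits (x ∷ xs) = ([] , x , xs) ∷ map (λ (l , y , r) → (x ∷ l , y , r)) (splits xs)

LRMax RLMax RLMin : List ℕ × ℕ × List ℕ → Set
LRMax (l , x , r) = All (_< x) l
RLMax (l , x , r) = All (_< x) r
RLMin (l , x , r) = All (x <_) r

lrMax? : Decidable LRMax
lrMax? (l , x , r) = all? (_<? x) l

rlMax? : Decidable RLMax
rlMax? (l , x , r) = all? (_<? x) r

rlMin? : Decidable RLMin
rlMin? (l , x , r) = all? (x <?_) r

SameSet : List ℕ → List ℕ → Set
SameSet xs ys = All (_∈ ys) xs × All (_∈ xs) ys

sameSet? : ∀ xs ys → Dec (SameSet xs ys)
sameSet? xs ys = all? (_∈? ys) xs ×-dec all? (_∈? xs) ys

-- The last entry; 0 for the empty list.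
lastEntry : List ℕ → ℕ
lastEntry []           = 0
lastEntry (x ∷ [])     = x
lastEntry (_ ∷ y ∷ xs) = lastEntry (y ∷ xs)

-- The largest k ≤ n with P k, or 0 if there is none.
largest : ∀ {P : Pred ℕ 0ℓ} → Decidable P → ℕ → ℕ
largest P? zero    = 0
largest P? (suc k) = if does (P? (suc k)) then suc k else largest P? k

------------------------------------------------------------------------
-- Dyck paths

module Dyck where

  data Step : Set where
    u d : Step

  _≟ₛ_ : DecidableEquality Step
  u ≟ₛ u = yes refl
  u ≟ₛ d = no λ ()
  d ≟ₛ u = no λ ()
  d ≟ₛ d = yes refl

  #u #d : List Step → ℕ
  #u = count (u ≟ₛ_)
  #d = count (d ≟ₛ_)

  IsDyck : List Step → Set
  IsDyck w = #u w ≡ #d w × (∀ p s → w ≡ p ++ s → #d p ≤ #u p)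

  dyck : RawCatalan
  dyck = record
    { Carrier  = List Step
    ; IsObject = IsDyck
    ; ∣_∣      = #u
    ; e        = []
    ; lam      = λ w → u ∷ w ++ d ∷ []
    ; _⊕_      = _++_
    }

  comp : List Step → ℕ
  comp w = count (λ k → #u (take k w) ≟ #d (take k w)) [1⋯ length w ]

  rcomp : List Step → ℕ
  rcomp w = length (takeWhile (d ≟ₛ_) (reverse w))

  factors : Step → Step → List Step → ℕ
  factors a b (x ∷ y ∷ w) =
    (if does (a ≟ₛ x) ∧ does (b ≟ₛ y) then 1 else 0) + factors a b (y ∷ w)
  factors a b _ = 0

  peak nonpeak : List Step → ℕ
  peak    = factors u d
  nonpeak = λ w → 1 + factors u u w

open Dyck using (dyck) public

------------------------------------------------------------------------
-- Triangulations of a polygon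

module Triangulation where

  -- An edge {i, j} is the pair (i , j) with i < j.
  Edge : Set
  Edge = ℕ × ℕ

  open DecMembership (≡-dec _≟_ _≟_) renaming (_∈?_ to _∈ₑ?_) using ()

  record PolygonEdges : Set where
    constructor polygon
    field
      size  : ℕ
      edges : List Edge

  open PolygonEdges

  possibleEdges : ℕ → List Edge
  possibleEdges n = filter (λ (i , j) → i <? j) (cartesianProduct [1⋯ n + 2 ] [1⋯ n + 2 ])

  -- The given set of edges of the (n+2)-gon, in lexicographic order and without
  -- repetitions, so that equality of edge sets becomes _≡_.
  edgeSet : ℕ → List Edge → PolygonEdges
  edgeSet n es = polygon n (filter (_∈ₑ? es) (possibleEdges n))

  Crosses : Edge → Edge → Set
  Crosses (a , b) (c , d) = (a < c × c < b × b < d) ⊎ (c < a × a < d × d < b)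

  record IsTriangulation (T : PolygonEdges) : Set where
    field
      normal      : edgeSet (size T) (edges T) ≡ T
      nonCrossing : ∀ {a b} → a ∈ edges T → b ∈ edges T → ¬ Crosses a b
      maximal     : ∀ {a} → a ∈ possibleEdges (size T) →
                    (∀ {b} → b ∈ edges T → ¬ Crosses a b) → a ∈ edges T

  shift : Edge → Edge
  shift (i , j) = (suc i , suc j)

  relabel : ℕ → ℕ → ℕ
  relabel n₁ j = if does (j ≟ 1) then 1 else n₁ + j

  triangulations : RawCatalan
  triangulations = record
    { Carrier  = PolygonEdges
    ; IsObject = IsTriangulation
    ; ∣_∣      = size
    ; e        = polygon 0 ((1 , 2) ∷ [])
    ; lam      = λ T → edgeSet (suc (size T))
                   ((1 , 2) ∷ (1 , size T + 3) ∷ map shift (edges T))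
    ; _⊕_      = λ T₁ T₂ → edgeSet (size T₁ + size T₂)
                   (edges T₁ ++
                    map (λ (i , j) → (relabel (size T₁) i , relabel (size T₁) j)) (edges T₂))
    }

  degree : PolygonEdges → ℕ → ℕ
  degree T v = count (λ (i , j) → (i ≟ v) ⊎-dec (j ≟ v)) (edges T)

  comp rcomp tr nontr : PolygonEdges → ℕ
  comp  T = degree T 1 ∸ 1
  rcomp T = degree T (size T + 2) ∸ 1
  tr    T = count (λ i → any? (λ j → ((j , i) ∈ₑ? edges T) ×-dec ((j , suc i) ∈ₑ? edges T))
                              [1⋯ i ∸ 1 ])
                  (map suc [1⋯ size T ])
  nontr T = (size T + 1) ∸ tr T

open Triangulation using (triangulations) public

------------------------------------------------------------------------
-- Pattern-avoiding permutations, as words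

module Permutation where

  IsPermutation : List ℕ → Set
  IsPermutation π = π ↭ [1⋯ length π ]

  Avoids231 Avoids321 : List ℕ → Set
  Avoids231 π = ∀ {a b c} → a ∷ b ∷ c ∷ [] ⊆ π → ¬ (c < a × a < b)
  Avoids321 π = ∀ {a b c} → a ∷ b ∷ c ∷ [] ⊆ π → ¬ (c < b × b < a)

  directSum : List ℕ → List ℕ → List ℕ
  directSum π₁ π₂ = π₁ ++ map (length π₁ +_) π₂

  permutations231 : RawCatalan
  permutations231 = record
    { Carrier  = List ℕ
    ; IsObject = λ π → IsPermutation π × Avoids231 π
    ; ∣_∣      = length
    ; e        = []
    ; lam      = λ π → suc (length π) ∷ π
    ; _⊕_      = directSum
    }

  -- A word in which some positions are boxed (true).
  Boxed : Set
  Boxed = List (Bool × ℕ)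

  box : List ℕ → Boxed
  box π = map (λ s@(l , x , r) → does ((1 ∈? l) ×-dec lrMax? s ×-dec ¬? (rlMin? s)) , x)
              (splits π)

  -- Inserts a boxed m at the position of 1.
  insertBoxed : ℕ → Boxed → Boxed
  insertBoxed m []            = []
  insertBoxed m ((b , x) ∷ w) =
    if does (x ≟ 1) then (true , m) ∷ (b , x) ∷ w else (b , x) ∷ insertBoxed m w

  boxedValues : Boxed → List ℕ
  boxedValues []                = []
  boxedValues ((true  , x) ∷ w) = x ∷ boxedValues w
  boxedValues ((false , x) ∷ w) = boxedValues w

  rotate : List ℕ → List ℕ
  rotate []       = []
  rotate (x ∷ xs) = xs ++ x ∷ []

  -- Replaces the boxed values by the given ones, from left to right.
  refill : Boxed → List ℕ → List ℕ
  refill []                vs       = []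
  refill ((false , x) ∷ w) vs       = x ∷ refill w vs
  refill ((true  , x) ∷ w) []       = x ∷ refill w []
  refill ((true  , _) ∷ w) (v ∷ vs) = v ∷ refill w vs

  cycleBoxed : Boxed → List ℕ
  cycleBoxed w = refill w (rotate (boxedValues w))

  lam321 : List ℕ → List ℕ
  lam321 []          = 1 ∷ []
  lam321 π@(_ ∷ _)  = cycleBoxed (insertBoxed (suc (length π)) (box π))

  permutations321 : RawCatalan
  permutations321 = record
    { Carrier  = List ℕ
    ; IsObject = λ π → IsPermutation π × Avoids321 π
    ; ∣_∣      = length
    ; e        = []
    ; lam      = lam321
    ; _⊕_      = directSum
    }

  -- A direct-sum component ends after position k exactly when the first k
  -- entries are 1, …, k.
  comp : List ℕ → ℕ
  comp π = count (λ k → sameSet? (take k π) [1⋯ k ]) [1⋯ length π ]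

  rmax rmin nonrmin rcomp : List ℕ → ℕ
  rmax    π = count rlMax? (splits π)
  rmin    π = count rlMin? (splits π)
  nonrmin π = 1 + count (λ s → ¬? (rlMin? s)) (splits π)
  rcomp   π = (length π ∸ lastEntry π) + 1

open Permutation using (permutations231; permutations321) public

------------------------------------------------------------------------
-- Binary trees

module BinaryTree where

  data Tree : Set where
    ∅    : Tree
    node : Tree → Tree → Tree

  nodes : Tree → ℕ
  nodes ∅          = 0
  nodes (node L R) = suc (nodes L + nodes R)

  graft : Tree → Tree → Tree
  graft ∅          B = B
  graft (node T C) B = node T (graft C B)

  binaryTrees : RawCatalan
  binaryTrees = record
    { Carrier  = Tree
    ; IsObject = λ _ → ⊤
    ; ∣_∣      = nodes
    ; e        = ∅
    ; lam      = λ T → node T ∅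
    ; _⊕_      = graft
    }

  comp : Tree → ℕ
  comp ∅          = 0
  comp (node L R) = suc (comp R)

  -- The left subtree of the last node of the right spine.
  lastLeft : Tree → Tree
  lastLeft ∅                     = ∅
  lastLeft (node L ∅)            = L
  lastLeft (node L R@(node _ _)) = lastLeft R

  -- The number of iterations of lastLeft needed to reach ∅: see rcomp-step.
  rcomp : Tree → ℕ
  rcomp ∅                     = 0
  rcomp (node L ∅)            = suc (rcomp L)
  rcomp (node L R@(node _ _)) = rcomp R

  rcomp-step : ∀ L R → rcomp (node L R) ≡ suc (rcomp (lastLeft (node L R)))
  rcomp-step L ∅            = refl
  rcomp-step L (node L′ R′) = rcomp-step L′ R′

  rightEdges : Tree → ℕ
  rightEdges ∅                     = 0
  rightEdges (node L ∅)            = rightEdges L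
  rightEdges (node L R@(node _ _)) = suc (rightEdges L + rightEdges R)

  redge ledge : Tree → ℕ
  redge t = 1 + rightEdges t
  ledge t = (nodes t + 1) ∸ redge t

open BinaryTree using (binaryTrees) public

------------------------------------------------------------------------
-- 2×n standard Young tableaux

module Tableau where

  record Tableau : Set where
    constructor tableau
    field
      top bottom : List ℕ

  open Tableau

  columns : Tableau → ℕ
  columns T = length (top T)

  record IsStandard (T : Tableau) : Set where
    field
      -- in particular the two rows have the same length
      columnsIncrease : Pointwise _<_ (top T) (bottom T)
      topIncreases    : AllPairs _<_ (top T)
      bottomIncreases : AllPairs _<_ (bottom T)
      entries         : top T ++ bottom T ↭ [1⋯ 2 * columns T ]

  tableaux : RawCatalan
  tableaux = record
    { Carrier  = Tableau
    ; IsObject = IsStandard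
    ; ∣_∣      = columns
    ; e        = tableau [] []
    ; lam      = λ T → tableau (1 ∷ map suc (top T))
                               (map suc (bottom T) ++ (2 * columns T + 2) ∷ [])
    ; _⊕_      = λ T₁ T₂ →
                   let s = map (2 * columns T₁ +_)
                   in tableau (top T₁ ++ s (top T₂)) (bottom T₁ ++ s (bottom T₂))
    }

  comp rcomp cons noncons : Tableau → ℕ
  comp T = count (λ k → sameSet? (take k (top T) ++ take k (bottom T)) [1⋯ 2 * k ])
                 [1⋯ columns T ]
  rcomp T = largest (λ k → ≡-decₗ (take k (reverse (bottom T)))
                                  (map (2 * columns T ∸_) (upTo k)))
                    (columns T)
    where ≡-decₗ = List.≡-dec _≟_
  cons    T = 1 + count (λ i → suc i ∈? top T) (top T)
  noncons T = count (λ i → suc i ∈? bottom T) (top T)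

open Tableau using (tableaux) public

------------------------------------------------------------------------
-- Non-crossing partitions

module Partition where

  -- A set partition of [n] is represented by its list of blocks, each block in
  -- decreasing order and the blocks sorted by minimal element, so that concat
  -- is the flattened form and equality of partitions is _≡_.
  Blocks : Set
  Blocks = List (List ℕ)

  size : Blocks → ℕ
  size P = length (concat P)

  record IsNonCrossing (P : Blocks) : Set where
    field
      nonEmpty    : All (_≢ []) P
      decreasing  : All (AllPairs _>_) P
      -- the minimum of a decreasing block is its last entry
      sorted      : AllPairs (λ B C → lastEntry B < lastEntry C) P
      partition   : concat P ↭ [1⋯ size P ]
      nonCrossing : ∀ {B C a b c d} → B ∈ P → C ∈ P →
                    a ∈ B → b ∈ C → c ∈ B → d ∈ C →
                    a < b → b < c → c < d → B ≡ C

  -- The block containing 1 is the first one.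
  lamBlocks : Blocks → Blocks
  lamBlocks []         = (1 ∷ []) ∷ []
  lamBlocks P@(B ∷ Bs) = (suc (size P) ∷ B) ∷ Bs

  partitions : RawCatalan
  partitions = record
    { Carrier  = Blocks
    ; IsObject = IsNonCrossing
    ; ∣_∣      = size
    ; e        = []
    ; lam      = lamBlocks
    ; _⊕_      = λ P₁ P₂ → P₁ ++ map (map (size P₁ +_)) P₂
    }

  -- [k] is a union of blocks when each block is contained in [k] or disjoint from it.
  comp rcomp blocks nonmin : Blocks → ℕ
  comp   P = count (λ k → all? (λ B → all? (_≤? k) B ⊎-dec all? (k <?_) B) P) [1⋯ size P ]
  rcomp  P = count rlMax? (splits (concat P))
  blocks P = length P
  nonmin P = (size P + 1) ∸ blocks P

open Partition using (partitions) public

{-# OPTIONS --safe #-}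

-- Every object of a Catalan structure is obtained in exactly one way from e by the
-- operation (s , v) ↦ lam s ⊕ v, so that a Catalan structure is a copy of the binary
-- trees, with node L R for lam L ⊕ R.  On trees h is an involution because T ⊖ γ W is
-- a second decomposition of the nonempty objects, with h (T ⊖ γ W) = lam (h W) ⊕ h T.
-- The four statistics are determined by how they behave under lam and ⊕, and in each
-- family they obey the same rules as comp, redge, rcomp and ledge do for trees.
--
-- Tableaux record the positions of the letters of a Dyck path, and flattening embeds
-- non-crossing partitions into the 231-avoiding permutations.  On 321-avoiding
-- permutations, lam is the inverse of a pass of bubble sort.  A triangulation is cut into
-- lam S ⊕ V at the edge from 1 to its least neighbour other than 2.

module Submission where

open import Defs
open import Data.Bool using (true; false; if_then_else_)
open import Data.Empty using (⊥-elim)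
open import Data.List using (List; []; _∷_; _++_; map; length; filter; concat; take; drop; takeWhile; reverse; upTo; applyUpTo; cartesianProduct; cartesianProductWith)
open import Data.List.Membership.Propositional using (_∈_; _∉_; find; lose)
open import Data.List.Membership.Propositional.Properties using (∈-map⁺; ∈-map⁻; ∈-++⁺ˡ; ∈-++⁺ʳ; ∈-++⁻; ∈-filter⁺; ∈-filter⁻; ∈-cartesianProductWith⁺; ∈-cartesianProduct⁺; ∈-cartesianProduct⁻; ∈-upTo⁺; ∈-upTo⁻; ∈-concat⁺′; ∈-concat⁻′)
open import Data.List.Membership.Propositional.Properties.WithK using (unique∧set⇒bag)
open import Data.List.Relation.Binary.BagAndSetEquality using (∼bag⇒↭)
open import Data.List.Relation.Binary.Permutation.Propositional using (_↭_; ↭⇒↭ₛ; ↭-refl; ↭-sym; ↭-trans; ↭-reflexive; prep; swap)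
open import Data.List.Relation.Binary.Permutation.Propositional.Properties using (↭-length; filter-↭; ∈-resp-↭; All-resp-↭; drop-∷; ∷↭∷ʳ)
open import Data.List.Relation.Binary.Pointwise using (Pointwise; Pointwise-length; []; _∷_)
open import Data.List.Relation.Binary.Sublist.Propositional as Sublist using (_⊆_; []; _∷_)
open import Data.List.Relation.Unary.All using (All; []; _∷_; all?; lookup)
open import Data.List.Relation.Unary.AllPairs using (AllPairs; []; _∷_)
open import Data.List.Relation.Unary.Any using (Any; here; there; any?)
open import Data.List.Relation.Unary.Unique.Propositional using (Unique)
open import Data.Nat
open import Data.Nat.Induction using (Acc; acc; <-wellFounded)
open import Data.Nat.Properties
open import Data.Nat.Tactic.RingSolver using (solve-∀)
open import Data.Product using (∃₂; ∃-syntax; _×_; _,_; proj₁; proj₂)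
open import Data.Sum using (_⊎_; inj₁; inj₂; [_,_]′)
open import Data.Unit using (⊤; tt)
open import Function using (_∘_; id; case_of_)
open import Function.Bundles using (mk⇔)
open import Level using (0ℓ)
open import Relation.Binary.Definitions using (tri<; tri≈; tri>)
open import Relation.Binary.PropositionalEquality
open import Relation.Nullary using (¬_; Dec; yes; no; does; contradiction)
open import Relation.Nullary.Decidable using (_×-dec_; _⊎-dec_; ¬?; dec-true; dec-false)
open import Relation.Unary using (Pred; Decidable)
open import Data.Product.Properties using (≡-dec; ,-injective)
open import Data.List.Membership.DecPropositional (≡-dec _≟_ _≟_) using () renaming (_∈?_ to _∈ₑ?_)
open import Data.List.Membership.DecPropositional _≟_ using (_∈?_)
import Data.List.Properties as List
import Data.List.Relation.Binary.Permutation.Propositional.Properties as Perm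
import Data.List.Relation.Binary.Permutation.Setoid.Properties as PermSetoid
import Data.List.Relation.Unary.All as All
import Data.List.Relation.Unary.All.Properties as All
import Data.List.Relation.Unary.AllPairs as AllPairs
import Data.List.Relation.Unary.AllPairs.Properties as AllPairs
import Data.List.Relation.Unary.Unique.Propositional.Properties as Unique

-- The statistics `b′` are never followed through `h`. Each is the complement of `b` to `n + 1`, and
-- on nonempty trees `redge (dual T) + redge T` is `suc (nodes T)`; together these give
-- `b′ (h t) ≡ b t`, so that a family has to supply rules for `b` only. The tree identity fails at
-- `∅`, where it would read `2 ≡ 1`, and the statistics take conventional values at `e` (on the
-- empty word `peak` is 0 and `nonpeak` is 1). This is where `n ≥ 1` enters, and why the rules carry
-- hypotheses `≢ e`. `h` recurses on `form`, which returns components together with proofs of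
-- `IsObject`. Such proofs may differ for the same element, so objects are compared by `≋`, and
-- statements about `h` are moved at once to trees, where `dual` is a structural recursion free of
-- proofs.

-- Counting elements of lists.

count-≡0 : ∀ {A : Set} {P : Pred A 0ℓ} (P? : Decidable P) {xs} → All (¬_ ∘ P) xs → count P? xs ≡ 0
count-≡0 P? ps = cong length (List.filter-none P? ps)

count-yes : ∀ {A : Set} {P : Pred A 0ℓ} (P? : Decidable P) {x} xs → P x → count P? (x ∷ xs) ≡ suc (count P? xs)
count-yes P? xs p = cong length (List.filter-accept P? p)

count-no : ∀ {A : Set} {P : Pred A 0ℓ} (P? : Decidable P) {x} xs → ¬ P x → count P? (x ∷ xs) ≡ count P? xs
count-no P? xs ¬p = cong length (List.filter-reject P? ¬p)

count-++ : ∀ {A : Set} {P : Pred A 0ℓ} (P? : Decidable P) xs ys →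
           count P? (xs ++ ys) ≡ count P? xs + count P? ys
count-++ P? xs ys = trans (cong length (List.filter-++ P? xs ys)) (List.length-++ (filter P? xs))

count-↭ : ∀ {A : Set} {P : Pred A 0ℓ} (P? : Decidable P) {xs ys} → xs ↭ ys → count P? xs ≡ count P? ys
count-↭ P? p = ↭-length (filter-↭ P? p)

count-cong : ∀ {A B : Set} {P : Pred A 0ℓ} {Q : Pred B 0ℓ} (P? : Decidable P) (Q? : Decidable Q)
             (f : A → B) xs →
             All (λ x → (P x → Q (f x)) × (Q (f x) → P x)) xs → count P? xs ≡ count Q? (map f xs)
count-cong P? Q? f [] [] = refl
count-cong P? Q? f (x ∷ xs) ((to , from) ∷ ps) with P? x
... | yes p = trans (cong suc (count-cong P? Q? f xs ps)) (sym (count-yes Q? (map f xs) (to p)))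
... | no ¬p = trans (count-cong P? Q? f xs ps) (sym (count-no Q? (map f xs) (¬p ∘ from)))

count-complement : ∀ {A : Set} {P : Pred A 0ℓ} (P? : Decidable P) xs →
                   count (λ x → ¬? (P? x)) xs + count P? xs ≡ length xs
count-complement P? [] = refl
count-complement P? (x ∷ xs) with P? x
... | yes _ = trans (+-suc _ _) (cong suc (count-complement P? xs))
... | no _  = cong suc (count-complement P? xs)

unique-set⇒↭ : ∀ {A : Set} {xs ys : List A} → Unique xs → Unique ys →
               (∀ {x} → x ∈ xs → x ∈ ys) → (∀ {x} → x ∈ ys → x ∈ xs) → xs ↭ ys
unique-set⇒↭ u v to from = ∼bag⇒↭ (unique∧set⇒bag u v (mk⇔ to from))

-- The Catalan structure of binary trees

open BinaryTree using (Tree; ∅; node; nodes; graft)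

node-injective : ∀ {L R L′ R′} → node L R ≡ node L′ R′ → L ≡ L′ × R ≡ R′
node-injective refl = refl , refl

graft-∅ : ∀ T → graft T ∅ ≡ T
graft-∅ ∅          = refl
graft-∅ (node L R) = cong (node L) (graft-∅ R)

graft-assoc : ∀ T U V → graft (graft T U) V ≡ graft T (graft U V)
graft-assoc ∅          U V = refl
graft-assoc (node L R) U V = cong (node L) (graft-assoc R U V)

nodes-graft : ∀ T U → nodes (graft T U) ≡ nodes T + nodes U
nodes-graft ∅          U = refl
nodes-graft (node L R) U =
  cong suc (trans (cong (nodes L +_) (nodes-graft R U)) (sym (+-assoc (nodes L) _ _)))

-- The map `h` on trees and its effect on the tree statistics.

infixr 6 _⊖ᵗ_
-- Passing to the last node of the right spine and then to its left subtree, again and again, ends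
-- at an empty tree, and `V` is put there. The clause for `(t ⊕ u) ⊖ v` is used with `t` a single
-- spine node.
_⊖ᵗ_ : Tree → Tree → Tree
∅                   ⊖ᵗ V = V
node L ∅            ⊖ᵗ V = node (L ⊖ᵗ V) ∅
node L R@(node _ _) ⊖ᵗ V = node L (R ⊖ᵗ V)

γᵗ : Tree → Tree
γᵗ T = graft T (node ∅ ∅)

dual : Tree → Tree
dual ∅          = ∅
dual (node L R) = dual R ⊖ᵗ γᵗ (dual L)

γᵗ≢∅ : ∀ T → γᵗ T ≢ ∅
γᵗ≢∅ ∅          ()
γᵗ≢∅ (node _ _) ()

⊖ᵗ≢∅ : ∀ T V → V ≢ ∅ → T ⊖ᵗ V ≢ ∅
⊖ᵗ≢∅ ∅                     V n = n
⊖ᵗ≢∅ (node L ∅)            V n ()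
⊖ᵗ≢∅ (node L (node _ _))   V n ()

node-⊖ᵗ : ∀ L R V → R ≢ ∅ → node L R ⊖ᵗ V ≡ node L (R ⊖ᵗ V)
node-⊖ᵗ L ∅          V n = ⊥-elim (n refl)
node-⊖ᵗ L (node _ _) V n = refl

nodes-⊖ᵗ : ∀ T V → nodes (T ⊖ᵗ V) ≡ nodes T + nodes V
nodes-⊖ᵗ ∅                       V = refl
nodes-⊖ᵗ (node L ∅)              V = cong suc (begin
  nodes (L ⊖ᵗ V) + 0          ≡⟨ +-identityʳ _ ⟩
  nodes (L ⊖ᵗ V)              ≡⟨ nodes-⊖ᵗ L V ⟩
  nodes L + nodes V           ≡⟨ cong (_+ nodes V) (sym (+-identityʳ (nodes L))) ⟩
  nodes L + 0 + nodes V       ∎)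
  where open ≡-Reasoning
nodes-⊖ᵗ (node L R@(node _ _))   V =
  cong suc (trans (cong (nodes L +_) (nodes-⊖ᵗ R V)) (sym (+-assoc (nodes L) (nodes R) (nodes V))))

nodes-γᵗ : ∀ T → nodes (γᵗ T) ≡ suc (nodes T)
nodes-γᵗ T = trans (nodes-graft T (node ∅ ∅)) (+-comm (nodes T) 1)

nodes-dual : ∀ T → nodes (dual T) ≡ nodes T
nodes-dual ∅          = refl
nodes-dual (node L R) = begin
  nodes (dual R ⊖ᵗ γᵗ (dual L))           ≡⟨ nodes-⊖ᵗ (dual R) (γᵗ (dual L)) ⟩
  nodes (dual R) + nodes (γᵗ (dual L))    ≡⟨ cong₂ _+_ (nodes-dual R) (trans (nodes-γᵗ (dual L)) (cong suc (nodes-dual L))) ⟩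
  nodes R + suc (nodes L)                 ≡⟨ +-suc (nodes R) (nodes L) ⟩
  suc (nodes R + nodes L)                 ≡⟨ cong suc (+-comm (nodes R) (nodes L)) ⟩
  suc (nodes L + nodes R)                 ∎
  where open ≡-Reasoning

node-≢∅ : ∀ {L R} → node L R ≢ ∅
node-≢∅ ()

dual-≢∅ : ∀ T → T ≢ ∅ → dual T ≢ ∅
dual-≢∅ ∅          n = n
dual-≢∅ (node L R) n = ⊖ᵗ≢∅ (dual R) _ (γᵗ≢∅ (dual L))

-- This is the base case of `dual-⊖ᵗ`. In the inductive step the left operand has become
-- `node (dual R) ∅`, and there `⊖ᵗ` moves on to the left subtree by definition.
dual-γᵗ : ∀ T → dual (γᵗ T) ≡ node (dual T) ∅
dual-γᵗ ∅          = refl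
dual-γᵗ (node L R) = cong (_⊖ᵗ γᵗ (dual L)) (dual-γᵗ R)

-- T ⊖ γ W is a second decomposition of the nonempty trees, and dual swaps it with node W T.
dual-⊖ᵗ : ∀ T W → dual (T ⊖ᵗ γᵗ W) ≡ node (dual W) (dual T)
dual-⊖ᵗ ∅                     W = dual-γᵗ W
dual-⊖ᵗ (node L ∅)            W = cong γᵗ (dual-⊖ᵗ L W)
dual-⊖ᵗ (node L R@(node _ _)) W =
  trans (cong (_⊖ᵗ γᵗ (dual L)) (dual-⊖ᵗ R W))
        (node-⊖ᵗ (dual W) (dual R) (γᵗ (dual L)) (dual-≢∅ R node-≢∅))

dual-involutive : ∀ T → dual (dual T) ≡ T
dual-involutive ∅          = refl
dual-involutive (node L R) =
  trans (dual-⊖ᵗ (dual R) (dual L)) (cong₂ node (dual-involutive L) (dual-involutive R))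

module _ where
  open BinaryTree

  rcomp-node : ∀ L R → R ≢ ∅ → rcomp (node L R) ≡ rcomp R
  rcomp-node L ∅          n = ⊥-elim (n refl)
  rcomp-node L (node _ _) n = refl

  rcomp-γᵗ : ∀ T → rcomp (γᵗ T) ≡ 1
  rcomp-γᵗ ∅          = refl
  rcomp-γᵗ (node L R) = trans (rcomp-node L (γᵗ R) (γᵗ≢∅ R)) (rcomp-γᵗ R)

  -- The operation grafts at the end of the chain of left subtrees that `rcomp` follows. There
  -- `γᵗ W` adds exactly one iteration, since the last node of its spine has an empty left subtree.
  rcomp-⊖ᵗ : ∀ T W → rcomp (T ⊖ᵗ γᵗ W) ≡ suc (rcomp T)
  rcomp-⊖ᵗ ∅                     W = rcomp-γᵗ W
  rcomp-⊖ᵗ (node L ∅)            W = cong suc (rcomp-⊖ᵗ L W)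
  rcomp-⊖ᵗ (node L R@(node _ _)) W =
    trans (rcomp-node L (R ⊖ᵗ γᵗ W) (⊖ᵗ≢∅ R _ (γᵗ≢∅ W))) (rcomp-⊖ᵗ R W)

  rcomp-dual : ∀ T → rcomp (dual T) ≡ comp T
  rcomp-dual ∅          = refl
  rcomp-dual (node L R) = trans (rcomp-⊖ᵗ (dual R) (dual L)) (cong suc (rcomp-dual R))

  -- The offset 1 in `redge` pays for the edge from the root to `R`; this makes `redge` additive.
  redge-node : ∀ L R → R ≢ ∅ → redge (node L R) ≡ redge (node L ∅) + redge R
  redge-node L ∅          n = ⊥-elim (n refl)
  redge-node L (node L′ R′) n = cong suc (sym (+-suc (rightEdges L) (rightEdges (node L′ R′))))

  redge-γᵗ : ∀ T → T ≢ ∅ → redge (γᵗ T) ≡ suc (redge T)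
  redge-γᵗ ∅ n = ⊥-elim (n refl)
  redge-γᵗ (node L ∅) n = cong (suc ∘ suc) (+-identityʳ (rightEdges L))
  redge-γᵗ (node L R@(node _ _)) n =
    trans (redge-node L (γᵗ R) (γᵗ≢∅ R))
    (trans (cong (redge (node L ∅) +_) (redge-γᵗ R node-≢∅))
    (trans (+-suc (redge (node L ∅)) (redge R)) (cong suc (sym (redge-node L R node-≢∅)))))

  -- The junction is a left edge, so the right edges of the two trees simply add up. The offset 1 of
  -- `redge` occurs once on the left, where `suc` makes up for it, and twice on the right.
  suc-redge-⊖ᵗ : ∀ T W → T ≢ ∅ → W ≢ ∅ → suc (redge (T ⊖ᵗ W)) ≡ redge T + redge W
  suc-redge-⊖ᵗ ∅                       W n m = ⊥-elim (n refl)
  suc-redge-⊖ᵗ (node ∅ ∅)              W n m = refl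
  suc-redge-⊖ᵗ (node L@(node _ _) ∅)   W n m = suc-redge-⊖ᵗ L W node-≢∅ m
  suc-redge-⊖ᵗ (node L R@(node _ _))   W n m = begin
    suc (redge (node L (R ⊖ᵗ W)))                ≡⟨ cong suc (redge-node L (R ⊖ᵗ W) (⊖ᵗ≢∅ R W m)) ⟩
    suc (redge (node L ∅) + redge (R ⊖ᵗ W))      ≡⟨ sym (+-suc (redge (node L ∅)) (redge (R ⊖ᵗ W))) ⟩
    redge (node L ∅) + suc (redge (R ⊖ᵗ W))      ≡⟨ cong (redge (node L ∅) +_) (suc-redge-⊖ᵗ R W node-≢∅ m) ⟩
    redge (node L ∅) + (redge R + redge W)       ≡⟨ sym (+-assoc (redge (node L ∅)) (redge R) (redge W)) ⟩
    redge (node L ∅) + redge R + redge W         ≡⟨ cong (_+ redge W) (sym (redge-node L R node-≢∅)) ⟩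
    redge (node L R) + redge W                   ∎
    where open ≡-Reasoning

  -- As a tree has one edge fewer than nodes, this says that `dual` exchanges the numbers of left
  -- and right edges. A nonempty `L`, which costs a left edge, yields a right edge through `γᵗ`; a
  -- nonempty `R` yields a left edge through `⊖ᵗ`. Hence the four cases.
  redge-dual : ∀ T → T ≢ ∅ → redge (dual T) + redge T ≡ suc (nodes T)
  redge-dual ∅ n = ⊥-elim (n refl)
  redge-dual (node ∅ ∅) n = refl
  redge-dual (node L@(node _ _) ∅) n =
    trans (cong (_+ redge L) (redge-γᵗ (dual L) (dual-≢∅ L node-≢∅)))
          (cong suc (trans (redge-dual L node-≢∅) (cong suc (sym (+-identityʳ (nodes L))))))
  redge-dual (node ∅ R@(node _ _)) n = suc-injective (begin
    suc (redge (dual R ⊖ᵗ node ∅ ∅) + suc (redge R))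
      ≡⟨ cong (_+ suc (redge R)) (suc-redge-⊖ᵗ (dual R) (node ∅ ∅) (dual-≢∅ R node-≢∅) node-≢∅) ⟩
    redge (dual R) + 1 + suc (redge R)   ≡⟨ cong (_+ suc (redge R)) (+-comm (redge (dual R)) 1) ⟩
    suc (redge (dual R) + suc (redge R)) ≡⟨ cong suc (+-suc (redge (dual R)) (redge R)) ⟩
    suc (suc (redge (dual R) + redge R)) ≡⟨ cong (suc ∘ suc) (redge-dual R node-≢∅) ⟩
    suc (suc (suc (nodes R)))            ∎)
    where open ≡-Reasoning
  redge-dual (node L@(node _ _) R@(node _ _)) n = suc-injective (begin
    suc (redge (dual R ⊖ᵗ γᵗ (dual L)) + redge (node L R))
      ≡⟨ cong (_+ redge (node L R)) (suc-redge-⊖ᵗ (dual R) (γᵗ (dual L)) (dual-≢∅ R node-≢∅) (γᵗ≢∅ (dual L))) ⟩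
    redge (dual R) + redge (γᵗ (dual L)) + redge (node L R)
      ≡⟨ cong₂ (λ a b → redge (dual R) + a + b) (redge-γᵗ (dual L) (dual-≢∅ L node-≢∅)) (redge-node L R node-≢∅) ⟩
    redge (dual R) + suc (redge (dual L)) + (redge L + redge R)
      ≡⟨ rearrange (redge (dual R)) (redge (dual L)) (redge L) (redge R) ⟩
    suc ((redge (dual L) + redge L) + (redge (dual R) + redge R))
      ≡⟨ cong suc (cong₂ _+_ (redge-dual L node-≢∅) (redge-dual R node-≢∅)) ⟩
    suc (suc (nodes L) + suc (nodes R))
      ≡⟨ cong (suc ∘ suc) (+-suc (nodes L) (nodes R)) ⟩
    suc (suc (suc (nodes L + nodes R)))  ∎)
    where
    open ≡-Reasoning
    rearrange : ∀ a b c e → a + suc b + (c + e) ≡ suc ((b + c) + (a + e))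
    rearrange = solve-∀

  rightEdges<nodes : ∀ L R → rightEdges (node L R) ≤ nodes L + nodes R
  rightEdges<nodes ∅ ∅ = z≤n
  rightEdges<nodes (node L₁ R₁) ∅ =
    ≤-trans (rightEdges<nodes L₁ R₁) (≤-trans (n≤1+n _) (m≤m+n _ 0))
  rightEdges<nodes ∅ (node L R) = s≤s (rightEdges<nodes L R)
  rightEdges<nodes (node L₁ R₁) (node L₂ R₂) =
    ≤-trans (s≤s (+-mono-≤ (rightEdges<nodes L₁ R₁) (rightEdges<nodes L₂ R₂)))
      (s≤s (+-monoʳ-≤ _ (n≤1+n _)))

  redge≤suc-nodes : ∀ T → redge T ≤ suc (nodes T)
  redge≤suc-nodes ∅          = ≤-refl
  redge≤suc-nodes (node L R) = s≤s (≤-trans (rightEdges<nodes L R) (n≤1+n _))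

-- Enumeration of the trees of a given size.

-- Bounding the height keeps the recursion structural, with no splitting of the size between the
-- subtrees. A tree with `n` nodes has height at most `n`, so filtering by size loses nothing.
trees-of-height≤ : ℕ → List Tree
trees-of-height≤ zero    = ∅ ∷ []
trees-of-height≤ (suc k) = ∅ ∷ cartesianProductWith node (trees-of-height≤ k) (trees-of-height≤ k)

trees-of-height≤-unique : ∀ k → Unique (trees-of-height≤ k)
trees-of-height≤-unique zero    = [] ∷ []
trees-of-height≤-unique (suc k) =
  All.tabulate (λ { p refl → ∅∉ (trees-of-height≤ k) (trees-of-height≤ k) p })
  ∷ Unique.cartesianProductWith⁺ node node-injective (trees-of-height≤-unique k) (trees-of-height≤-unique k)
  where
  ∅∉ : ∀ xs ys → ∅ ∉ cartesianProductWith node xs ys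
  ∅∉ (x ∷ xs) ys p with ∈-++⁻ (map (node x) ys) p
  ... | inj₁ q with ∈-map⁻ (node x) q
  ...   | _ , _ , ()
  ∅∉ (x ∷ xs) ys p | inj₂ q = ∅∉ xs ys q

trees-of-height≤-complete : ∀ k T → nodes T ≤ k → T ∈ trees-of-height≤ k
trees-of-height≤-complete zero    ∅ le = here refl
trees-of-height≤-complete (suc k) ∅ le = here refl
trees-of-height≤-complete (suc k) (node L R) (s≤s le) = there (∈-cartesianProductWith⁺ node
  (trees-of-height≤-complete k L (≤-trans (m≤m+n _ _) le))
  (trees-of-height≤-complete k R (≤-trans (m≤n+m _ _) le)))

trees : ℕ → List Tree
trees n = filter (λ T → nodes T ≟ n) (trees-of-height≤ n)

trees-unique : ∀ n → Unique (trees n)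
trees-unique n = Unique.filter⁺ _ (trees-of-height≤-unique n)

∈-trees⁺ : ∀ T → T ∈ trees (nodes T)
∈-trees⁺ T = ∈-filter⁺ (λ T′ → nodes T′ ≟ nodes T) (trees-of-height≤-complete _ T ≤-refl) refl

∈-trees⁻ : ∀ n {T} → T ∈ trees n → nodes T ≡ n
∈-trees⁻ n p = proj₂ (∈-filter⁻ (λ T → nodes T ≟ n) {xs = trees-of-height≤ n} p)

dual-injective : ∀ {T U} → dual T ≡ dual U → T ≡ U
dual-injective {T} {U} eq = trans (sym (dual-involutive T)) (trans (cong dual eq) (dual-involutive U))

-- This turns the pointwise identities between statistics into the equality of joint distributions.
trees-dual : ∀ n → map dual (trees n) ↭ trees n
trees-dual n = unique-set⇒↭ (Unique.map⁺ dual-injective (trees-unique n)) (trees-unique n) to from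
  where
  dual∈ : ∀ {T} → T ∈ trees n → dual T ∈ trees n
  dual∈ {T} p = subst (λ k → dual T ∈ trees k) (trans (nodes-dual T) (∈-trees⁻ n p)) (∈-trees⁺ (dual T))
  to : ∀ {T} → T ∈ map dual (trees n) → T ∈ trees n
  to p with ∈-map⁻ dual p
  ... | T , q , refl = dual∈ q
  from : ∀ {T} → T ∈ trees n → T ∈ map dual (trees n)
  from {T} p = subst (_∈ map dual (trees n)) (dual-involutive T) (∈-map⁺ dual (dual∈ p))

-- A criterion for Catalan structures: form and its uniqueness are replaced by
-- the single decomposition lam s ⊕ v of the nonempty objects.
record Presentation (R : RawCatalan) : Set where
  open RawCatalan R
  field
    e-isObject   : IsObject e
    lam-isObject : ∀ {t} → IsObject t → IsObject (lam t)
    ⊕-isObject   : ∀ {t u} → IsObject t → IsObject u → IsObject (t ⊕ u)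
    ∣e∣          : ∣ e ∣ ≡ 0
    ∣lam∣        : ∀ {t} → IsObject t → ∣ lam t ∣ ≡ suc ∣ t ∣
    ∣⊕∣          : ∀ {t u} → IsObject t → IsObject u → ∣ t ⊕ u ∣ ≡ ∣ t ∣ + ∣ u ∣
    ⊕-assoc      : ∀ {t u v} → IsObject t → IsObject u → IsObject v → (t ⊕ u) ⊕ v ≡ t ⊕ (u ⊕ v)
    ⊕-identityˡ  : ∀ {t} → IsObject t → e ⊕ t ≡ t
    ⊕-identityʳ  : ∀ {t} → IsObject t → t ⊕ e ≡ t
    decompose    : ∀ {t} → IsObject t →
                   t ≡ e ⊎ ∃₂ λ s v → IsObject s × IsObject v × t ≡ lam s ⊕ v
    cancel       : ∀ {s v s′ v′} → IsObject s → IsObject v → IsObject s′ → IsObject v′ →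
                   lam s ⊕ v ≡ lam s′ ⊕ v′ → s ≡ s′ × v ≡ v′

-- From trees to an arbitrary presented family.

module FromPresentation {R : RawCatalan} (pres : Presentation R) where
  open RawCatalan R
  open Presentation pres

  ∣lam⊕∣ : ∀ {s v} → IsObject s → IsObject v → ∣ lam s ⊕ v ∣ ≡ suc (∣ s ∣ + ∣ v ∣)
  ∣lam⊕∣ {v = v} p q = trans (∣⊕∣ (lam-isObject p) q) (cong (_+ ∣ v ∣) (∣lam∣ p))

  lam⊕≢e : ∀ {s v} → IsObject s → IsObject v → lam s ⊕ v ≢ e
  lam⊕≢e p q eq = 1+n≢0 (trans (sym (∣lam⊕∣ p q)) (trans (cong ∣_∣ eq) ∣e∣))

  private
    lam-⊕e : ∀ {s} → IsObject s → lam s ≡ lam s ⊕ e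
    lam-⊕e p = sym (⊕-identityʳ (lam-isObject p))

    size-e : ∀ {t} → IsObject t → ∣ t ∣ ≡ 0 → t ≡ e
    size-e p eq with decompose p
    ... | inj₁ t≡e = t≡e
    ... | inj₂ (s , v , ps , pv , refl) = ⊥-elim (1+n≢0 (trans (sym (∣lam⊕∣ ps pv)) eq))

    size-≢e : ∀ {t k} → ∣ t ∣ ≡ suc k → t ≢ e
    size-≢e eq refl = 1+n≢0 (trans (sym eq) ∣e∣)

    form′ : ∀ {t} → IsObject t → Form t
    form′ p with decompose p
    ... | inj₁ t≡e = empty t≡e
    -- The size decides whether `v` is `e`, on a carrier that comes with no decidable equality.
    ... | inj₂ (s , v , ps , pv , refl) with ∣ v ∣ in eq
    ...   | zero  = indecomposable s ps
                      (trans (cong (lam s ⊕_) (size-e pv eq)) (⊕-identityʳ (lam-isObject ps)))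
    ...   | suc _ = decomposable (lam s) v (s , ps , refl) pv (size-≢e eq) refl

  isCatalan : IsCatalan R
  isCatalan = record
    { e-isObject    = e-isObject
    ; lam-isObject  = lam-isObject
    ; ⊕-isObject    = ⊕-isObject
    ; ∣e∣           = ∣e∣
    ; ∣t∣≡0         = size-e
    ; ∣lam∣         = ∣lam∣
    ; ∣⊕∣           = ∣⊕∣
    ; ⊕-assoc       = ⊕-assoc
    ; ⊕-identityˡ   = ⊕-identityˡ
    ; ⊕-identityʳ   = ⊕-identityʳ
    ; form          = form′
    ; lam≢e         = λ p → size-≢e (∣lam∣ p)
    ; ⊕≢e           = λ { (_ , p , refl) q _ → lam⊕≢e p q }
    -- Reading `lam s` as `lam s ⊕ e`, cancellation would force `v ≡ e`.
    ; lam≢⊕         = λ { p (_ , q , refl) r v≢e eq →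
                        v≢e (sym (proj₂ (cancel p e-isObject q r (trans (sym (lam-⊕e p)) eq)))) }
    ; lam-injective = λ p q eq → proj₁ (cancel p e-isObject q e-isObject
                        (trans (sym (lam-⊕e p)) (trans eq (lam-⊕e q))))
    ; ⊕-unique      = λ { (_ , p , refl) q _ (_ , p′ , refl) q′ _ eq →
                        let (s≡ , v≡) = cancel p q p′ q′ eq in cong lam s≡ , v≡ }
    }

  ⟦_⟧ : Tree → Carrier
  ⟦ ∅ ⟧        = e
  ⟦ node L R ⟧ = lam ⟦ L ⟧ ⊕ ⟦ R ⟧

  ⟦⟧-isObject : ∀ T → IsObject ⟦ T ⟧
  ⟦⟧-isObject ∅          = e-isObject
  ⟦⟧-isObject (node L R) = ⊕-isObject (lam-isObject (⟦⟧-isObject L)) (⟦⟧-isObject R)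

  ∣⟦⟧∣ : ∀ T → ∣ ⟦ T ⟧ ∣ ≡ nodes T
  ∣⟦⟧∣ ∅          = ∣e∣
  ∣⟦⟧∣ (node L R) = trans (∣lam⊕∣ (⟦⟧-isObject L) (⟦⟧-isObject R))
                          (cong suc (cong₂ _+_ (∣⟦⟧∣ L) (∣⟦⟧∣ R)))

  ⟦⟧-injective : ∀ T U → ⟦ T ⟧ ≡ ⟦ U ⟧ → T ≡ U
  ⟦⟧-injective ∅ ∅ eq = refl
  ⟦⟧-injective ∅ (node L R) eq = ⊥-elim (lam⊕≢e (⟦⟧-isObject L) (⟦⟧-isObject R) (sym eq))
  ⟦⟧-injective (node L R) ∅ eq = ⊥-elim (lam⊕≢e (⟦⟧-isObject L) (⟦⟧-isObject R) eq)
  ⟦⟧-injective (node L R) (node L′ R′) eq =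
    let (L≡ , R≡) = cancel (⟦⟧-isObject L) (⟦⟧-isObject R) (⟦⟧-isObject L′) (⟦⟧-isObject R′) eq
    in cong₂ node (⟦⟧-injective L L′ L≡) (⟦⟧-injective R R′ R≡)

  ⟦⟧-surjective : ∀ {t} → IsObject t → ∃[ T ] (t ≡ ⟦ T ⟧)
  ⟦⟧-surjective {t} p = go p (<-wellFounded ∣ t ∣)
    where
    go : ∀ {t} → IsObject t → Acc _<_ ∣ t ∣ → ∃[ T ] (t ≡ ⟦ T ⟧)
    go p (acc rs) with decompose p
    ... | inj₁ eq = ∅ , eq
    ... | inj₂ (s , v , ps , pv , refl) =
      let lt = ≤-reflexive (sym (∣lam⊕∣ ps pv))
          (L , s≡) = go ps (rs (≤-trans (s≤s (m≤m+n ∣ s ∣ ∣ v ∣)) lt))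
          (R , v≡) = go pv (rs (≤-trans (s≤s (m≤n+m ∣ v ∣ ∣ s ∣)) lt))
      in node L R , cong₂ (λ x y → lam x ⊕ y) s≡ v≡

  ⟦⟧-graft : ∀ T U → ⟦ graft T U ⟧ ≡ ⟦ T ⟧ ⊕ ⟦ U ⟧
  ⟦⟧-graft ∅          U = sym (⊕-identityˡ (⟦⟧-isObject U))
  ⟦⟧-graft (node L R) U = trans (cong (lam ⟦ L ⟧ ⊕_) (⟦⟧-graft R U))
    (sym (⊕-assoc (lam-isObject (⟦⟧-isObject L)) (⟦⟧-isObject R) (⟦⟧-isObject U)))

  ⟦⟧-γ : ∀ T → ⟦ γᵗ T ⟧ ≡ ⟦ T ⟧ ⊕ lam e
  ⟦⟧-γ T = trans (⟦⟧-graft T (node ∅ ∅)) (cong (⟦ T ⟧ ⊕_) (⊕-identityʳ (lam-isObject e-isObject)))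

  module C = CatalanMap isCatalan

  ⟦_⟧ᵒ : Tree → Object
  ⟦ T ⟧ᵒ = object ⟦ T ⟧ (⟦⟧-isObject T)

  lam≢e : ∀ {s} → IsObject s → lam s ≢ e
  lam≢e p = size-≢e (∣lam∣ p)

  -- The clauses of `⊖ᵗ` correspond to `⊖-e`, `⊖-lam` and `⊖-⊕`. A one-node spine is interpreted as
  -- `lam s ⊕ e`, so the middle case passes to `lam s` and back.
  ⟦⟧-⊖ : ∀ T V → elem (⟦ T ⟧ᵒ C.⊖ ⟦ V ⟧ᵒ) ≡ ⟦ T ⊖ᵗ V ⟧
  ⟦⟧-⊖ ∅ V = trans (C.⊖-cong ⟦ ∅ ⟧ᵒ C.e ⟦ V ⟧ᵒ ⟦ V ⟧ᵒ refl refl) (C.⊖-e ⟦ V ⟧ᵒ)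
  ⟦⟧-⊖ (node L ∅) V =
    trans (C.⊖-cong ⟦ node L ∅ ⟧ᵒ (C.lam ⟦ L ⟧ᵒ) ⟦ V ⟧ᵒ ⟦ V ⟧ᵒ
             (⊕-identityʳ (lam-isObject (⟦⟧-isObject L))) refl)
    (trans (C.⊖-lam ⟦ L ⟧ᵒ ⟦ V ⟧ᵒ)
    (trans (cong lam (⟦⟧-⊖ L V)) (lam-⊕e (⟦⟧-isObject (L ⊖ᵗ V)))))
  ⟦⟧-⊖ (node L R@(node L′ R′)) V =
    trans (C.⊖-cong ⟦ node L R ⟧ᵒ (C.lam ⟦ L ⟧ᵒ C.⊕ ⟦ R ⟧ᵒ) ⟦ V ⟧ᵒ ⟦ V ⟧ᵒ refl refl)
    (trans (C.⊖-⊕ (C.lam ⟦ L ⟧ᵒ) ⟦ R ⟧ᵒ ⟦ V ⟧ᵒ (lam≢e (⟦⟧-isObject L))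
             (lam⊕≢e (⟦⟧-isObject L′) (⟦⟧-isObject R′)))
           (cong (lam ⟦ L ⟧ ⊕_) (⟦⟧-⊖ R V)))

  h-⟦⟧ : ∀ T → elem (C.h ⟦ T ⟧ᵒ) ≡ ⟦ dual T ⟧
  h-⟦⟧ ∅ = trans (C.h-cong ⟦ ∅ ⟧ᵒ C.e refl) C.h-e
  h-⟦⟧ (node L R) =
    trans (C.h-cong ⟦ node L R ⟧ᵒ (C.lam ⟦ L ⟧ᵒ C.⊕ ⟦ R ⟧ᵒ) refl)
    (trans (C.h-lam-⊕ ⟦ L ⟧ᵒ ⟦ R ⟧ᵒ)
    (trans (C.⊖-cong (C.h ⟦ R ⟧ᵒ) ⟦ dual R ⟧ᵒ (C.γ (C.h ⟦ L ⟧ᵒ)) ⟦ γᵗ (dual L) ⟧ᵒ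
             (h-⟦⟧ R) (trans (cong (_⊕ lam e) (h-⟦⟧ L)) (sym (⟦⟧-γ (dual L)))))
           (⟦⟧-⊖ (dual R) (γᵗ (dual L)))))

  -- a and a′ generalise comp and rcomp; b is additive and fixed by lam, b′ is its complement.
  record StatisticLaws (a b a′ b′ : Carrier → ℕ) : Set where
    field
      a-e      : a e ≡ 0
      a-lam⊕   : ∀ {u v} → IsObject u → IsObject v → a (lam u ⊕ v) ≡ suc (a v)
      a′-lam-e : a′ (lam e) ≡ 1
      a′-lam   : ∀ {u} → IsObject u → u ≢ e → a′ (lam u) ≡ suc (a′ u)
      a′-lam⊕  : ∀ {u v} → IsObject u → IsObject v → v ≢ e → a′ (lam u ⊕ v) ≡ a′ v
      b-lam-e  : b (lam e) ≡ 1
      b-lam    : ∀ {u} → IsObject u → u ≢ e → b (lam u) ≡ b u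
      b-lam⊕   : ∀ {u v} → IsObject u → IsObject v → v ≢ e → b (lam u ⊕ v) ≡ b (lam u) + b v
      b′-b     : ∀ {t} → IsObject t → t ≢ e → b′ t + b t ≡ suc ∣ t ∣

  module _ {a b a′ b′} (laws : StatisticLaws a b a′ b′) where
    open StatisticLaws laws

    ⟦⟧≢e : ∀ T → T ≢ ∅ → ⟦ T ⟧ ≢ e
    ⟦⟧≢e T T≢∅ eq = T≢∅ (⟦⟧-injective T ∅ eq)

    ⟦⟧-leaf : ∀ L → ⟦ node L ∅ ⟧ ≡ lam ⟦ L ⟧
    ⟦⟧-leaf L = ⊕-identityʳ (lam-isObject (⟦⟧-isObject L))

    a-⟦⟧ : ∀ T → a ⟦ T ⟧ ≡ BinaryTree.comp T
    a-⟦⟧ ∅          = a-e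
    a-⟦⟧ (node L R) = trans (a-lam⊕ (⟦⟧-isObject L) (⟦⟧-isObject R)) (cong suc (a-⟦⟧ R))

    mutual
      -- The laws prescribe no value of `a′` at `e` (for 321-avoiding permutations it is 1, not 0),
      -- so `L = ∅` is singled out and the recursion stays on nonempty trees. The same is done for
      -- `b`.
      a′-lam-⟦⟧ : ∀ L → a′ (lam ⟦ L ⟧) ≡ suc (BinaryTree.rcomp L)
      a′-lam-⟦⟧ ∅            = a′-lam-e
      a′-lam-⟦⟧ L@(node _ _) =
        trans (a′-lam (⟦⟧-isObject L) (⟦⟧≢e L node-≢∅)) (cong suc (a′-⟦⟧ L node-≢∅))

      a′-⟦⟧ : ∀ T → T ≢ ∅ → a′ ⟦ T ⟧ ≡ BinaryTree.rcomp T
      a′-⟦⟧ ∅ n = ⊥-elim (n refl)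
      a′-⟦⟧ (node L ∅) n = trans (cong a′ (⟦⟧-leaf L)) (a′-lam-⟦⟧ L)
      a′-⟦⟧ (node L R@(node _ _)) n =
        trans (a′-lam⊕ (⟦⟧-isObject L) (⟦⟧-isObject R) (⟦⟧≢e R node-≢∅)) (a′-⟦⟧ R node-≢∅)

    mutual
      b-lam-⟦⟧ : ∀ L → b (lam ⟦ L ⟧) ≡ BinaryTree.redge (node L ∅)
      b-lam-⟦⟧ ∅            = b-lam-e
      b-lam-⟦⟧ L@(node _ _) = trans (b-lam (⟦⟧-isObject L) (⟦⟧≢e L node-≢∅)) (b-⟦⟧ L node-≢∅)

      b-⟦⟧ : ∀ T → T ≢ ∅ → b ⟦ T ⟧ ≡ BinaryTree.redge T
      b-⟦⟧ ∅ n = ⊥-elim (n refl)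
      b-⟦⟧ (node L ∅) n = trans (cong b (⟦⟧-leaf L)) (b-lam-⟦⟧ L)
      b-⟦⟧ (node L R@(node _ _)) n =
        trans (b-lam⊕ (⟦⟧-isObject L) (⟦⟧-isObject R) (⟦⟧≢e R node-≢∅))
        (trans (cong₂ _+_ (b-lam-⟦⟧ L) (b-⟦⟧ R node-≢∅)) (sym (redge-node L R node-≢∅)))

    a-dual : ∀ T → T ≢ ∅ → a′ ⟦ dual T ⟧ ≡ a ⟦ T ⟧
    a-dual T n = trans (a′-⟦⟧ (dual T) (dual-≢∅ T n)) (trans (rcomp-dual T) (sym (a-⟦⟧ T)))

    -- Adding `b ⟦ dual T ⟧` makes both sides `suc (nodes T)`: the left by `b′-b`, the right by
    -- `redge-dual`.
    b-dual : ∀ T → T ≢ ∅ → b′ ⟦ dual T ⟧ ≡ b ⟦ T ⟧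
    b-dual T n = +-cancelʳ-≡ (b ⟦ dual T ⟧) (b′ ⟦ dual T ⟧) (b ⟦ T ⟧) (begin
      b′ ⟦ dual T ⟧ + b ⟦ dual T ⟧   ≡⟨ b′-b (⟦⟧-isObject (dual T)) (⟦⟧≢e (dual T) (dual-≢∅ T n)) ⟩
      suc ∣ ⟦ dual T ⟧ ∣             ≡⟨ cong suc (trans (∣⟦⟧∣ (dual T)) (nodes-dual T)) ⟩
      suc (nodes T)                  ≡⟨ sym (redge-dual T n) ⟩
      BinaryTree.redge (dual T) + BinaryTree.redge T
        ≡⟨ +-comm (BinaryTree.redge (dual T)) _ ⟩
      BinaryTree.redge T + BinaryTree.redge (dual T)
        ≡⟨ sym (cong₂ _+_ (b-⟦⟧ T n) (b-⟦⟧ (dual T) (dual-≢∅ T n))) ⟩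
      b ⟦ T ⟧ + b ⟦ dual T ⟧         ∎)
      where open ≡-Reasoning

    enumeration : ∀ n → Enumeration R n
    enumeration n = record
      { objects  = map ⟦_⟧ (trees n)
      ; unique   = Unique.map⁺ (λ {T} {U} → ⟦⟧-injective T U) (trees-unique n)
      ; sound    = λ p → let (T , q , eq) = ∈-map⁻ ⟦_⟧ p in
                     subst (λ t → IsObject t × ∣ t ∣ ≡ n) (sym eq)
                       (⟦⟧-isObject T , trans (∣⟦⟧∣ T) (∈-trees⁻ n q))
      ; complete = λ p eq → let (T , t≡) = ⟦⟧-surjective p in
                     subst (_∈ map ⟦_⟧ (trees n)) (sym t≡)
                       (∈-map⁺ ⟦_⟧ (subst (λ k → T ∈ trees k)
                         (trans (sym (∣⟦⟧∣ T)) (trans (cong ∣_∣ (sym t≡)) eq)) (∈-trees⁺ T)))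
      }

    sendsPair : ∀ n → n ≥ 1 → HSendsPair R n (a , b) (a′ , b′)
    sendsPair n n≥1 = isCatalan , record
      { first      = λ t eq → via (λ x y → a′ y ≡ a x) (λ T T≢∅ _ → a-dual T T≢∅) t eq
      ; second     = λ t eq → via (λ x y → b′ y ≡ b x) (λ T T≢∅ _ → b-dual T T≢∅) t eq
      ; h-size     = λ t eq → via (λ x y → ∣ y ∣ ≡ n)
                       (λ T _ nT → trans (∣⟦⟧∣ (dual T)) (trans (nodes-dual T) nT)) t eq
      ; involutive = λ t _ → involutive′ t
      ; joint      = enumeration n , sameDistribution
      }
      where
      nonempty : ∀ {T} → nodes T ≡ n → T ≢ ∅
      nonempty eq refl = n≢0 n≥1 (sym eq)
        where
        n≢0 : ∀ {n} → n ≥ 1 → n ≢ 0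
        n≢0 (s≤s _) ()

      h-tree : ∀ t T → elem t ≡ ⟦ T ⟧ → elem (C.h t) ≡ ⟦ dual T ⟧
      h-tree t T t≡ = trans (C.h-cong t ⟦ T ⟧ᵒ t≡) (h-⟦⟧ T)

      -- An object `t` agrees with some `⟦ T ⟧ᵒ` only in its element, so a claim about `t` and `h t`
      -- is stated for elements and moved along two equalities of the carrier.
      via : ∀ (P : Carrier → Carrier → Set) → (∀ T → T ≢ ∅ → nodes T ≡ n → P ⟦ T ⟧ ⟦ dual T ⟧) →
            ∀ t → C.size t ≡ n → P (elem t) (elem (C.h t))
      via P f t eq =
        let (T , t≡) = ⟦⟧-surjective (isObject t)
            nT = trans (sym (∣⟦⟧∣ T)) (trans (cong ∣_∣ (sym t≡)) eq)
        in subst₂ P (sym t≡) (sym (h-tree t T t≡)) (f T (nonempty nT) nT)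

      involutive′ : ∀ t → C.h (C.h t) ≋ t
      involutive′ t =
        let (T , t≡) = ⟦⟧-surjective (isObject t)
        in trans (h-tree (C.h t) (dual T) (h-tree t T t≡))
                 (trans (cong ⟦_⟧ (dual-involutive T)) (sym t≡))

      sameDistribution : ∀ i j →
        count (λ t → (a t ≟ i) ×-dec (b t ≟ j)) (map ⟦_⟧ (trees n)) ≡
        count (λ t → (a′ t ≟ i) ×-dec (b′ t ≟ j)) (map ⟦_⟧ (trees n))
      sameDistribution i j = begin
        count Q (map ⟦_⟧ (trees n))
          ≡⟨ sym (count-cong (λ T → Q ⟦ T ⟧) Q ⟦_⟧ (trees n) (All.tabulate (λ _ → id , id))) ⟩
        count (λ T → Q ⟦ T ⟧) (trees n)
          ≡⟨ count-cong (λ T → Q ⟦ T ⟧) (λ T → Q′ ⟦ T ⟧) dual (trees n) (All.tabulate (λ {T} p →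
               let T≢∅ = nonempty (∈-trees⁻ n p) ; a≡ = a-dual T T≢∅ ; b≡ = b-dual T T≢∅
               in (λ (x , y) → trans a≡ x , trans b≡ y)
                , (λ (x , y) → trans (sym a≡) x , trans (sym b≡) y))) ⟩
        count (λ T → Q′ ⟦ T ⟧) (map dual (trees n))
          ≡⟨ count-↭ (λ T → Q′ ⟦ T ⟧) (trees-dual n) ⟩
        count (λ T → Q′ ⟦ T ⟧) (trees n)
          ≡⟨ count-cong (λ T → Q′ ⟦ T ⟧) Q′ ⟦_⟧ (trees n) (All.tabulate (λ _ → id , id)) ⟩
        count Q′ (map ⟦_⟧ (trees n)) ∎
        where
        open ≡-Reasoning
        Q = λ t → (a t ≟ i) ×-dec (b t ≟ j)
        Q′ = λ t → (a′ t ≟ i) ×-dec (b′ t ≟ j)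

open FromPresentation public using (StatisticLaws; sendsPair)

-- Transport of a presentation along a correspondence.

module Correspondence {R R′ : RawCatalan} (pres′ : Presentation R′) where

  private
    module R  = RawCatalan R
    module R′ = RawCatalan R′
    module P′ = Presentation pres′
    open FromPresentation pres′ using (⟦_⟧; ⟦⟧-isObject; ⟦⟧-surjective)

  -- A relation serves both directions: tableaux are images of words (`T ≡ tab w`), whereas
  -- partitions are mapped to words (`concat P ≡ w`). Every object of `R′` is some `⟦ T ⟧`, and
  -- `⟦ T ⟧ᴿ` is an object of `R` related to it. A decomposition found in `R′` can therefore be
  -- rebuilt in `R`, and injectivity identifies the result with the given object.
  module Along
    (_~_ : R.Carrier → R′.Carrier → Set)
    (e-isObject   : R.IsObject R.e)
    (lam-isObject : ∀ {t} → R.IsObject t → R.IsObject (R.lam t))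
    (⊕-isObject   : ∀ {t u} → R.IsObject t → R.IsObject u → R.IsObject (t R.⊕ u))
    (~-total      : ∀ {t} → R.IsObject t → ∃[ w ] (R′.IsObject w × t ~ w))
    (~-functional : ∀ {t w w′} → R′.IsObject w → R′.IsObject w′ → t ~ w → t ~ w′ → w ≡ w′)
    (~-injective  : ∀ {t u w} → R.IsObject t → R.IsObject u → t ~ w → u ~ w → t ≡ u)
    (~-size       : ∀ {t w} → R′.IsObject w → t ~ w → R.∣ t ∣ ≡ R′.∣ w ∣)
    (~-e          : R.e ~ R′.e)
    (~-lam        : ∀ {t w} → R′.IsObject w → t ~ w → R.lam t ~ R′.lam w)
    (~-⊕          : ∀ {t u w v} → R′.IsObject w → R′.IsObject v → t ~ w → u ~ v → (t R.⊕ u) ~ (w R′.⊕ v))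
    where

    private
      ~-lam⊕ : ∀ {t u w v} → R′.IsObject w → R′.IsObject v → t ~ w → u ~ v → (R.lam t R.⊕ u) ~ (R′.lam w R′.⊕ v)
      ~-lam⊕ o o′ p q = ~-⊕ (P′.lam-isObject o) o′ (~-lam o p) q

      ⟦_⟧ᴿ : Tree → R.Carrier
      ⟦ ∅ ⟧ᴿ        = R.e
      ⟦ node L R ⟧ᴿ = R.lam ⟦ L ⟧ᴿ R.⊕ ⟦ R ⟧ᴿ

      ⟦⟧ᴿ-isObject : ∀ T → R.IsObject ⟦ T ⟧ᴿ
      ⟦⟧ᴿ-isObject ∅          = e-isObject
      ⟦⟧ᴿ-isObject (node L R) = ⊕-isObject (lam-isObject (⟦⟧ᴿ-isObject L)) (⟦⟧ᴿ-isObject R)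

      ⟦⟧ᴿ~⟦⟧ : ∀ T → ⟦ T ⟧ᴿ ~ ⟦ T ⟧
      ⟦⟧ᴿ~⟦⟧ ∅          = ~-e
      ⟦⟧ᴿ~⟦⟧ (node L R) = ~-lam⊕ (⟦⟧-isObject L) (⟦⟧-isObject R) (⟦⟧ᴿ~⟦⟧ L) (⟦⟧ᴿ~⟦⟧ R)

      ∣lam∣ : ∀ {t} → R.IsObject t → R.∣ R.lam t ∣ ≡ suc R.∣ t ∣
      ∣lam∣ p = let (_ , o , t~w) = ~-total p in
        trans (~-size (P′.lam-isObject o) (~-lam o t~w)) (trans (P′.∣lam∣ o) (cong suc (sym (~-size o t~w))))

      ∣⊕∣ : ∀ {t u} → R.IsObject t → R.IsObject u → R.∣ t R.⊕ u ∣ ≡ R.∣ t ∣ + R.∣ u ∣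
      ∣⊕∣ p q = let (_ , o , t~w) = ~-total p ; (_ , o′ , u~v) = ~-total q in
        trans (~-size (P′.⊕-isObject o o′) (~-⊕ o o′ t~w u~v))
              (trans (P′.∣⊕∣ o o′) (sym (cong₂ _+_ (~-size o t~w) (~-size o′ u~v))))

      assoc : ∀ {t u v} → R.IsObject t → R.IsObject u → R.IsObject v → (t R.⊕ u) R.⊕ v ≡ t R.⊕ (u R.⊕ v)
      assoc {t} {u} {v} p q r = let (_ , o , t~) = ~-total p ; (_ , o′ , u~) = ~-total q ; (_ , o″ , v~) = ~-total r in
        ~-injective (⊕-isObject (⊕-isObject p q) r) (⊕-isObject p (⊕-isObject q r))
          (~-⊕ (P′.⊕-isObject o o′) o″ (~-⊕ o o′ t~ u~) v~)
          (subst ((t R.⊕ u R.⊕ v) ~_) (sym (P′.⊕-assoc o o′ o″)) (~-⊕ o (P′.⊕-isObject o′ o″) t~ (~-⊕ o′ o″ u~ v~)))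

      identityˡ : ∀ {t} → R.IsObject t → R.e R.⊕ t ≡ t
      identityˡ p = let (_ , o , t~) = ~-total p in
        ~-injective (⊕-isObject e-isObject p) p (~-⊕ P′.e-isObject o ~-e t~) (subst (_ ~_) (sym (P′.⊕-identityˡ o)) t~)

      identityʳ : ∀ {t} → R.IsObject t → t R.⊕ R.e ≡ t
      identityʳ p = let (_ , o , t~) = ~-total p in
        ~-injective (⊕-isObject p e-isObject) p (~-⊕ o P′.e-isObject t~ ~-e) (subst (_ ~_) (sym (P′.⊕-identityʳ o)) t~)

      decompose : ∀ {t} → R.IsObject t →
                  t ≡ R.e ⊎ ∃₂ λ s v → R.IsObject s × R.IsObject v × t ≡ R.lam s R.⊕ v
      decompose p with ~-total p
      ... | w , o , t~ with ⟦⟧-surjective o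
      ...   | ∅ , refl        = inj₁ (~-injective p e-isObject t~ ~-e)
      ...   | node L R , refl = inj₂ (⟦ L ⟧ᴿ , ⟦ R ⟧ᴿ , ⟦⟧ᴿ-isObject L , ⟦⟧ᴿ-isObject R
                                     , ~-injective p (⟦⟧ᴿ-isObject (node L R)) t~ (⟦⟧ᴿ~⟦⟧ (node L R)))

      cancel : ∀ {s v s′ v′} → R.IsObject s → R.IsObject v → R.IsObject s′ → R.IsObject v′ →
               R.lam s R.⊕ v ≡ R.lam s′ R.⊕ v′ → s ≡ s′ × v ≡ v′
      cancel p q p′ q′ eq with ~-total p | ~-total q | ~-total p′ | ~-total q′
      ... | _ , o₁ , s~ | _ , o₂ , v~ | _ , o₃ , s′~ | _ , o₄ , v′~
            with P′.cancel o₁ o₂ o₃ o₄ (~-functional (P′.⊕-isObject (P′.lam-isObject o₁) o₂)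
                   (P′.⊕-isObject (P′.lam-isObject o₃) o₄)
                   (subst (_~ _) eq (~-lam⊕ o₁ o₂ s~ v~)) (~-lam⊕ o₃ o₄ s′~ v′~))
      ...   | refl , refl = ~-injective p p′ s~ s′~ , ~-injective q q′ v~ v′~

    presentation : Presentation R
    presentation = record
      { e-isObject   = e-isObject
      ; lam-isObject = lam-isObject
      ; ⊕-isObject   = ⊕-isObject
      ; ∣e∣          = trans (~-size P′.e-isObject ~-e) P′.∣e∣
      ; ∣lam∣        = ∣lam∣
      ; ∣⊕∣          = ∣⊕∣
      ; ⊕-assoc      = assoc
      ; ⊕-identityˡ  = identityˡ
      ; ⊕-identityʳ  = identityʳ
      ; decompose    = decompose
      ; cancel       = cancel
      }

-- Binary trees.

module BinaryTreeProof where
  open BinaryTree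

  presentation : Presentation binaryTrees
  presentation = record
    { e-isObject   = tt
    ; lam-isObject = λ _ → tt
    ; ⊕-isObject   = λ _ _ → tt
    ; ∣e∣          = refl
    ; ∣lam∣        = λ {T} _ → cong suc (+-identityʳ (nodes T))
    ; ∣⊕∣          = λ {T} {U} _ _ → nodes-graft T U
    ; ⊕-assoc      = λ {T} {U} {V} _ _ _ → graft-assoc T U V
    ; ⊕-identityˡ  = λ _ → refl
    ; ⊕-identityʳ  = λ {T} _ → graft-∅ T
    ; decompose    = λ { {∅} _ → inj₁ refl ; {node L R} _ → inj₂ (L , R , tt , tt , refl) }
    ; cancel       = λ _ _ _ _ → node-injective
    }

  laws : StatisticLaws presentation comp redge rcomp ledge
  laws = record
    { a-e     = refl
    ; a-lam⊕  = λ _ _ → refl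
    ; a′-lam-e = refl
    ; a′-lam  = λ _ _ → refl
    ; a′-lam⊕ = λ {L} {R} _ _ → rcomp-node L R
    ; b-lam-e = refl
    ; b-lam   = λ _ _ → refl
    ; b-lam⊕  = λ {L} {R} _ _ → redge-node L R
    ; b′-b    = λ {T} _ _ → trans (m∸n+n≡m (≤-trans (redge≤suc-nodes T) (≤-reflexive (+-comm 1 (nodes T)))))
                                   (+-comm (nodes T) 1)
    }

-- The interval [1⋯ n ]

[1⋯suc] : ∀ n → [1⋯ suc n ] ≡ 1 ∷ map suc [1⋯ n ]
[1⋯suc] n = cong (λ l → 1 ∷ map suc l) (sym (List.map-upTo suc n))

[1⋯]-++ : ∀ m n → [1⋯ m + n ] ≡ [1⋯ m ] ++ map (m +_) [1⋯ n ]
[1⋯]-++ zero    n = sym (List.map-id _)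
[1⋯]-++ (suc m) n = begin
  [1⋯ suc (m + n) ]                                          ≡⟨ [1⋯suc] (m + n) ⟩
  1 ∷ map suc [1⋯ m + n ]                                    ≡⟨ cong (λ l → 1 ∷ map suc l) ([1⋯]-++ m n) ⟩
  1 ∷ map suc ([1⋯ m ] ++ map (m +_) [1⋯ n ])                ≡⟨ cong (1 ∷_) (List.map-++ suc [1⋯ m ] _) ⟩
  1 ∷ map suc [1⋯ m ] ++ map suc (map (m +_) [1⋯ n ])        ≡⟨ cong₂ _++_ (sym ([1⋯suc] m)) (sym (List.map-∘ [1⋯ n ])) ⟩
  [1⋯ suc m ] ++ map (suc m +_) [1⋯ n ]                      ∎
  where open ≡-Reasoning

[1⋯]-∷ʳ : ∀ n → [1⋯ suc n ] ≡ [1⋯ n ] ++ suc n ∷ []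
[1⋯]-∷ʳ n = trans (cong [1⋯_] (+-comm 1 n)) (trans ([1⋯]-++ n 1) (cong (λ k → [1⋯ n ] ++ k ∷ []) (+-comm n 1)))

∈-[1⋯]⁺ : ∀ {n k} → 1 ≤ k → k ≤ n → k ∈ [1⋯ n ]
∈-[1⋯]⁺ (s≤s _) le = ∈-map⁺ suc (∈-upTo⁺ le)

∈-[1⋯]⁻ : ∀ {n k} → k ∈ [1⋯ n ] → 1 ≤ k × k ≤ n
∈-[1⋯]⁻ p with ∈-map⁻ suc p
... | _ , q , refl = s≤s z≤n , ∈-upTo⁻ q

[1⋯]-unique : ∀ n → Unique [1⋯ n ]
[1⋯]-unique n = Unique.map⁺ suc-injective (Unique.upTo⁺ n)

length-[1⋯] : ∀ n → length [1⋯ n ] ≡ n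
length-[1⋯] n = trans (List.length-map suc (upTo n)) (List.length-upTo n)

↭[1⋯]-length : ∀ {w n} → w ↭ [1⋯ n ] → length w ≡ n
↭[1⋯]-length {n = n} p = trans (↭-length p) (length-[1⋯] n)

↭[1⋯]-bounds : ∀ {w n x} → w ↭ [1⋯ n ] → x ∈ w → 1 ≤ x × x ≤ n
↭[1⋯]-bounds p x∈w = ∈-[1⋯]⁻ (∈-resp-↭ p x∈w)

unique-resp-↭ : ∀ {A : Set} {xs ys : List A} → xs ↭ ys → Unique xs → Unique ys
unique-resp-↭ = PermSetoid.Unique-resp-↭ (setoid _) ∘ ↭⇒↭ₛ

↭[1⋯]-unique : ∀ {w n} → w ↭ [1⋯ n ] → Unique w
↭[1⋯]-unique {n = n} p = unique-resp-↭ (↭-sym p) ([1⋯]-unique n)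

-- This evaluates `comp (lam s ⊕ v)` wherever `comp` counts cut positions. The first component has
-- size `m` and no cut before its end; the cuts after `m` are those of `v`, displaced by `m`.
count-cuts : ∀ {P Q : Pred ℕ 0ℓ} (P? : Decidable P) (Q? : Decidable Q) m n → 1 ≤ m →
             (∀ k → 1 ≤ k → k < m → ¬ P k) → P m →
             (∀ k → 1 ≤ k → k ≤ n → (P (m + k) → Q k) × (Q k → P (m + k))) →
             count P? [1⋯ m + n ] ≡ suc (count Q? [1⋯ n ])
count-cuts P? Q? m@(suc j) n (s≤s _) before at after = begin
  count P? [1⋯ m + n ]                                    ≡⟨ cong (count P?) ([1⋯]-++ m n) ⟩
  count P? ([1⋯ m ] ++ map (m +_) [1⋯ n ])                ≡⟨ count-++ P? [1⋯ m ] _ ⟩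
  count P? [1⋯ m ] + count P? (map (m +_) [1⋯ n ])        ≡⟨ cong₂ _+_ first rest ⟩
  suc (count Q? [1⋯ n ])                                  ∎
  where
  open ≡-Reasoning
  first : count P? [1⋯ m ] ≡ 1
  first = begin
    count P? [1⋯ m ]                      ≡⟨ cong (count P?) ([1⋯]-∷ʳ j) ⟩
    count P? ([1⋯ j ] ++ m ∷ [])          ≡⟨ count-++ P? [1⋯ j ] _ ⟩
    count P? [1⋯ j ] + count P? (m ∷ [])  ≡⟨ cong₂ _+_
      (count-≡0 P? {[1⋯ j ]} (All.tabulate λ k∈ → let (1≤k , k≤j) = ∈-[1⋯]⁻ k∈ in before _ 1≤k (s≤s k≤j)))
      (count-yes P? [] at) ⟩
    1                                     ∎
  rest : count P? (map (m +_) [1⋯ n ]) ≡ count Q? [1⋯ n ]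
  rest = sym (count-cong Q? P? (m +_) [1⋯ n ] (All.tabulate λ k∈ →
    let (1≤k , k≤n) = ∈-[1⋯]⁻ k∈ ; (to , from) = after _ 1≤k k≤n in from , to))

-- Conditions on triples of entries, for pattern avoidance.

-- Pattern avoidance is given as a condition on all three-term sublists. The recursive form is
-- easier to carry through concatenation and `map`; `triples⁺` and `triples⁻` translate between the
-- two.
Triples : (ℕ → ℕ → ℕ → Set) → List ℕ → Set
Triples R []      = ⊤
Triples R (x ∷ w) = AllPairs (R x) w × Triples R w

module _ {S : ℕ → ℕ → Set} where

  allPairs : ∀ {w} → (∀ {b c} → b ∈ w → c ∈ w → S b c) → AllPairs S w
  allPairs {[]}    h = []
  allPairs {y ∷ w} h = All.tabulate (λ c → h (here refl) (there c)) ∷ allPairs (λ b c → h (there b) (there c))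

  pairs⁺ : ∀ {w} → (∀ {b c} → b ∷ c ∷ [] ⊆ w → S b c) → AllPairs S w
  pairs⁺ {[]}    f = []
  pairs⁺ {y ∷ w} f = All.tabulate (λ c∈w → f (refl ∷ Sublist.from∈ c∈w)) ∷ pairs⁺ (f ∘ (y Sublist.∷ʳ_))

  pairs⁻ : ∀ {w b c} → AllPairs S w → b ∷ c ∷ [] ⊆ w → S b c
  pairs⁻ (_ ∷ ss) (y Sublist.∷ʳ p) = pairs⁻ ss p
  pairs⁻ (s ∷ _)  (refl ∷ p)       = lookup s (Sublist.to∈ p)

module _ {R : ℕ → ℕ → ℕ → Set} where

  triples⁺ : ∀ {w} → (∀ {a b c} → a ∷ b ∷ c ∷ [] ⊆ w → R a b c) → Triples R w
  triples⁺ {[]}    f = tt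
  triples⁺ {x ∷ w} f = pairs⁺ (λ p → f (refl ∷ p)) , triples⁺ (f ∘ (x Sublist.∷ʳ_))

  triples⁻ : ∀ {w a b c} → Triples R w → a ∷ b ∷ c ∷ [] ⊆ w → R a b c
  triples⁻ {_ ∷ _} (_ , ts) (y Sublist.∷ʳ p) = triples⁻ ts p
  triples⁻ {_ ∷ _} (t , _)  (refl ∷ p)       = pairs⁻ t p

  triples-++⁺ : ∀ p q → (∀ {x b c} → x ∈ p → b ∈ p → c ∈ q → R x b c) →
                (∀ {x b c} → x ∈ p → b ∈ q → c ∈ q → R x b c) →
                Triples R p → Triples R q → Triples R (p ++ q)
  triples-++⁺ []      q f g _        tq = tq
  triples-++⁺ (x ∷ p) q f g (t , tp) tq =
    AllPairs.++⁺ t (allPairs (λ b c → g (here refl) b c))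
      (All.tabulate λ b → All.tabulate λ c → f (here refl) (there b) c)
    , triples-++⁺ p q (λ x b c → f (there x) (there b) c) (λ x → g (there x)) tp tq

  triples-++⁻ : ∀ p q → Triples R (p ++ q) → Triples R p × Triples R q
  triples-++⁻ []      q t        = tt , t
  triples-++⁻ (x ∷ p) q (t , ts) =
    let (tp , tq) = triples-++⁻ p q ts in (pairs-++⁻ p t , tp) , tq
    where
    pairs-++⁻ : ∀ {S : ℕ → ℕ → Set} p {q} → AllPairs S (p ++ q) → AllPairs S p
    pairs-++⁻ []      _        = []
    pairs-++⁻ (y ∷ p) (s ∷ ss) = All.++⁻ˡ p s ∷ pairs-++⁻ p ss

triples-map⁺ : ∀ {R R′ : ℕ → ℕ → ℕ → Set} (f : ℕ → ℕ) → (∀ {a b c} → R a b c → R′ (f a) (f b) (f c)) →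
               ∀ w → Triples R w → Triples R′ (map f w)
triples-map⁺ f r []      _        = tt
triples-map⁺ f r (x ∷ w) (t , ts) = AllPairs.map⁺ (AllPairs.map r t) , triples-map⁺ f r w ts

triples-map⁻ : ∀ {R R′ : ℕ → ℕ → ℕ → Set} (f : ℕ → ℕ) → (∀ {a b c} → R′ (f a) (f b) (f c) → R a b c) →
               ∀ w → Triples R′ (map f w) → Triples R w
triples-map⁻ f r []      _        = tt
triples-map⁻ f r (x ∷ w) (t , ts) = AllPairs.map r (AllPairs.map⁻ t) , triples-map⁻ f r w ts

-- Permutations and direct sums

open Permutation using (IsPermutation; directSum; rmax; rmin; nonrmin)

infix 4 _≪_
_≪_ : List ℕ → List ℕ → Set
p ≪ q = ∀ {a b} → a ∈ p → b ∈ q → a < b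

length-directSum : ∀ π₁ π₂ → length (directSum π₁ π₂) ≡ length π₁ + length π₂
length-directSum π₁ π₂ = trans (List.length-++ π₁) (cong (length π₁ +_) (List.length-map _ π₂))

directSum-isPermutation : ∀ {π₁ π₂} → IsPermutation π₁ → IsPermutation π₂ → IsPermutation (directSum π₁ π₂)
directSum-isPermutation {π₁} {π₂} p q = ↭-trans (Perm.++⁺ p (Perm.map⁺ (length π₁ +_) q))
  (↭-reflexive (trans (sym ([1⋯]-++ (length π₁) (length π₂))) (cong [1⋯_] (sym (length-directSum π₁ π₂)))))

map-+-+ : ∀ m n w → map (m +_) (map (n +_) w) ≡ map (m + n +_) w
map-+-+ m n w = trans (sym (List.map-∘ w)) (List.map-cong (λ x → sym (+-assoc m n x)) w)

directSum-assoc : ∀ p q r → directSum (directSum p q) r ≡ directSum p (directSum q r)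
directSum-assoc p q r = begin
  (p ++ map (length p +_) q) ++ map (length (directSum p q) +_) r
    ≡⟨ List.++-assoc p _ _ ⟩
  p ++ map (length p +_) q ++ map (length (directSum p q) +_) r
    ≡⟨ cong (λ k → p ++ map (length p +_) q ++ map (k +_) r) (length-directSum p q) ⟩
  p ++ map (length p +_) q ++ map (length p + length q +_) r
    ≡⟨ cong (λ l → p ++ map (length p +_) q ++ l) (sym (map-+-+ (length p) (length q) r)) ⟩
  p ++ map (length p +_) q ++ map (length p +_) (map (length q +_) r)
    ≡⟨ cong (p ++_) (sym (List.map-++ (length p +_) q _)) ⟩
  p ++ map (length p +_) (directSum q r) ∎
  where open ≡-Reasoning

++-≪ : ∀ {p q} → IsPermutation p → IsPermutation q → p ≪ map (length p +_) q
++-≪ {p} perm-p perm-q a∈p b∈q with ∈-map⁻ (length p +_) b∈q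
... | b , b∈ , refl = ≤-<-trans (proj₂ (↭[1⋯]-bounds perm-p a∈p))
        (m<m+n (length p) (proj₁ (↭[1⋯]-bounds perm-q b∈)))

++-injective : ∀ {A : Set} (p p′ : List A) {q q′} → length p ≡ length p′ → p ++ q ≡ p′ ++ q′ → p ≡ p′ × q ≡ q′
++-injective []      []        _  eq = refl , eq
++-injective (x ∷ p) (x′ ∷ p′) l  eq =
  let (p≡ , q≡) = ++-injective p p′ (suc-injective l) (List.∷-injectiveʳ eq)
  in cong₂ _∷_ (List.∷-injectiveˡ eq) p≡ , q≡

map-+-injective : ∀ m {v v′} → map (m +_) v ≡ map (m +_) v′ → v ≡ v′
map-+-injective m = List.map-injective (λ {x} {y} → +-cancelˡ-≡ m x y)

↭[1⋯]⇒isPermutation : ∀ {w n} → w ↭ [1⋯ n ] → IsPermutation w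
↭[1⋯]⇒isPermutation {w} p = subst (λ k → w ↭ [1⋯ k ]) (sym (↭[1⋯]-length p)) p

suc-∷-isPermutation : ∀ {w} → IsPermutation w → suc (length w) ∷ w ↭ [1⋯ suc (length w) ]
suc-∷-isPermutation {w} p = ↭-trans (prep _ p)
  (↭-trans (∷↭∷ʳ (suc (length w)) [1⋯ length w ]) (↭-reflexive (sym ([1⋯]-∷ʳ (length w)))))

max-∷-isPermutation : ∀ {m w n} → m ∷ w ↭ [1⋯ n ] → All (_< m) w → IsPermutation w × m ≡ suc (length w)
max-∷-isPermutation {m} {w} {zero}  p w<m = contradiction p Perm.¬x∷xs↭[]
max-∷-isPermutation {m} {w} {suc n} p w<m =
  subst (λ k → w ↭ [1⋯ k ]) n≡ w↭ , trans m≡ (cong suc n≡)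
  where
  n≡ : n ≡ length w
  n≡ = sym (suc-injective (↭[1⋯]-length p))
  m≡ : m ≡ suc n
  m≡ with ∈-resp-↭ (↭-sym p) (∈-[1⋯]⁺ (s≤s z≤n) ≤-refl)
  ... | here eq   = sym eq
  ... | there n∈w = contradiction (proj₂ (↭[1⋯]-bounds p (here refl))) (<⇒≱ (lookup w<m n∈w))
  w↭ : w ↭ [1⋯ n ]
  w↭ = drop-∷ (↭-trans (subst (λ k → k ∷ w ↭ [1⋯ suc n ]) m≡ p)
         (↭-trans (↭-reflexive ([1⋯]-∷ʳ n)) (↭-sym (∷↭∷ʳ (suc n) [1⋯ n ]))))

-- Filtering both sides of the permutation by `_≤ m`, and again by `m <_`, leaves exactly the two
-- halves.
permutation-split : ∀ {p q m n} → p ++ q ↭ [1⋯ m + n ] → All (_≤ m) p → All (m <_) q →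
                    p ↭ [1⋯ m ] × ∃[ v ] (q ≡ map (m +_) v × v ↭ [1⋯ n ])
permutation-split {p} {q} {m} {n} perm p≤ q> =
  subst₂ _↭_ lowˡ lowʳ (filter-↭ (_≤? m) perm)
  , let (v , v≡ , v↭) = Perm.↭-map-inv (m +_) (subst₂ _↭_ highʳ highˡ (↭-sym (filter-↭ (m <?_) perm)))
    in v , v≡ , ↭-sym v↭
  where
  low≤ : All (_≤ m) [1⋯ m ]
  low≤ = All.tabulate (proj₂ ∘ ∈-[1⋯]⁻)
  high> : All (m <_) (map (m +_) [1⋯ n ])
  high> = All.map⁺ (All.tabulate (λ k∈ → m<m+n m (proj₁ (∈-[1⋯]⁻ k∈))))
  open ≡-Reasoning
  lowˡ : filter (_≤? m) (p ++ q) ≡ p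
  lowˡ = trans (List.filter-++ (_≤? m) p q) (trans (cong₂ _++_ (List.filter-all (_≤? m) p≤)
           (List.filter-none (_≤? m) (All.map <⇒≱ q>))) (List.++-identityʳ p))
  lowʳ : filter (_≤? m) [1⋯ m + n ] ≡ [1⋯ m ]
  lowʳ = trans (cong (filter (_≤? m)) ([1⋯]-++ m n)) (trans (List.filter-++ (_≤? m) [1⋯ m ] _)
           (trans (cong₂ _++_ (List.filter-all (_≤? m) low≤)
           (List.filter-none (_≤? m) (All.map <⇒≱ high>))) (List.++-identityʳ [1⋯ m ])))
  highˡ : filter (m <?_) (p ++ q) ≡ q
  highˡ = trans (List.filter-++ (m <?_) p q) (cong₂ _++_
           (List.filter-none (m <?_) (All.map ≤⇒≯ p≤)) (List.filter-all (m <?_) q>))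
  highʳ : filter (m <?_) [1⋯ m + n ] ≡ map (m +_) [1⋯ n ]
  highʳ = trans (cong (filter (m <?_)) ([1⋯]-++ m n)) (trans (List.filter-++ (m <?_) [1⋯ m ] _)
           (cong₂ _++_ (List.filter-none (m <?_) (All.map ≤⇒≯ low≤)) (List.filter-all (m <?_) high>)))

-- For a permutation this is indecomposability under `directSum`. The formulation by an inversion
-- across every cut also makes sense for words on arbitrary numbers, as they arise within a pass of
-- bubble sort.
Connected : List ℕ → Set
Connected w = ∀ p q → w ≡ p ++ q → p ≢ [] → q ≢ [] → ∃₂ λ a b → a ∈ p × b ∈ q × b < a

private
  take-nonempty : ∀ {A : Set} k {w : List A} → 1 ≤ k → 1 ≤ length w → take k w ≢ []
  take-nonempty (suc k) {x ∷ w} _ _ ()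

  drop-nonempty : ∀ {A : Set} k {w : List A} → k < length w → drop k w ≢ []
  drop-nonempty zero    {x ∷ w} _        ()
  drop-nonempty (suc k) {x ∷ w} (s≤s lt) eq = drop-nonempty k lt eq

unique-++-disjoint : ∀ {A : Set} p {q : List A} {x} → Unique (p ++ q) → x ∈ p → x ∉ q
unique-++-disjoint (y ∷ p) (n ∷ u) (here refl) x∈q = lookup n (∈-++⁺ʳ p x∈q) refl
unique-++-disjoint (y ∷ p) (n ∷ u) (there x∈p) x∈q = unique-++-disjoint p u x∈p x∈q

-- The smaller entry of an inversion across the cut would also be at most `k`, hence would occur
-- among the first `k` entries as well as after them.
connected⇒¬cut : ∀ {p} → IsPermutation p → Connected p → ∀ k → 1 ≤ k → k < length p → ¬ SameSet (take k p) [1⋯ k ]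
connected⇒¬cut {p} perm conn k 1≤k k<p (to , from) =
  let split = sym (List.take++drop≡id k p)
      (a , b , a∈ , b∈ , b<a) = conn (take k p) (drop k p) split
        (take-nonempty k 1≤k (≤-trans 1≤k (<⇒≤ k<p))) (drop-nonempty k k<p)
      b∈p = subst (b ∈_) (List.take++drop≡id k p) (∈-++⁺ʳ (take k p) b∈)
      b≤k = ≤-trans (<⇒≤ b<a) (proj₂ (∈-[1⋯]⁻ (lookup to a∈)))
  in unique-++-disjoint (take k p) (subst Unique split (↭[1⋯]-unique perm))
       (lookup from (∈-[1⋯]⁺ (proj₁ (↭[1⋯]-bounds perm b∈p)) b≤k)) b∈

↭⇒SameSet : ∀ {xs ys} → xs ↭ ys → SameSet xs ys
↭⇒SameSet p = All.tabulate (∈-resp-↭ p) , All.tabulate (∈-resp-↭ (↭-sym p))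

sameSet-shift : ∀ {p m xs ys} → p ↭ [1⋯ m ] → All (1 ≤_) xs → All (1 ≤_) ys →
                (SameSet (p ++ map (m +_) xs) ([1⋯ m ] ++ map (m +_) ys) → SameSet xs ys)
                × (SameSet xs ys → SameSet (p ++ map (m +_) xs) ([1⋯ m ] ++ map (m +_) ys))
sameSet-shift {p} {m} {xs} {ys} perm xs≥1 ys≥1 =
  (λ (to , from) → All.tabulate (λ x∈ → below [1⋯ m ] (proj₂ ∘ ∈-[1⋯]⁻) (lookup xs≥1 x∈)
                  (lookup to (∈-++⁺ʳ p (∈-map⁺ (m +_) x∈))))
             , All.tabulate (λ y∈ → below p (proj₂ ∘ ↭[1⋯]-bounds perm) (lookup ys≥1 y∈)
                  (lookup from (∈-++⁺ʳ [1⋯ m ] (∈-map⁺ (m +_) y∈)))))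
  , (λ (to , from) → All.++⁺ (All.tabulate (∈-++⁺ˡ ∘ ∈-resp-↭ perm))
                    (All.map⁺ (All.map (λ y∈ → ∈-++⁺ʳ [1⋯ m ] (∈-map⁺ (m +_) y∈)) to))
               , All.++⁺ (All.tabulate (∈-++⁺ˡ ∘ ∈-resp-↭ (↭-sym perm)))
                    (All.map⁺ (All.map (λ x∈ → ∈-++⁺ʳ p (∈-map⁺ (m +_) x∈)) from)))
  where
  below : ∀ l {x zs} → (∀ {a} → a ∈ l → a ≤ m) → 1 ≤ x → m + x ∈ l ++ map (m +_) zs → x ∈ zs
  below l {x} l≤ 1≤x q with ∈-++⁻ l q
  ... | inj₁ x∈l = contradiction (l≤ x∈l) (<⇒≱ (m<m+n m 1≤x))
  ... | inj₂ x∈m with ∈-map⁻ (m +_) x∈m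
  ...   | z , z∈ , eq = subst (_∈ _) (sym (+-cancelˡ-≡ m x z eq)) z∈

∈-take : ∀ {A : Set} k {w : List A} {x} → x ∈ take k w → x ∈ w
∈-take k {w} x∈ = subst (_ ∈_) (List.take++drop≡id k w) (∈-++⁺ˡ x∈)

∈-drop : ∀ {A : Set} k {w : List A} {x} → x ∈ drop k w → x ∈ w
∈-drop k {w} x∈ = subst (_ ∈_) (List.take++drop≡id k w) (∈-++⁺ʳ (take k w) x∈)

SameSet-resp-↭ : ∀ {xs xs′ ys} → xs ↭ xs′ → SameSet xs ys → SameSet xs′ ys
SameSet-resp-↭ p (to , from) = All-resp-↭ p to , All.map (∈-resp-↭ p) from

take-++-+ : ∀ {A : Set} (p : List A) {q} k → take (length p + k) (p ++ q) ≡ p ++ take k q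
take-++-+ []      k = refl
take-++-+ (x ∷ p) k = cong (x ∷_) (take-++-+ p k)

take-++-≤ : ∀ {A : Set} (p : List A) {q} k → k ≤ length p → take k (p ++ q) ≡ take k p
take-++-≤ p       zero    _        = refl
take-++-≤ (x ∷ p) (suc k) (s≤s le) = cong (x ∷_) (take-++-≤ p k le)

comp-directSum : ∀ {p v} → IsPermutation p → IsPermutation v → Connected p → 1 ≤ length p →
                 Permutation.comp (directSum p v) ≡ suc (Permutation.comp v)
comp-directSum {p} {v} perm-p perm-v conn 1≤ = trans
  (cong (λ n → count (λ k → sameSet? (take k (directSum p v)) [1⋯ k ]) [1⋯ n ]) (length-directSum p v))
  (count-cuts (λ k → sameSet? (take k (directSum p v)) [1⋯ k ]) (λ k → sameSet? (take k v) [1⋯ k ])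
    (length p) (length v) 1≤
    (λ k 1≤k k<p cut → connected⇒¬cut perm-p conn k 1≤k k<p
      (subst (λ l → SameSet l [1⋯ k ]) (take-++-≤ p k (<⇒≤ k<p)) cut))
    (subst (λ l → SameSet l [1⋯ length p ])
      (sym (trans (take-++-≤ p (length p) ≤-refl) (List.take-all (length p) p ≤-refl))) (↭⇒SameSet perm-p))
    (λ k 1≤k k≤v →
      let eq = cong₂ SameSet (trans (take-++-+ p {map (length p +_) v} k)
                 (cong (p ++_) (List.take-map {f = length p +_} k v))) ([1⋯]-++ (length p) k)
          (to , from) = sameSet-shift perm-p
            (All.take⁺ k (All.tabulate (proj₁ ∘ ↭[1⋯]-bounds perm-v)))
            (All.tabulate (proj₁ ∘ ∈-[1⋯]⁻ {k}))
      in (λ cut → to (subst id eq cut)) , (λ cut → subst id (sym eq) (from cut))))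

private
  longer : ∀ p p′ {q q′ : List ℕ} → length p < length p′ → p ++ q ≡ p′ ++ q′ →
           ∃[ r ] (r ≢ [] × p′ ≡ p ++ r × q ≡ r ++ q′)
  longer []      (y ∷ p′) _        eq = y ∷ p′ , (λ ()) , refl , eq
  longer (x ∷ p) (y ∷ p′) (s≤s l<) eq =
    let (r , r≢[] , p′≡ , q≡) = longer p p′ l< (List.∷-injectiveʳ eq)
    in r , r≢[] , cong₂ _∷_ (sym (List.∷-injectiveˡ eq)) p′≡ , q≡

  -- If `p′` were `p ++ r` with `r` nonempty, connectedness would give an inversion between `p` and
  -- `r`; but `r` begins `q`, and `p` lies below `q`. Used both ways round, this fixes the length of
  -- the first component.
  not-shorter : ∀ p p′ {q q′} → p ≢ [] → Connected p′ → p ≪ q → p ++ q ≡ p′ ++ q′ → ¬ (length p < length p′)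
  not-shorter p p′ p≢[] conn′ p≪q eq l< =
    let (r , r≢[] , p′≡ , q≡) = longer p p′ l< eq
        (a , b , a∈ , b∈ , b<a) = conn′ p r p′≡ p≢[] r≢[]
    in <-asym b<a (p≪q a∈ (subst (b ∈_) (sym q≡) (∈-++⁺ˡ b∈)))

connected-length : ∀ {p q p′ q′} → IsPermutation p → IsPermutation q → IsPermutation p′ → IsPermutation q′ →
                   Connected p → Connected p′ → p ≢ [] → p′ ≢ [] →
                   directSum p q ≡ directSum p′ q′ → length p ≡ length p′
connected-length {p} {q} {p′} {q′} perm-p perm-q perm-p′ perm-q′ conn conn′ p≢[] p′≢[] eq = ≤-antisym
  (≮⇒≥ (not-shorter p′ p p′≢[] conn (++-≪ perm-p′ perm-q′) (sym eq)))
  (≮⇒≥ (not-shorter p p′ p≢[] conn′ (++-≪ perm-p perm-q) eq))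

take-drop-length : ∀ {A : Set} (p r : List A) → take (length p) (p ++ r) ≡ p × drop (length p) (p ++ r) ≡ r
take-drop-length []      r = refl , refl
take-drop-length (x ∷ p) r = let (t , d) = take-drop-length p r in cong (x ∷_) t , d

least : ∀ {P : Pred ℕ 0ℓ} → Decidable P → ∀ n → 1 ≤ n → P n →
        ∃[ k ] (1 ≤ k × k ≤ n × P k × (∀ j → 1 ≤ j → j < k → ¬ P j))
least {P} P? n = go n (<-wellFounded n)
  where
  go : ∀ n → Acc _<_ n → 1 ≤ n → P n → ∃[ k ] (1 ≤ k × k ≤ n × P k × (∀ j → 1 ≤ j → j < k → ¬ P j))
  go n (acc rs) 1≤n pn with any? (λ j → (1 ≤? j) ×-dec P? j) (upTo n)
  ... | no none = n , 1≤n , ≤-refl , pn , λ j 1≤j j<n pj → none (lose (∈-upTo⁺ j<n) (1≤j , pj))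
  ... | yes some =
    let (j , j∈ , 1≤j , pj) = find some
        (k , 1≤k , k≤j , rest) = go j (rs (∈-upTo⁻ j∈)) 1≤j pj
    in k , 1≤k , ≤-trans k≤j (<⇒≤ (∈-upTo⁻ j∈)) , rest

maximum : ∀ x (w : List ℕ) → ∃[ m ] (m ∈ x ∷ w × All (_≤ m) (x ∷ w))
maximum x []      = x , here refl , ≤-refl ∷ []
maximum x (y ∷ w) with maximum y w | ≤-total x y
... | m , m∈ , y≤m ∷ ≤m | inj₁ x≤y = m , there m∈ , ≤-trans x≤y y≤m ∷ y≤m ∷ ≤m
... | m , m∈ , ≤m       | inj₂ y≤x with ≤-total x m
...   | inj₁ x≤m = m , there m∈ , x≤m ∷ ≤m
...   | inj₂ m≤x = x , here refl , ≤-refl ∷ All.map (λ le → ≤-trans le m≤x) ≤m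

-- The component is the shortest nonempty prefix all of whose entries lie below all later ones. Its
-- maximum `m` separates the values, so `permutation-split` applies and shows that `m` is its
-- length.
first-component : ∀ {w} → IsPermutation w → w ≢ [] →
                  ∃₂ λ p v → IsPermutation p × IsPermutation v × p ≢ [] × Connected p × w ≡ directSum p v
first-component {[]} perm w≢[] = contradiction refl w≢[]
first-component {w@(x₀ ∷ w₀)} perm w≢[]
  with least (λ k → all? (λ a → all? (a <?_) (drop k w)) (take k w)) (length w) (s≤s z≤n)
         (subst (λ q → All (λ a → All (a <_) q) (take (length w) w)) (sym (List.drop-all (length w) w ≤-refl))
           (All.tabulate (λ _ → [])))
... | suc k , _ , k≤n , cut , ¬cut =
  p , v , subst (λ n → p ↭ [1⋯ n ]) m≡ p↭ , ↭[1⋯]⇒isPermutation v↭ , (λ ()) , connected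
  , trans (sym (List.take++drop≡id (suc k) w)) (cong (p ++_) (trans q≡ (cong (λ n → map (n +_) v) m≡)))
  where
  p q : List ℕ
  p = take (suc k) w
  q = drop (suc k) w
  p++q : p ++ q ≡ w
  p++q = List.take++drop≡id (suc k) w
  max : ∃[ m ] (m ∈ p × All (_≤ m) p)
  max = maximum x₀ (take k w₀)
  m : ℕ
  m = proj₁ max
  m≤n : m ≤ length w
  m≤n = proj₂ (↭[1⋯]-bounds perm (∈-take (suc k) {w} (proj₁ (proj₂ max))))
  split : p ↭ [1⋯ m ] × ∃[ v ] (q ≡ map (m +_) v × v ↭ [1⋯ length w ∸ m ])
  split = permutation-split {p} {q} {m} {length w ∸ m}
    (subst₂ (λ l n → l ↭ [1⋯ n ]) (sym p++q) (sym (m+[n∸m]≡n m≤n)) perm)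
    (proj₂ (proj₂ max)) (lookup cut (proj₁ (proj₂ max)))
  p↭ : p ↭ [1⋯ m ]
  p↭ = proj₁ split
  v : List ℕ
  v = proj₁ (proj₂ split)
  q≡ : q ≡ map (m +_) v
  q≡ = proj₁ (proj₂ (proj₂ split))
  v↭ : v ↭ [1⋯ length w ∸ m ]
  v↭ = proj₂ (proj₂ (proj₂ split))
  m≡ : m ≡ length p
  m≡ = sym (↭[1⋯]-length p↭)
  connected : Connected p
  -- As `p₁` is shorter than the least cut, some `a` in it is not below everything after `p₁`. The
  -- offending entry cannot lie in `q`, all of `p` being below `q`.
  connected p₁ p₂ p≡ p₁≢[] p₂≢[] =
    let (a , a∈ , a≮) = find (All.¬All⇒Any¬ (λ a → all? (a <?_) p₂++q) p₁ ¬cut₁)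
        (b , b∈ , a≮b) = find (All.¬All⇒Any¬ (a <?_) p₂++q a≮)
    in [ (λ b∈p₂ → a , b , a∈ , b∈p₂ , ≤∧≢⇒< (≮⇒≥ a≮b) (λ b≡a → unique-++-disjoint p₁ unique a∈ (subst (_∈ p₂++q) b≡a b∈)))
       , (λ b∈q → contradiction (lookup (lookup cut (subst (a ∈_) (sym p≡) (∈-++⁺ˡ a∈))) b∈q) a≮b) ]′ (∈-++⁻ p₂ b∈)
    where
    p₂++q : List ℕ
    p₂++q = p₂ ++ q
    w≡ : p₁ ++ p₂++q ≡ w
    w≡ = trans (sym (List.++-assoc p₁ p₂ q)) (trans (cong (_++ q) (sym p≡)) p++q)
    unique : Unique (p₁ ++ p₂++q)
    unique = subst Unique (sym w≡) (↭[1⋯]-unique perm)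
    nonempty : ∀ {l : List ℕ} → l ≢ [] → 1 ≤ length l
    nonempty {[]}    n = contradiction refl n
    nonempty {_ ∷ _} n = s≤s z≤n
    p₁<p : length p₁ < suc k
    p₁<p = ≤-trans (m<m+n (length p₁) (nonempty p₂≢[])) (≤-reflexive
      (trans (sym (List.length-++ p₁)) (trans (cong length (sym p≡))
        (trans (List.length-take (suc k) w) (m≤n⇒m⊓n≡m k≤n)))))
    ¬cut₁ : ¬ All (λ a → All (a <_) p₂++q) p₁
    ¬cut₁ c = ¬cut (length p₁) (nonempty p₁≢[]) p₁<p
      (subst₂ (λ t d → All (λ a → All (a <_) d) t)
        (trans (sym (proj₁ (take-drop-length p₁ p₂++q))) (cong (take (length p₁)) w≡))
        (trans (sym (proj₂ (take-drop-length p₁ p₂++q))) (cong (drop (length p₁)) w≡)) c)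

-- Right-to-left minima and maxima

length-splits : ∀ w → length (splits w) ≡ length w
length-splits []      = refl
length-splits (x ∷ w) = cong suc (trans (List.length-map _ (splits w)) (length-splits w))

nonrmin+rmin : ∀ w → nonrmin w + rmin w ≡ suc (length w)
nonrmin+rmin w = cong suc (trans (count-complement rlMin? (splits w)) (length-splits w))

private
  rmin-tail : ∀ x w → count rlMin? (map (λ (l , y , r) → (x ∷ l , y , r)) (splits w)) ≡ rmin w
  rmin-tail x w = sym (count-cong rlMin? rlMin? (λ (l , y , r) → (x ∷ l , y , r)) (splits w)
                    (All.tabulate λ _ → id , id))

  rmax-tail : ∀ x w → count rlMax? (map (λ (l , y , r) → (x ∷ l , y , r)) (splits w)) ≡ rmax w
  rmax-tail x w = sym (count-cong rlMax? rlMax? (λ (l , y , r) → (x ∷ l , y , r)) (splits w)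
                    (All.tabulate λ _ → id , id))

rmin-yes : ∀ x w → All (x <_) w → rmin (x ∷ w) ≡ suc (rmin w)
rmin-yes x w x< = trans (count-yes rlMin? _ x<) (cong suc (rmin-tail x w))

rmin-no : ∀ x w → ¬ All (x <_) w → rmin (x ∷ w) ≡ rmin w
rmin-no x w x≮ = trans (count-no rlMin? _ x≮) (rmin-tail x w)

rmax-yes : ∀ x w → All (_< x) w → rmax (x ∷ w) ≡ suc (rmax w)
rmax-yes x w <x = trans (count-yes rlMax? _ <x) (cong suc (rmax-tail x w))

rmax-no : ∀ x w → ¬ All (_< x) w → rmax (x ∷ w) ≡ rmax w
rmax-no x w ≮x = trans (count-no rlMax? _ ≮x) (rmax-tail x w)

rmin-++ : ∀ p q → p ≪ q → rmin (p ++ q) ≡ rmin p + rmin q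
rmin-++ []      q p≪q = refl
rmin-++ (x ∷ p) q p≪q = case all? (x <?_) p of λ where
    (yes x<) → trans (rmin-yes x (p ++ q) (All.++⁺ x< (All.tabulate (p≪q (here refl)))))
          (trans (cong suc (rmin-++ p q (p≪q ∘ there))) (cong (_+ rmin q) (sym (rmin-yes x p x<))))
    (no x≮) → trans (rmin-no x (p ++ q) (x≮ ∘ All.++⁻ˡ p))
          (trans (rmin-++ p q (p≪q ∘ there)) (cong (_+ rmin q) (sym (rmin-no x p x≮))))

rmax-++ : ∀ p q → p ≪ q → q ≢ [] → rmax (p ++ q) ≡ rmax q
rmax-++ []      q       p≪q q≢[] = refl
rmax-++ (x ∷ p) []      p≪q q≢[] = contradiction refl q≢[]
rmax-++ (x ∷ p) (y ∷ q) p≪q q≢[] =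
  trans (rmax-no x (p ++ y ∷ q)
          (λ a → <-asym (p≪q (here refl) (here refl)) (lookup (All.++⁻ʳ p a) (here refl))))
        (rmax-++ p (y ∷ q) (p≪q ∘ there) q≢[])

rmin-map : ∀ m w → rmin (map (m +_) w) ≡ rmin w
rmin-map m []      = refl
rmin-map m (x ∷ w) = case all? (x <?_) w of λ where
    (yes x<) → trans (rmin-yes (m + x) (map (m +_) w) (All.map⁺ (All.map (+-monoʳ-< m) x<)))
                       (trans (cong suc (rmin-map m w)) (sym (rmin-yes x w x<)))
    (no x≮) → trans (rmin-no (m + x) (map (m +_) w)
                             (λ a → x≮ (All.map (+-cancelˡ-< m _ _) (All.map⁻ a))))
                       (trans (rmin-map m w) (sym (rmin-no x w x≮)))

rmax-map : ∀ m w → rmax (map (m +_) w) ≡ rmax w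
rmax-map m []      = refl
rmax-map m (x ∷ w) = case all? (_<? x) w of λ where
    (yes <x) → trans (rmax-yes (m + x) (map (m +_) w) (All.map⁺ (All.map (+-monoʳ-< m) <x)))
                       (trans (cong suc (rmax-map m w)) (sym (rmax-yes x w <x)))
    (no ≮x) → trans (rmax-no (m + x) (map (m +_) w)
                             (λ a → ≮x (All.map (+-cancelˡ-< m _ _) (All.map⁻ a))))
                       (trans (rmax-map m w) (sym (rmax-no x w ≮x)))

rmin-directSum : ∀ {p q} → IsPermutation p → IsPermutation q → rmin (directSum p q) ≡ rmin p + rmin q
rmin-directSum {p} {q} perm-p perm-q = trans (rmin-++ p (map (length p +_) q) (++-≪ perm-p perm-q))
  (cong (rmin p +_) (rmin-map (length p) q))

map-≢[] : ∀ {A B : Set} {f : A → B} {w} → w ≢ [] → map f w ≢ []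
map-≢[] {w = []}    n _ = n refl
map-≢[] {w = _ ∷ _} n ()

rmax-directSum : ∀ {p q} → IsPermutation p → IsPermutation q → q ≢ [] → rmax (directSum p q) ≡ rmax q
rmax-directSum {p} {q} perm-p perm-q q≢[] =
  trans (rmax-++ p (map (length p +_) q) (++-≪ perm-p perm-q) (map-≢[] q≢[])) (rmax-map (length p) q)

lastEntry-∈ : ∀ {B} → B ≢ [] → lastEntry B ∈ B
lastEntry-∈ {[]}        B≢[] = contradiction refl B≢[]
lastEntry-∈ {x ∷ []}    B≢[] = here refl
lastEntry-∈ {x ∷ y ∷ B} B≢[] = there (lastEntry-∈ λ ())

lastEntry-map : ∀ f {B} → B ≢ [] → lastEntry (map f B) ≡ f (lastEntry B)
lastEntry-map f {[]}        B≢[] = contradiction refl B≢[]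
lastEntry-map f {x ∷ []}    B≢[] = refl
lastEntry-map f {x ∷ y ∷ B} B≢[] = lastEntry-map f {y ∷ B} λ ()

lastEntry-∷ : ∀ x {B} → B ≢ [] → lastEntry (x ∷ B) ≡ lastEntry B
lastEntry-∷ x {[]}    B≢[] = contradiction refl B≢[]
lastEntry-∷ x {_ ∷ _} B≢[] = refl

lastEntry-++ : ∀ p {q} → q ≢ [] → lastEntry (p ++ q) ≡ lastEntry q
lastEntry-++ []      q≢[] = refl
lastEntry-++ (x ∷ p) q≢[] = trans (lastEntry-∷ x (q≢[] ∘ List.++-conicalʳ p _)) (lastEntry-++ p q≢[])

-- Dyck paths.

module DyckProof where
  open Dyck

  -- Paths from height k to height 0.
  data Path : ℕ → List Step → Set where
    []   : Path 0 []
    up   : ∀ {k w} → Path (suc k) w → Path k (u ∷ w)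
    down : ∀ {k w} → Path k w → Path (suc k) (d ∷ w)

  infixr 5 _++ᵖ_
  _++ᵖ_ : ∀ {j k w v} → Path j w → Path k v → Path (j + k) (w ++ v)
  []     ++ᵖ q = q
  up p   ++ᵖ q = up (p ++ᵖ q)
  down p ++ᵖ q = down (p ++ᵖ q)

  path-balance : ∀ {k w} → Path k w → k + #u w ≡ #d w
  path-balance []               = refl
  path-balance (up {k} p)       = trans (+-suc k _) (path-balance p)
  path-balance (down p)         = cong suc (path-balance p)

  path-prefix : ∀ {k w} → Path k w → ∀ p s → w ≡ p ++ s → #d p ≤ k + #u p
  path-prefix q              []      s eq   = z≤n
  path-prefix (up {k} q)     (u ∷ p) s refl = ≤-trans (path-prefix q p s refl) (≤-reflexive (sym (+-suc k _)))
  path-prefix (down q)       (d ∷ p) s refl = s≤s (path-prefix q p s refl)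

  path⁺ : ∀ {k} w → k + #u w ≡ #d w → (∀ p s → w ≡ p ++ s → #d p ≤ k + #u p) → Path k w
  path⁺ {k} []      eq f = subst (λ j → Path j []) (trans (sym eq) (+-identityʳ k)) []
  path⁺ {k} (u ∷ w) eq f = up (path⁺ w (trans (sym (+-suc k _)) eq)
    λ p s eq′ → ≤-trans (f (u ∷ p) s (cong (u ∷_) eq′)) (≤-reflexive (+-suc k _)))
  path⁺ {zero} (d ∷ w) eq f = contradiction (f (d ∷ []) w refl) λ ()
  path⁺ {suc k} (d ∷ w) eq f = down (path⁺ w (suc-injective eq)
    λ p s eq′ → s≤s⁻¹ (f (d ∷ p) s (cong (d ∷_) eq′)))

  dyck⇒path : ∀ {w} → IsDyck w → Path 0 w
  dyck⇒path {w} (eq , f) = path⁺ w eq f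

  path⇒dyck : ∀ {w} → Path 0 w → IsDyck w
  path⇒dyck p = path-balance p , path-prefix p

  -- A path from height `j + suc k` has a first step down to height `k`. The part `s` before it
  -- stays at height `suc k` or above, so measured from that level it is a path from `j` to 0. The
  -- start is a separate variable `i` so that the path can be matched on.
  first-return : ∀ j {k i w} → i ≡ j + suc k → Path i w → ∃₂ λ s v → w ≡ s ++ d ∷ v × Path j s × Path k v
  first-return zero    ()   []
  first-return (suc j) ()   []
  first-return j       refl (up p) =
    let (s , v , eq , ps , pv) = first-return (suc j) refl p in u ∷ s , v , cong (u ∷_) eq , up ps , pv
  first-return zero    refl (down p) = [] , _ , refl , [] , p
  first-return (suc j) refl (down p) =
    let (s , v , eq , ps , pv) = first-return j refl p in d ∷ s , v , cong (d ∷_) eq , down ps , pv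

  -- If `s` were a proper prefix of `s′`, then `s′` would contain the `d` following `s` and go below
  -- height 0, which a `Path` cannot do.
  first-return-unique : ∀ {j s s′ v v′} → Path j s → Path j s′ → s ++ d ∷ v ≡ s′ ++ d ∷ v′ → s ≡ s′ × v ≡ v′
  first-return-unique []       []        eq = refl , List.∷-injectiveʳ eq
  first-return-unique []       (up _)    ()
  first-return-unique (up _)   []        ()
  first-return-unique (up p)   (up p′)   eq =
    let (s≡ , v≡) = first-return-unique p p′ (List.∷-injectiveʳ eq) in cong (u ∷_) s≡ , v≡
  first-return-unique (up p)   (down p′) ()
  first-return-unique (down p) (up p′)   ()
  first-return-unique (down p) (down p′) eq =
    let (s≡ , v≡) = first-return-unique p p′ (List.∷-injectiveʳ eq) in cong (d ∷_) s≡ , v≡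

  open RawCatalan dyck using (lam)

  lam-++ : ∀ s v → lam s ++ v ≡ u ∷ s ++ d ∷ v
  lam-++ s v = cong (u ∷_) (List.++-assoc s (d ∷ []) v)

  lam-path : ∀ {s} → Path 0 s → Path 0 (lam s)
  lam-path p = up (p ++ᵖ down [])

  decompose : ∀ {w} → Path 0 w → w ≡ [] ⊎ ∃₂ λ s v → IsDyck s × IsDyck v × w ≡ lam s ++ v
  decompose []     = inj₁ refl
  decompose (up p) =
    let (s , v , eq , ps , pv) = first-return 0 refl p
    in inj₂ (s , v , path⇒dyck ps , path⇒dyck pv , trans (cong (u ∷_) eq) (sym (lam-++ s v)))

  presentation : Presentation dyck
  presentation = record
    { e-isObject   = path⇒dyck []
    ; lam-isObject = λ o → path⇒dyck (lam-path (dyck⇒path o))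
    ; ⊕-isObject   = λ o o′ → path⇒dyck (dyck⇒path o ++ᵖ dyck⇒path o′)
    ; ∣e∣          = refl
    ; ∣lam∣        = λ {w} _ → cong suc (trans (count-++ (u ≟ₛ_) w (d ∷ [])) (+-identityʳ _))
    ; ∣⊕∣          = λ {w} {w′} _ _ → count-++ (u ≟ₛ_) w w′
    ; ⊕-assoc      = λ {w} {w′} {w″} _ _ _ → List.++-assoc w w′ w″
    ; ⊕-identityˡ  = λ _ → refl
    ; ⊕-identityʳ  = λ {w} _ → List.++-identityʳ w
    ; decompose    = decompose ∘ dyck⇒path
    ; cancel       = λ {s} {v} {s′} {v′} p _ p′ _ eq →
        first-return-unique (dyck⇒path p) (dyck⇒path p′)
          (List.∷-injectiveʳ (trans (sym (lam-++ s v)) (trans eq (lam-++ s′ v′))))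
    }

  comp-lam⊕ : ∀ {s v} → IsDyck s → IsDyck v → comp (lam s ++ v) ≡ suc (comp v)
  comp-lam⊕ {s} {v} ds dv = trans
    (cong (λ n → count (cut? (lam s ++ v)) [1⋯ n ]) (List.length-++ (lam s)))
    (count-cuts (cut? (lam s ++ v)) (cut? v) (length (lam s)) (length v) (s≤s z≤n)
      before
      (subst Balanced (sym (trans (take-++-≤ (lam s) (length (lam s)) ≤-refl) (List.take-all _ (lam s) ≤-refl))) lam-balanced)
      (λ k _ _ → let split = trans (cong #u (take-++-+ (lam s) {v} k)) (count-++ (u ≟ₛ_) (lam s) (take k v))
                     split′ = trans (cong #d (take-++-+ (lam s) {v} k)) (count-++ (d ≟ₛ_) (lam s) (take k v))
                 in (λ eq → +-cancelˡ-≡ (#u (lam s)) _ _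
                       (trans (sym split) (trans eq (trans split′ (cong (_+ #d (take k v)) (sym lam-balanced))))))
                  , (λ eq → trans split (trans (cong₂ _+_ lam-balanced eq) (sym split′)))))
    where
    Balanced : List Step → Set
    Balanced w = #u w ≡ #d w
    cut? : ∀ w k → Dec (Balanced (take k w))
    cut? w k = #u (take k w) ≟ #d (take k w)
    lam-balanced : Balanced (lam s)
    lam-balanced = path-balance (lam-path (dyck⇒path ds))
    before : ∀ k → 1 ≤ k → k < length (lam s) → ¬ Balanced (take k (lam s ++ v))
    -- The prefix is `u` followed by a prefix of `s`, in which `#d` is at most `#u`; the additional
    -- `u` makes the inequality strict.
    before (suc k) _ (s≤s k<) eq = <-irrefl (sym (trans (sym (cong #u take≡)) (trans eq (cong #d take≡))))
      (s≤s (proj₂ ds (take k s) (drop k s) (sym (List.take++drop≡id k s))))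
      where
      k≤ : k ≤ length s
      k≤ = s≤s⁻¹ (≤-trans k< (≤-reflexive (trans (List.length-++ s) (+-comm (length s) 1))))
      take≡ : take (suc k) (lam s ++ v) ≡ u ∷ take k s
      take≡ = cong (u ∷_) (trans (cong (take k) (List.++-assoc s _ v)) (take-++-≤ s k k≤))

  leading : List Step → ℕ
  leading w = length (takeWhile (d ≟ₛ_) w)

  leading-++ : ∀ w v → leading (w ++ u ∷ v) ≡ leading (w ++ u ∷ [])
  leading-++ []      v = refl
  leading-++ (u ∷ w) v = refl
  leading-++ (d ∷ w) v = cong suc (leading-++ w v)

  leading-∷ʳu : ∀ w → leading (w ++ u ∷ []) ≡ leading w
  leading-∷ʳu []      = refl
  leading-∷ʳu (u ∷ w) = refl
  leading-∷ʳu (d ∷ w) = cong suc (leading-∷ʳu w)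

  rcomp-lam : ∀ s → rcomp (lam s) ≡ suc (rcomp s)
  rcomp-lam s = trans (cong leading (begin
    reverse (u ∷ s ++ d ∷ [])             ≡⟨ List.unfold-reverse u (s ++ d ∷ []) ⟩
    reverse (s ++ d ∷ []) ++ u ∷ []       ≡⟨ cong (_++ u ∷ []) (List.reverse-++ s (d ∷ [])) ⟩
    d ∷ reverse s ++ u ∷ []               ∎))
    (cong suc (leading-∷ʳu (reverse s)))
    where open ≡-Reasoning

  -- A nonempty path from height 0 begins with `u`, and this `u` stops the final run of `d`'s before
  -- it can reach `w`.
  rcomp-++ : ∀ w {v} → Path 0 v → v ≢ [] → rcomp (w ++ v) ≡ rcomp v
  rcomp-++ w []             v≢[] = contradiction refl v≢[]
  rcomp-++ w (up {w = v} p) v≢[] = begin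
    leading (reverse (w ++ u ∷ v))                     ≡⟨ cong leading (List.reverse-++ w (u ∷ v)) ⟩
    leading (reverse (u ∷ v) ++ reverse w)             ≡⟨ cong (λ l → leading (l ++ reverse w)) (List.unfold-reverse u v) ⟩
    leading ((reverse v ++ u ∷ []) ++ reverse w)       ≡⟨ cong leading (List.++-assoc (reverse v) _ (reverse w)) ⟩
    leading (reverse v ++ u ∷ reverse w)               ≡⟨ leading-++ (reverse v) (reverse w) ⟩
    leading (reverse v ++ u ∷ [])                      ≡⟨ cong leading (sym (List.unfold-reverse u v)) ⟩
    leading (reverse (u ∷ v))                          ∎
    where open ≡-Reasoning

  -- A nonempty path to height 0 ends with d, so no factor ud straddles the border.
  peak-++ : ∀ {k w} v → Path k w → w ≢ [] → peak (w ++ v) ≡ peak w + peak v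
  peak-++ v       []                 w≢[] = contradiction refl w≢[]
  peak-++ v       (up (up p))        _    = peak-++ v (up p) λ ()
  peak-++ v       (up (down p))      _    = cong suc (peak-++ v (down p) λ ())
  peak-++ []      (down [])          _    = refl
  peak-++ (_ ∷ _) (down [])          _    = refl
  peak-++ v       (down (up p))      _    = peak-++ v (up p) λ ()
  peak-++ v       (down (down p))    _    = peak-++ v (down p) λ ()

  peak-lam : ∀ {s} → Path 0 s → s ≢ [] → peak (lam s) ≡ peak s
  peak-lam []     s≢[] = contradiction refl s≢[]
  peak-lam (up p) s≢[] = trans (peak-++ (d ∷ []) (up p) s≢[]) (+-identityʳ _)

  -- A path to height 0 does not end in `u`, so each `u` has a successor and starts exactly one of
  -- the factors `uu` and `ud`.
  uu+ud : ∀ {k w} → Path k w → factors u u w + factors u d w ≡ #u w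
  uu+ud []              = refl
  uu+ud (up (up p))     = cong suc (uu+ud (up p))
  uu+ud (up (down p))   = trans (+-suc _ _) (cong suc (uu+ud (down p)))
  uu+ud (down [])       = refl
  uu+ud (down (up p))   = uu+ud (up p)
  uu+ud (down (down p)) = uu+ud (down p)

  laws : StatisticLaws presentation comp peak rcomp nonpeak
  laws = record
    { a-e     = refl
    ; a-lam⊕  = comp-lam⊕
    ; a′-lam-e = refl
    ; a′-lam  = λ {s} _ _ → rcomp-lam s
    ; a′-lam⊕ = λ {s} _ q → rcomp-++ (lam s) (dyck⇒path q)
    ; b-lam-e = refl
    ; b-lam   = peak-lam ∘ dyck⇒path
    ; b-lam⊕  = λ {s} {v} p _ _ → peak-++ v (lam-path (dyck⇒path p)) λ ()
    ; b′-b    = λ p _ → cong suc (uu+ud (dyck⇒path p))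
    }

-- Triangulations.

module TriangulationProof where
  open Triangulation
  open PolygonEdges
  open IsTriangulation
  open RawCatalan triangulations using (lam; _⊕_)

  Within : ℕ → Edge → Set
  Within n (i , j) = 1 ≤ i × i < j × j ≤ n + 2

  possible⁺ : ∀ n {a} → Within n a → a ∈ possibleEdges n
  possible⁺ n (1≤i , i<j , j≤) = ∈-filter⁺ (λ (i , j) → i <? j)
    (∈-cartesianProduct⁺ (∈-[1⋯]⁺ 1≤i (≤-trans (<⇒≤ i<j) j≤)) (∈-[1⋯]⁺ (≤-trans 1≤i (<⇒≤ i<j)) j≤)) i<j

  possible⁻ : ∀ n {a} → a ∈ possibleEdges n → Within n a
  possible⁻ n a∈ =
    let (a∈′ , i<j) = ∈-filter⁻ (λ (i , j) → i <? j) {xs = cartesianProduct [1⋯ n + 2 ] [1⋯ n + 2 ]} a∈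
        (i∈ , j∈) = ∈-cartesianProduct⁻ [1⋯ n + 2 ] [1⋯ n + 2 ] a∈′
    in proj₁ (∈-[1⋯]⁻ i∈) , i<j , proj₂ (∈-[1⋯]⁻ j∈)

  possible-unique : ∀ n → Unique (possibleEdges n)
  possible-unique n = Unique.filter⁺ _ (Unique.cartesianProduct⁺ ([1⋯]-unique (n + 2)) ([1⋯]-unique (n + 2)))

  filter-cong : ∀ {A : Set} {P Q : Pred A 0ℓ} (P? : Decidable P) (Q? : Decidable Q) xs →
                (∀ {x} → x ∈ xs → (P x → Q x) × (Q x → P x)) → filter P? xs ≡ filter Q? xs
  filter-cong P? Q? []       f = refl
  filter-cong P? Q? (x ∷ xs) f with P? x | Q? x
  ... | yes p | yes q = cong (x ∷_) (filter-cong P? Q? xs (f ∘ there))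
  ... | yes p | no ¬q = contradiction (proj₁ (f (here refl)) p) ¬q
  ... | no ¬p | yes q = contradiction (proj₂ (f (here refl)) q) ¬p
  ... | no ¬p | no ¬q = filter-cong P? Q? xs (f ∘ there)

  edgeSet-cong : ∀ {n n′ es es′} → n ≡ n′ → (∀ {a} → a ∈ possibleEdges n → (a ∈ es → a ∈ es′) × (a ∈ es′ → a ∈ es)) →
                 edgeSet n es ≡ edgeSet n′ es′
  edgeSet-cong {n} refl f = cong (polygon n) (filter-cong (_∈ₑ? _) (_∈ₑ? _) (possibleEdges n) f)

  -- Normal edge lists of equal size are filtered from the same enumeration `possibleEdges`, so
  -- mutual inclusion already gives equal lists.
  extensional : ∀ {T T′} → edgeSet (size T) (edges T) ≡ T → edgeSet (size T′) (edges T′) ≡ T′ → size T ≡ size T′ →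
                (∀ {a} → a ∈ edges T → a ∈ edges T′) → (∀ {a} → a ∈ edges T′ → a ∈ edges T) → T ≡ T′
  extensional n n′ s to from = trans (sym n) (trans (edgeSet-cong s (λ _ → to , from)) n′)

  module _ (n : ℕ) {P : Pred Edge 0ℓ} (P? : Decidable P) where

    restrict : PolygonEdges
    restrict = polygon n (filter P? (possibleEdges n))

    restrict-normal : edgeSet n (edges restrict) ≡ restrict
    restrict-normal = cong (polygon n) (filter-cong (_∈ₑ? edges restrict) P? (possibleEdges n)
      (λ a∈ → (λ a∈′ → proj₂ (∈-filter⁻ P? {xs = possibleEdges n} a∈′)) , ∈-filter⁺ P? a∈))

    restrict⁺ : ∀ {a} → Within n a → P a → a ∈ edges restrict
    restrict⁺ w p = ∈-filter⁺ P? (possible⁺ n w) p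

    restrict⁻ : ∀ {a} → a ∈ edges restrict → Within n a × P a
    restrict⁻ a∈ = let (a∈′ , p) = ∈-filter⁻ P? {xs = possibleEdges n} a∈ in possible⁻ n a∈′ , p

  within : ∀ {T a} → IsTriangulation T → a ∈ edges T → Within (size T) a
  within {T} {a} t a∈ = proj₁ (restrict⁻ (size T) (_∈ₑ? edges T) (subst (λ T → a ∈ edges T) (sym (normal t)) a∈))

  edges-unique : ∀ {T} → IsTriangulation T → Unique (edges T)
  edges-unique {T} t = subst (λ T → Unique (edges T)) (normal t)
    (Unique.filter⁺ (_∈ₑ? edges T) (possible-unique (size T)))

  -- A side of the polygon crosses nothing, so maximality provides it; the same argument gives
  -- `last-edge`.
  base-edge : ∀ {T} → IsTriangulation T → (1 , 2) ∈ edges T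
  base-edge {T} t = maximal t (possible⁺ (size T) (s≤s z≤n , s≤s (s≤s z≤n) , m≤n+m 2 (size T)))
    λ { b∈ (inj₁ (1<c , c<2 , _)) → <⇒≱ 1<c (s≤s⁻¹ c<2)
      ; b∈ (inj₂ (c<1 , _)) → <⇒≱ c<1 (proj₁ (within t b∈)) }

  last-edge : ∀ {T} → IsTriangulation T → (1 , size T + 2) ∈ edges T
  last-edge {T} t = maximal t (possible⁺ (size T) (s≤s z≤n , m≤n+m 2 (size T) , ≤-refl))
    λ { b∈ (inj₁ (_ , _ , n<d)) → <⇒≱ n<d (proj₂ (proj₂ (within t b∈)))
      ; b∈ (inj₂ (c<1 , _)) → <⇒≱ c<1 (proj₁ (within t b∈)) }

  crosses-sym : ∀ {a b} → Crosses a b → Crosses b a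
  crosses-sym (inj₁ x) = inj₂ x
  crosses-sym (inj₂ x) = inj₁ x

  crosses-map : ∀ (f : ℕ → ℕ) {i j k l} →
                (i < k → f i < f k) × (k < i → f k < f i) × (k < j → f k < f j) ×
                (i < l → f i < f l) × (j < l → f j < f l) × (l < j → f l < f j) →
                Crosses (i , j) (k , l) → Crosses (f i , f j) (f k , f l)
  crosses-map f (ik , ki , kj , il , jl , lj) (inj₁ (x , y , z)) = inj₁ (ik x , kj y , jl z)
  crosses-map f (ik , ki , kj , il , jl , lj) (inj₂ (x , y , z)) = inj₂ (ki x , il y , lj z)

  crosses-shift⁺ : ∀ {a b} → Crosses a b → Crosses (shift a) (shift b)
  crosses-shift⁺ = crosses-map suc (s≤s , s≤s , s≤s , s≤s , s≤s , s≤s)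

  crosses-shift⁻ : ∀ {a b} → Crosses (shift a) (shift b) → Crosses a b
  crosses-shift⁻ (inj₁ (s≤s x , s≤s y , s≤s z)) = inj₁ (x , y , z)
  crosses-shift⁻ (inj₂ (s≤s x , s≤s y , s≤s z)) = inj₂ (x , y , z)

  relabel-≥2 : ∀ m {j} → 2 ≤ j → relabel m j ≡ m + j
  relabel-≥2 m (s≤s (s≤s _)) = refl

  relabel-high : ∀ m {j} → 2 ≤ j → m + 2 ≤ relabel m j
  relabel-high m 2≤j = ≤-trans (+-monoʳ-≤ m 2≤j) (≤-reflexive (sym (relabel-≥2 m 2≤j)))

  relabel-≥1 : ∀ m {j} → 1 ≤ j → 1 ≤ relabel m j
  relabel-≥1 m {suc zero}    _ = ≤-refl
  relabel-≥1 m {suc (suc j)} _ = ≤-trans (s≤s z≤n) (m≤n+m (suc (suc j)) m)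

  relabel-≤ : ∀ m {j} → 1 ≤ j → relabel m j ≤ m + j
  relabel-≤ m {suc zero}    _ = m≤n+m 1 m
  relabel-≤ m {suc (suc j)} _ = ≤-refl

  relabel-mono : ∀ m {i j} → 1 ≤ i → i < j → relabel m i < relabel m j
  relabel-mono m {suc zero}    {suc (suc j)} _ lt = ≤-trans lt (m≤n+m (suc (suc j)) m)
  relabel-mono m {suc (suc i)} {suc (suc j)} _ lt = +-monoʳ-< m lt
  relabel-mono m {suc zero}    {suc zero}    _ (s≤s ())
  relabel-mono m {suc (suc i)} {suc zero}    _ (s≤s ())

  relabel-reflects : ∀ m {i j} → 1 ≤ i → 1 ≤ j → relabel m i < relabel m j → i < j
  relabel-reflects m {i} {j} 1≤i 1≤j lt with <-cmp i j
  ... | tri< i<j _ _  = i<j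
  ... | tri≈ _ refl _ = contradiction lt (<-irrefl refl)
  ... | tri> _ _ j<i  = contradiction lt (<-asym (relabel-mono m 1≤j j<i))

  relabel-injective : ∀ m {i j} → 1 ≤ i → 1 ≤ j → relabel m i ≡ relabel m j → i ≡ j
  relabel-injective m {i} {j} 1≤i 1≤j eq with <-cmp i j
  ... | tri< i<j _ _ = contradiction eq (<⇒≢ (relabel-mono m 1≤i i<j))
  ... | tri≈ _ i≡j _ = i≡j
  ... | tri> _ _ j<i = contradiction (sym eq) (<⇒≢ (relabel-mono m 1≤j j<i))

  -- The image of `relabel m` leaves out 2, ..., `m + 1`, which are the vertices of the first
  -- summand other than the two ends of the glued edge.
  relabel-cases : ∀ m {i} → 1 ≤ i → i ≡ 1 ⊎ m + 2 ≤ relabel m i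
  relabel-cases m {suc zero}    _ = inj₁ refl
  relabel-cases m {suc (suc i)} _ = inj₂ (relabel-high m (s≤s (s≤s z≤n)))

  unrelabel : ∀ m z → z ≡ 1 ⊎ m + 2 ≤ z → ∃[ j ] (1 ≤ j × z ≡ relabel m j)
  unrelabel m z (inj₁ refl) = 1 , ≤-refl , refl
  unrelabel m z (inj₂ le)   = z ∸ m , ≤-trans (s≤s z≤n) 2≤ ,
    trans (sym (m+[n∸m]≡n (≤-trans (m≤m+n m 2) le))) (sym (relabel-≥2 m 2≤))
    where
    2≤ : 2 ≤ z ∸ m
    2≤ = m+n≤o⇒m≤o∸n 2 (≤-trans (≤-reflexive (+-comm 2 m)) le)

  relabel-relabel : ∀ m n {j} → 1 ≤ j → relabel m (relabel n j) ≡ relabel (m + n) j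
  relabel-relabel m n {suc zero}    _ = refl
  relabel-relabel m n {suc (suc j)} _ = trans (relabel-≥2 m (m≤n⇒m≤o+n n (s≤s (s≤s z≤n)))) (sym (+-assoc m n _))

  relabelEdge : ℕ → Edge → Edge
  relabelEdge m (i , j) = relabel m i , relabel m j

  within-shift : ∀ {n a} → Within n a → Within (suc n) (shift a)
  within-shift (1≤i , i<j , j≤) = s≤s z≤n , s≤s i<j , s≤s j≤

  within-relabel : ∀ m {n a} → Within n a → Within (m + n) (relabelEdge m a)
  within-relabel m {n} (1≤i , i<j , j≤) = relabel-≥1 m 1≤i , relabel-mono m 1≤i i<j ,
    ≤-trans (relabel-≤ m (≤-trans 1≤i (<⇒≤ i<j))) (≤-trans (+-monoʳ-≤ m j≤) (≤-reflexive (sym (+-assoc m n 2))))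

  within-mono : ∀ {m n a} → m ≤ n → Within m a → Within n a
  within-mono m≤n (1≤i , i<j , j≤) = 1≤i , i<j , ≤-trans j≤ (+-monoˡ-≤ 2 m≤n)

  within-unrelabel : ∀ m {n a} → 1 ≤ proj₁ a → 1 ≤ proj₂ a → Within (m + n) (relabelEdge m a) → Within n a
  within-unrelabel m {n} {i , j} 1≤i 1≤j (_ , lt , le) = 1≤i , i<j , +-cancelˡ-≤ m _ _
    (≤-trans (≤-reflexive (sym (relabel-≥2 m (≤-trans (s≤s 1≤i) i<j)))) (≤-trans le (≤-reflexive (+-assoc m n 2))))
    where
    i<j : i < j
    i<j = relabel-reflects m 1≤i 1≤j lt

  crosses-relabel⁺ : ∀ m {n n′ a b} → Within n a → Within n′ b → Crosses a b → Crosses (relabelEdge m a) (relabelEdge m b)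
  crosses-relabel⁺ m (1≤i , i<j , _) (1≤k , k<l , _) = crosses-map (relabel m)
    (relabel-mono m 1≤i , relabel-mono m 1≤k , relabel-mono m 1≤k , relabel-mono m 1≤i
    , relabel-mono m (≤-trans 1≤i (<⇒≤ i<j)) , relabel-mono m (≤-trans 1≤k (<⇒≤ k<l)))

  crosses-relabel⁻ : ∀ m {n n′ a b} → Within n a → Within n′ b → Crosses (relabelEdge m a) (relabelEdge m b) → Crosses a b
  crosses-relabel⁻ m (1≤i , i<j , _) (1≤k , k<l , _) = λ
    { (inj₁ (x , y , z)) → inj₁ (relabel-reflects m 1≤i 1≤k x , relabel-reflects m 1≤k 1≤j y , relabel-reflects m 1≤j 1≤l z)
    ; (inj₂ (x , y , z)) → inj₂ (relabel-reflects m 1≤k 1≤i x , relabel-reflects m 1≤i 1≤l y , relabel-reflects m 1≤l 1≤j z) }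
    where
    1≤j = ≤-trans 1≤i (<⇒≤ i<j)
    1≤l = ≤-trans 1≤k (<⇒≤ k<l)

  -- The edges of `lam T` and `T ⊕ V`, and the laws of the operations.

  data InLam (T : PolygonEdges) : Edge → Set where
    base  : InLam T (1 , 2)
    top   : InLam T (1 , suc (size T) + 2)
    inner : ∀ {a} → a ∈ edges T → InLam T (shift a)

  ∈-lam⁺ : ∀ {T a} → IsTriangulation T → InLam T a → a ∈ edges (lam T)
  ∈-lam⁺ {T} t base = restrict⁺ (suc (size T)) (_∈ₑ? _) (s≤s z≤n , s≤s (s≤s z≤n) , m≤n+m 2 (suc (size T))) (here refl)
  ∈-lam⁺ {T} t top  = restrict⁺ (suc (size T)) (_∈ₑ? _) (s≤s z≤n , m≤n+m 2 (suc (size T)) , ≤-refl)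
    (there (here (cong (1 ,_) (sym (+-suc (size T) 2)))))
  ∈-lam⁺ {T} t (inner a∈) = restrict⁺ (suc (size T)) (_∈ₑ? _) (within-shift (within t a∈)) (there (there (∈-map⁺ shift a∈)))

  ∈-lam⁻ : ∀ {T a} → a ∈ edges (lam T) → InLam T a
  ∈-lam⁻ {T} a∈ with proj₂ (restrict⁻ (suc (size T)) (_∈ₑ? _) a∈)
  ... | here refl = base
  ... | there (here refl) = subst (λ k → InLam T (1 , k)) (sym (+-suc (size T) 2)) top
  ... | there (there a∈′) with ∈-map⁻ shift a∈′
  ...   | b , b∈ , refl = inner b∈

  data InSum (T V : PolygonEdges) : Edge → Set where
    lower : ∀ {a} → a ∈ edges T → InSum T V a
    upper : ∀ {a} → a ∈ edges V → InSum T V (relabelEdge (size T) a)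

  ∈-⊕⁺ : ∀ {T V a} → IsTriangulation T → IsTriangulation V → InSum T V a → a ∈ edges (T ⊕ V)
  ∈-⊕⁺ {T} {V} t v (lower a∈) = restrict⁺ (size T + size V) (_∈ₑ? _)
    (within-mono (m≤m+n (size T) (size V)) (within t a∈)) (∈-++⁺ˡ a∈)
  ∈-⊕⁺ {T} {V} t v (upper a∈) = restrict⁺ (size T + size V) (_∈ₑ? _)
    (within-relabel (size T) (within v a∈)) (∈-++⁺ʳ (edges T) (∈-map⁺ (relabelEdge (size T)) a∈))

  ∈-⊕⁻ : ∀ {T V a} → a ∈ edges (T ⊕ V) → InSum T V a
  ∈-⊕⁻ {T} {V} a∈ with ∈-++⁻ (edges T) (proj₂ (restrict⁻ (size T + size V) (_∈ₑ? _) a∈))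
  ... | inj₁ a∈T = lower a∈T
  ... | inj₂ a∈V with ∈-map⁻ (relabelEdge (size T)) a∈V
  ...   | b , b∈ , refl = upper b∈

  e-isObject : IsTriangulation (polygon 0 ((1 , 2) ∷ []))
  e-isObject = record
    { normal      = refl
    ; nonCrossing = λ { (here refl) (here refl) (inj₁ (1<1 , _)) → <-irrefl refl 1<1
                      ; (here refl) (here refl) (inj₂ (1<1 , _)) → <-irrefl refl 1<1 }
    ; maximal     = λ a∈ _ → a∈
    }

  lam-isObject : ∀ {T} → IsTriangulation T → IsTriangulation (lam T)
  lam-isObject {T} t = record
    { normal      = restrict-normal (suc n) (_∈ₑ? _)
    ; nonCrossing = λ a∈ b∈ → nc (∈-lam⁻ a∈) (∈-lam⁻ b∈)
    ; maximal     = λ a∈ → mx (possible⁻ (suc (size T)) a∈)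
    }
    where
    n : ℕ
    n = size T
    within′ : ∀ {a} → InLam T a → Within (suc n) a
    within′ base       = s≤s z≤n , s≤s (s≤s z≤n) , m≤n+m 2 (suc n)
    within′ top        = s≤s z≤n , m≤n+m 2 (suc n) , ≤-refl
    within′ (inner a∈) = within-shift (within t a∈)
    -- The two edges at 1 are sides of the polygon.
    side : ∀ {a b} → a ≡ (1 , 2) ⊎ a ≡ (1 , suc n + 2) → Within (suc n) b → ¬ Crosses a b
    side (inj₁ refl) (1≤c , _ , _)  (inj₁ (1<c , c<2 , _)) = <⇒≱ 1<c (s≤s⁻¹ c<2)
    side (inj₁ refl) (1≤c , _ , _)  (inj₂ (c<1 , _ , _))   = <⇒≱ c<1 1≤c
    side (inj₂ refl) (_ , _ , d≤)   (inj₁ (_ , _ , n<d))   = <⇒≱ n<d d≤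
    side (inj₂ refl) (1≤c , _ , _)  (inj₂ (c<1 , _ , _))   = <⇒≱ c<1 1≤c
    nc : ∀ {a b} → InLam T a → InLam T b → ¬ Crosses a b
    nc base       b          x = side (inj₁ refl) (within′ b) x
    nc top        b          x = side (inj₂ refl) (within′ b) x
    nc (inner a∈) base       x = side (inj₁ refl) (within′ (inner a∈)) (crosses-sym x)
    nc (inner a∈) top        x = side (inj₂ refl) (within′ (inner a∈)) (crosses-sym x)
    nc (inner a∈) (inner b∈) x = nonCrossing t a∈ b∈ (crosses-shift⁻ x)
    mx : ∀ {a} → Within (suc n) a → (∀ {b} → b ∈ edges (lam T) → ¬ Crosses a b) → a ∈ edges (lam T)
    mx {suc zero , y} (_ , 1<y , y≤) free with y ≟ 2 | y ≟ suc n + 2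
    ... | yes refl | _        = ∈-lam⁺ t base
    ... | no _     | yes refl = ∈-lam⁺ t top
    -- Any other edge at 1 would cross the edge from 2 to `n + 3`, the shifted last edge of `T`.
    ... | no y≢2   | no y≢n   = contradiction (inj₁ (s≤s (s≤s z≤n) , ≤∧≢⇒< 1<y (y≢2 ∘ sym) , ≤∧≢⇒< y≤ y≢n))
                                  (free (∈-lam⁺ t (inner (last-edge t))))
    mx {suc (suc x) , suc y} (_ , s≤s lt , s≤s le) free =
      ∈-lam⁺ t (inner (maximal t (possible⁺ n (s≤s z≤n , lt , le))
        (λ b∈ x → free (∈-lam⁺ t (inner b∈)) (crosses-shift⁺ x))))

  ⊕-isObject : ∀ {T V} → IsTriangulation T → IsTriangulation V → IsTriangulation (T ⊕ V)
  ⊕-isObject {T} {V} t v = record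
    { normal      = restrict-normal (m + n) (_∈ₑ? _)
    ; nonCrossing = λ a∈ b∈ → nc (∈-⊕⁻ a∈) (∈-⊕⁻ b∈)
    ; maximal     = λ a∈ → mx (possible⁻ (size T + size V) a∈)
    }
    where
    m n : ℕ
    m = size T
    n = size V
    -- Both ends of a relabelled edge of `V` avoid the open interval from 1 to `m + 2`, while an
    -- edge of `T` stays within the closed one, so the ends cannot interleave.
    separate : ∀ {a b} → a ∈ edges T → b ∈ edges V → ¬ Crosses a (relabelEdge m b)
    separate a∈ b∈ x with within t a∈ | within v b∈
    ... | 1≤i , _ , j≤ | 1≤k , k<l , _ with x
    ...   | inj₂ (_ , _ , l<j) = <⇒≱ l<j (≤-trans j≤ (relabel-high m (≤-trans (s≤s 1≤k) k<l)))
    ...   | inj₁ (i<k , k<j , _) with relabel-cases m 1≤k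
    ...     | inj₁ refl = <⇒≱ i<k 1≤i
    ...     | inj₂ m≤k  = <⇒≱ k<j (≤-trans j≤ m≤k)
    nc : ∀ {a b} → InSum T V a → InSum T V b → ¬ Crosses a b
    nc (lower a∈) (lower b∈) x = nonCrossing t a∈ b∈ x
    nc (lower a∈) (upper b∈) x = separate a∈ b∈ x
    nc (upper a∈) (lower b∈) x = separate b∈ a∈ (crosses-sym x)
    nc (upper a∈) (upper b∈) x = nonCrossing v a∈ b∈ (crosses-relabel⁻ m (within v a∈) (within v b∈) x)
    mx : ∀ {a} → Within (m + n) a → (∀ {b} → b ∈ edges (T ⊕ V) → ¬ Crosses a b) → a ∈ edges (T ⊕ V)
    mx {x , y} w@(1≤x , x<y , _) free with y ≤? m + 2
    ... | yes y≤ = ∈-⊕⁺ t v (lower (maximal t (possible⁺ m (1≤x , x<y , y≤)) (λ b∈ → free (∈-⊕⁺ t v (lower b∈)))))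
    ... | no y≰ = subst (_∈ edges (T ⊕ V)) (sym eq) (∈-⊕⁺ t v (upper
            (maximal v (possible⁺ n w′) (λ b∈ c → free (∈-⊕⁺ t v (upper b∈))
              (subst (λ a → Crosses a _) (sym eq) (crosses-relabel⁺ m w′ (within v b∈) c))))))
      where
      x-outside : x ≡ 1 ⊎ m + 2 ≤ x
      x-outside with x ≟ 1 | m + 2 ≤? x
      ... | yes x≡1 | _       = inj₁ x≡1
      ... | no _    | yes m≤x = inj₂ m≤x
      -- With `x` strictly between 1 and `m + 2`, and `y` beyond, the edge would cross the glued
      -- edge `(1 , m + 2)`.
      ... | no x≢1  | no m≰x  = contradiction (inj₂ (≤∧≢⇒< 1≤x (x≢1 ∘ sym) , ≰⇒> m≰x , ≰⇒> y≰))
                                  (free (∈-⊕⁺ t v (lower (last-edge t))))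
      x′ = unrelabel m x x-outside
      y′ = unrelabel m y (inj₂ (<⇒≤ (≰⇒> y≰)))
      eq : (x , y) ≡ relabelEdge m (proj₁ x′ , proj₁ y′)
      eq = cong₂ _,_ (proj₂ (proj₂ x′)) (proj₂ (proj₂ y′))
      w′ : Within n (proj₁ x′ , proj₁ y′)
      w′ = within-unrelabel m (proj₁ (proj₂ x′)) (proj₁ (proj₂ y′)) (subst (Within (m + n)) eq w)

  ⊕-normal : ∀ T V → edgeSet (size (T ⊕ V)) (edges (T ⊕ V)) ≡ T ⊕ V
  ⊕-normal T V = restrict-normal (size T + size V) (_∈ₑ? _)

  relabelEdge-relabelEdge : ∀ m n {k a} → Within k a → relabelEdge m (relabelEdge n a) ≡ relabelEdge (m + n) a
  relabelEdge-relabelEdge m n (1≤i , i<j , _) =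
    cong₂ _,_ (relabel-relabel m n 1≤i) (relabel-relabel m n (≤-trans 1≤i (<⇒≤ i<j)))

  ⊕-assoc : ∀ {T U V} → IsTriangulation T → IsTriangulation U → IsTriangulation V → (T ⊕ U) ⊕ V ≡ T ⊕ (U ⊕ V)
  ⊕-assoc {T} {U} {V} t u v = extensional (⊕-normal (T ⊕ U) V) (⊕-normal T (U ⊕ V)) (+-assoc (size T) (size U) (size V))
    (to ∘ ∈-⊕⁻) (from ∘ ∈-⊕⁻)
    where
    tu = ⊕-isObject t u
    uv = ⊕-isObject u v
    to : ∀ {a} → InSum (T ⊕ U) V a → a ∈ edges (T ⊕ (U ⊕ V))
    to (lower a∈) with ∈-⊕⁻ {T} {U} a∈
    ... | lower a∈T = ∈-⊕⁺ t uv (lower a∈T)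
    ... | upper a∈U = ∈-⊕⁺ t uv (upper (∈-⊕⁺ u v (lower a∈U)))
    to (upper a∈) = subst (_∈ edges (T ⊕ (U ⊕ V))) (relabelEdge-relabelEdge (size T) (size U) (within v a∈))
      (∈-⊕⁺ t uv (upper (∈-⊕⁺ u v (upper a∈))))
    from : ∀ {a} → InSum T (U ⊕ V) a → a ∈ edges ((T ⊕ U) ⊕ V)
    from (lower a∈) = ∈-⊕⁺ tu v (lower (∈-⊕⁺ t u (lower a∈)))
    from (upper a∈) with ∈-⊕⁻ {U} {V} a∈
    ... | lower a∈U = ∈-⊕⁺ tu v (lower (∈-⊕⁺ t u (upper a∈U)))
    ... | upper a∈V = subst (_∈ edges ((T ⊕ U) ⊕ V)) (sym (relabelEdge-relabelEdge (size T) (size U) (within v a∈V)))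
                        (∈-⊕⁺ tu v (upper a∈V))

  private
    E : PolygonEdges
    E = polygon 0 ((1 , 2) ∷ [])

  relabel-0 : ∀ {j} → 1 ≤ j → relabel 0 j ≡ j
  relabel-0 {suc zero}    _ = refl
  relabel-0 {suc (suc j)} _ = refl

  ⊕-identityˡ : ∀ {T} → IsTriangulation T → E ⊕ T ≡ T
  ⊕-identityˡ {T} t = extensional (⊕-normal E T) (normal t) refl (to ∘ ∈-⊕⁻)
    (λ a∈ → subst (_∈ edges (E ⊕ T)) (same a∈) (∈-⊕⁺ e-isObject t (upper a∈)))
    where
    same : ∀ {a} → a ∈ edges T → relabelEdge 0 a ≡ a
    same a∈ = let (1≤i , i<j , _) = within t a∈ in cong₂ _,_ (relabel-0 1≤i) (relabel-0 (≤-trans 1≤i (<⇒≤ i<j)))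
    to : ∀ {a} → InSum E T a → a ∈ edges T
    to (lower (here refl)) = base-edge t
    to (upper a∈)          = subst (_∈ edges T) (sym (same a∈)) a∈

  ⊕-identityʳ : ∀ {T} → IsTriangulation T → T ⊕ E ≡ T
  ⊕-identityʳ {T} t = extensional (⊕-normal T E) (normal t) (+-identityʳ (size T)) (to ∘ ∈-⊕⁻)
    (λ a∈ → ∈-⊕⁺ t e-isObject (lower a∈))
    where
    to : ∀ {a} → InSum T E a → a ∈ edges T
    to (lower a∈)          = a∈
    to (upper (here refl)) = last-edge t

  -- The edges of lam S ⊕ V: the new edge from 1, and those of S and of V, whose
  -- side (1 , 2) becomes the other new edge from 1.

  data Part (S V : PolygonEdges) : Edge → Set where
    base  : Part S V (1 , 2)
    inner : ∀ {a} → a ∈ edges S → Part S V (shift a)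
    outer : ∀ {a} → a ∈ edges V → Part S V (relabelEdge (suc (size S)) a)

  part⁺ : ∀ {S V a} → IsTriangulation S → IsTriangulation V → Part S V a → a ∈ edges (lam S ⊕ V)
  part⁺ s v base       = ∈-⊕⁺ (lam-isObject s) v (lower (∈-lam⁺ s base))
  part⁺ s v (inner a∈) = ∈-⊕⁺ (lam-isObject s) v (lower (∈-lam⁺ s (inner a∈)))
  part⁺ s v (outer a∈) = ∈-⊕⁺ (lam-isObject s) v (upper a∈)

  part⁻ : ∀ {S V a} → IsTriangulation V → a ∈ edges (lam S ⊕ V) → Part S V a
  part⁻ {S} {V} v a∈ with ∈-⊕⁻ {lam S} {V} a∈
  ... | upper b∈ = outer b∈
  ... | lower b∈ with ∈-lam⁻ {S} b∈
  ...   | base     = base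
  ...   | top      = outer (base-edge v)
  ...   | inner c∈ = inner c∈

  -- With `k = suc p`, the least neighbour of 1 other than 2 is `k + 2`. The triangle on 1, 2 and
  -- `k + 2` separates `S`, on the vertices 2, ..., `k + 2`, from `V`, on 1 and the vertices from
  -- `k + 2` on.
  decompose : ∀ {T} → IsTriangulation T → T ≡ E ⊎ ∃₂ λ S V → IsTriangulation S × IsTriangulation V × T ≡ lam S ⊕ V
  decompose {polygon zero es} t = inj₁ (extensional (normal t) refl refl
    (λ a∈ → possible⁺ 0 (within t a∈)) (λ { (here refl) → base-edge t }))
  decompose {T@(polygon (suc n′) es)} t
    with least (λ k → (1 , k + 2) ∈ₑ? es) (suc n′) (s≤s z≤n) (last-edge t)
  ... | suc p , _ , k≤n , chord , minimal = inj₂ (S , V , s , v , T≡)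
    where
    k r : ℕ
    k = suc p
    r = suc n′ ∸ k
    k+r : k + r ≡ suc n′
    k+r = m+[n∸m]≡n k≤n
    S? : ∀ a → Dec (shift a ∈ es)
    S? a = shift a ∈ₑ? es
    V? : ∀ a → Dec (relabelEdge k a ∈ es)
    V? a = relabelEdge k a ∈ₑ? es
    S V : PolygonEdges
    S = restrict p S?
    V = restrict r V?
    no-shorter : ∀ {d} → 2 < d → d < k + 2 → (1 , d) ∉ es
    no-shorter {suc (suc d)} (s≤s (s≤s 1≤d)) d<k d∈ = minimal d 1≤d
      (+-cancelʳ-< 2 d k (≤-trans (s≤s (≤-reflexive (+-comm d 2))) d<k))
      (subst (λ j → (1 , j) ∈ es) (+-comm 2 d) d∈)
    no-straddle : ∀ {c e} → 1 < c → c < k + 2 → k + 2 < e → (c , e) ∉ es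
    no-straddle 1<c c<k k<e b∈ = nonCrossing t chord b∈ (inj₁ (1<c , c<k , k<e))
    1≤ : ∀ {a} → a ∈ es → 1 ≤ proj₁ a
    1≤ a∈ = proj₁ (within t a∈)
    2<k+2 : 2 < k + 2
    2<k+2 = s≤s (m≤n+m 2 p)
    chord′ : (2 , k + 2) ∈ es
    -- The third side of the triangle: an edge crossing it either crosses the chord `(1 , k + 2)`
    -- too, or leaves 1 for a vertex strictly between 2 and `k + 2`, against minimality.
    chord′ = maximal t (possible⁺ (suc n′) (s≤s z≤n , 2<k+2 , +-monoˡ-≤ 2 k≤n)) λ
      { b∈ (inj₁ (2<c , c<k , k<d)) → no-straddle (<⇒≤ 2<c) c<k k<d b∈
      ; {suc zero , d} b∈ (inj₂ (_ , 2<d , d<k)) → no-shorter 2<d d<k b∈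
      ; {suc (suc c) , d} b∈ (inj₂ (s≤s (s≤s ()) , _))
      ; {zero , d} b∈ (inj₂ _) → <⇒≱ (1≤ b∈) z≤n }
    lower⁻ : ∀ {c e} → 2 ≤ c → e ≤ k + 2 → (c , e) ∈ es → ∃[ b ] (b ∈ edges S × (c , e) ≡ shift b)
    lower⁻ {suc c} {suc e} (s≤s 1≤c) (s≤s e≤) b∈ =
      (c , e) , restrict⁺ p S? (1≤c , s≤s⁻¹ (proj₁ (proj₂ (within t b∈))) , e≤) b∈ , refl
    lower⁻ {suc c} {zero} _ _ b∈ = contradiction (proj₁ (proj₂ (within t b∈))) λ ()
    upper⁻ : ∀ {c e} → c ≡ 1 ⊎ k + 2 ≤ c → k + 2 ≤ e → (c , e) ∈ es → ∃[ b ] (b ∈ edges V × (c , e) ≡ relabelEdge k b)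
    upper⁻ {c} {e} c-out e-out b∈ =
      let (c′ , 1≤c′ , c≡) = unrelabel k c c-out
          (e′ , 1≤e′ , e≡) = unrelabel k e (inj₂ e-out)
          eq = cong₂ _,_ c≡ e≡
      in (c′ , e′) , restrict⁺ r V? (within-unrelabel k 1≤c′ 1≤e′
           (subst₂ Within (sym k+r) eq (within t b∈))) (subst (_∈ es) eq b∈) , eq
    s : IsTriangulation S
    s = record
      { normal      = restrict-normal p S?
      ; nonCrossing = λ a∈ b∈ x → nonCrossing t (proj₂ (restrict⁻ p S? a∈)) (proj₂ (restrict⁻ p S? b∈)) (crosses-shift⁺ x)
      ; maximal     = λ a∈ free → ∈-filter⁺ S? a∈ (mx (possible⁻ p a∈) free)
      }
      where
      -- Any edge of `T` that crosses a chord of the part for `S` has both ends in that part,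
      -- because it crosses neither `chord′` nor leaves 1 early. Maximality of `S` thus follows from
      -- that of `T`.
      inside : ∀ {x y c e} → 1 ≤ x → y ≤ p + 2 → Crosses (suc x , suc y) (c , e) → (c , e) ∈ es → 2 ≤ c × e ≤ k + 2
      inside {x} {y} {c} {e} 1≤x y≤ (inj₁ (x<c , c<y , y<e)) b∈ = 2≤c , ≮⇒≥ (λ k<e →
        nonCrossing t chord′ b∈ (inj₁ (≤-trans (s≤s (s≤s 1≤x)) x<c , ≤-trans c<y (s≤s y≤) , k<e)))
        where
        2≤c : 2 ≤ c
        2≤c = ≤-trans (s≤s 1≤x) (<⇒≤ x<c)
      inside {x} {y} {suc zero} {e} 1≤x y≤ (inj₂ (c<x , x<e , e<y)) b∈ =
        contradiction b∈ (no-shorter (≤-trans (s≤s (s≤s 1≤x)) x<e) (≤-trans e<y (s≤s y≤)))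
      inside {x} {y} {suc (suc c)} {e} 1≤x y≤ (inj₂ (c<x , x<e , e<y)) b∈ = s≤s (s≤s z≤n) , ≤-trans (<⇒≤ e<y) (s≤s y≤)
      inside {x} {y} {zero} {e} 1≤x y≤ (inj₂ _) b∈ = contradiction (1≤ b∈) λ ()
      mx : ∀ {a} → Within p a → (∀ {b} → b ∈ edges S → ¬ Crosses a b) → shift a ∈ es
      mx (1≤x , x<y , y≤) free = maximal t (possible⁺ (suc n′) (within-mono k≤n (within-shift (1≤x , x<y , y≤)))) λ b∈ x →
        let (2≤c , e≤) = inside 1≤x y≤ x b∈
            (b , b∈S , eq) = lower⁻ 2≤c e≤ b∈
        in free b∈S (crosses-shift⁻ (subst (Crosses _) eq x))
    v : IsTriangulation V
    v = record
      { normal      = restrict-normal r V?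
      ; nonCrossing = λ a∈ b∈ x → let (wa , a∈T) = restrict⁻ r V? a∈ ; (wb , b∈T) = restrict⁻ r V? b∈ in
                        nonCrossing t a∈T b∈T (crosses-relabel⁺ k wa wb x)
      ; maximal     = λ a∈ free → ∈-filter⁺ V? a∈ (mx (possible⁻ r a∈) free)
      }
      where
      -- The counterpart of `inside` for `V`; here it is the chord `(1 , k + 2)` that keeps crossing
      -- edges out of the part for `S`.
      outside : ∀ {x y c e} → x ≡ 1 ⊎ k + 2 ≤ x → k + 2 ≤ y → Crosses (x , y) (c , e) → (c , e) ∈ es →
                (c ≡ 1 ⊎ k + 2 ≤ c) × k + 2 ≤ e
      outside (inj₁ refl) y≥ (inj₁ (x<c , c<y , y<e)) b∈ =
        inj₂ (≮⇒≥ (λ c<k → no-straddle x<c c<k (≤-<-trans y≥ y<e) b∈)) , ≤-trans y≥ (<⇒≤ y<e)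
      outside (inj₂ x≥) y≥ (inj₁ (x<c , c<y , y<e)) b∈ = inj₂ (≤-trans x≥ (<⇒≤ x<c)) , ≤-trans y≥ (<⇒≤ y<e)
      outside (inj₁ refl) y≥ (inj₂ (c<1 , _)) b∈ = contradiction (1≤ b∈) (<⇒≱ c<1)
      outside {c = c} (inj₂ x≥) y≥ (inj₂ (c<x , x<e , e<y)) b∈ with c ≟ 1
      ... | yes c≡1 = inj₁ c≡1 , ≤-trans x≥ (<⇒≤ x<e)
      ... | no c≢1  = inj₂ (≮⇒≥ (λ c<k → no-straddle (≤∧≢⇒< (1≤ b∈) (c≢1 ∘ sym)) c<k (≤-<-trans x≥ x<e) b∈))
                    , ≤-trans x≥ (<⇒≤ x<e)
      mx : ∀ {a} → Within r a → (∀ {b} → b ∈ edges V → ¬ Crosses a b) → relabelEdge k a ∈ es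
      mx {a} w@(1≤x , x<y , _) free = maximal t (possible⁺ (suc n′) (subst (λ n → Within n (relabelEdge k a)) k+r (within-relabel k w))) λ b∈ x →
        let (c-out , e-out) = outside (relabel-one 1≤x) (relabel-high k (≤-trans (s≤s 1≤x) x<y)) x b∈
            (b , b∈V , eq) = upper⁻ c-out e-out b∈
        in free b∈V (crosses-relabel⁻ k w (proj₁ (restrict⁻ r V? b∈V)) (subst (Crosses _) eq x))
        where
        relabel-one : ∀ {x} → 1 ≤ x → relabel k x ≡ 1 ⊎ k + 2 ≤ relabel k x
        relabel-one 1≤x = [ (λ { refl → inj₁ refl }) , inj₂ ]′ (relabel-cases k 1≤x)
    to : ∀ {a} → a ∈ es → a ∈ edges (lam S ⊕ V)
    to {c , e} b∈ with c ≟ 1 | k + 2 ≤? e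
    ... | yes refl | yes k≤e = let (b , b∈V , eq) = upper⁻ (inj₁ refl) k≤e b∈ in
                                subst (_∈ edges (lam S ⊕ V)) (sym eq) (part⁺ s v (outer b∈V))
    ... | yes refl | no k≰e with e ≟ 2
    ...   | yes refl = part⁺ s v base
    ...   | no e≢2   = contradiction b∈ (no-shorter (≤∧≢⇒< (proj₁ (proj₂ (within t b∈))) (e≢2 ∘ sym)) (≰⇒> k≰e))
    to {c , e} b∈ | no c≢1 | k≤?e with e ≤? k + 2
    ...   | yes e≤k = let (b , b∈S , eq) = lower⁻ (≤∧≢⇒< (1≤ b∈) (c≢1 ∘ sym)) e≤k b∈ in
                        subst (_∈ edges (lam S ⊕ V)) (sym eq) (part⁺ s v (inner b∈S))
    ...   | no e≰k  =
            let k≤c = ≮⇒≥ (λ c<k → no-straddle (≤∧≢⇒< (1≤ b∈) (c≢1 ∘ sym)) c<k (≰⇒> e≰k) b∈)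
                (b , b∈V , eq) = upper⁻ (inj₂ k≤c) (<⇒≤ (≰⇒> e≰k)) b∈
            in subst (_∈ edges (lam S ⊕ V)) (sym eq) (part⁺ s v (outer b∈V))
    from : ∀ {a} → Part S V a → a ∈ es
    from base       = base-edge t
    from (inner a∈) = proj₂ (restrict⁻ p S? a∈)
    from (outer a∈) = proj₂ (restrict⁻ r V? a∈)
    T≡ : T ≡ lam S ⊕ V
    T≡ = extensional (normal t) (⊕-normal (lam S) V) (sym k+r) to (from ∘ part⁻ v)

  -- Beyond 2, the least neighbour of 1 in the sum is `suc (size S) + 2`. Together with `lam-chord`
  -- this recovers the size of `S`, the first step of cancellation; it also shows that 1 has no
  -- nearer neighbour.
  size-lam : ∀ {S V i} → IsTriangulation S → IsTriangulation V → 1 ≤ i → (1 , i + 2) ∈ edges (lam S ⊕ V) → size S < i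
  size-lam {S} {V} {i} s v 1≤i a∈ = go (part⁻ v a∈) refl
    where
    go : ∀ {a} → Part S V a → a ≡ (1 , i + 2) → size S < i
    go base       eq = contradiction (+-cancelʳ-≡ 2 0 i (proj₂ (,-injective eq))) (<⇒≢ 1≤i)
    go (inner b∈) eq = contradiction (proj₁ (within s b∈)) (<⇒≱ (≤-reflexive (proj₁ (,-injective eq))))
    go (outer b∈) eq = +-cancelʳ-≤ 2 (suc (size S)) i (≤-trans
      (relabel-high (suc (size S)) (let (1≤c , c<e , _) = within v b∈ in ≤-trans (s≤s 1≤c) c<e))
      (≤-reflexive (proj₂ (,-injective eq))))

  lam-chord : ∀ {S V} → IsTriangulation S → IsTriangulation V → (1 , suc (size S) + 2) ∈ edges (lam S ⊕ V)
  lam-chord s v = part⁺ s v (outer (base-edge v))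

  part-inner⁻ : ∀ {S V a} → IsTriangulation S → IsTriangulation V → Within (size S) a →
                shift a ∈ edges (lam S ⊕ V) → a ∈ edges S
  part-inner⁻ {S} {V} {a} s v (1≤i , i<j , j≤) a∈ = go (part⁻ v a∈) refl
    where
    go : ∀ {b} → Part S V b → b ≡ shift a → a ∈ edges S
    go base       eq = contradiction 1≤i (<⇒≱ (≤-reflexive (sym (proj₁ (,-injective eq)))))
    go (inner b∈) eq = subst (_∈ edges S) (cong₂ _,_ (suc-injective (proj₁ (,-injective eq))) (suc-injective (proj₂ (,-injective eq)))) b∈
    go (outer {c , _} b∈) eq = contradiction
      (≤-trans (s≤s i<j) (s≤s j≤)) (<⇒≱ (s≤s (≤-trans m≤ (≤-reflexive (proj₁ (,-injective eq))))))
      where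
      m≤ : suc (size S) + 2 ≤ relabel (suc (size S)) c
      m≤ = [ (λ { refl → contradiction (proj₁ (,-injective eq)) (<⇒≢ (s≤s 1≤i)) }) , id ]′
             (relabel-cases (suc (size S)) (proj₁ (within v b∈)))

  part-outer⁻ : ∀ {S V a n} → IsTriangulation S → IsTriangulation V → Within n a →
                relabelEdge (suc (size S)) a ∈ edges (lam S ⊕ V) → a ∈ edges V
  part-outer⁻ {S} {V} {i , j} s v (1≤i , i<j , _) a∈ = go (part⁻ v a∈) refl
    where
    m≤j : suc (size S) + 2 ≤ relabel (suc (size S)) j
    m≤j = relabel-high (suc (size S)) (≤-trans (s≤s 1≤i) i<j)
    go : ∀ {b} → Part S V b → b ≡ relabelEdge (suc (size S)) (i , j) → (i , j) ∈ edges V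
    go base       eq = contradiction (≤-trans m≤j (≤-reflexive (sym (proj₂ (,-injective eq)))))
                         (<⇒≱ (s≤s (m≤n+m 2 (size S))))
    go (inner {c , e} b∈) eq = let (1≤c , c<e , e≤) = within s b∈ in
      [ (λ { refl → contradiction (sym (proj₁ (,-injective eq))) (<⇒≢ (s≤s 1≤c)) })
      , (λ m≤i → contradiction (≤-trans m≤i (≤-reflexive (sym (proj₁ (,-injective eq)))))
                    (<⇒≱ (s≤s (≤-trans c<e e≤))))
      ]′ (relabel-cases (suc (size S)) 1≤i)
    go (outer b∈) eq = let (1≤c , c<e , _) = within v b∈ in
      subst (_∈ edges V) (cong₂ _,_
        (relabel-injective (suc (size S)) 1≤c 1≤i (proj₁ (,-injective eq)))
        (relabel-injective (suc (size S)) (≤-trans 1≤c (<⇒≤ c<e)) (≤-trans 1≤i (<⇒≤ i<j)) (proj₂ (,-injective eq)))) b∈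

  cancel : ∀ {S V S′ V′} → IsTriangulation S → IsTriangulation V → IsTriangulation S′ → IsTriangulation V′ →
           lam S ⊕ V ≡ lam S′ ⊕ V′ → S ≡ S′ × V ≡ V′
  cancel {S} {V} {S′} {V′} s v s′ v′ eq =
    extensional (normal s) (normal s′) p≡
      (λ {a} a∈ → part-inner⁻ s′ v′ (subst (λ n → Within n a) p≡ (within s a∈)) (subst (λ T → shift a ∈ edges T) eq (part⁺ s v (inner a∈))))
      (λ {a} a∈ → part-inner⁻ s v (subst (λ n → Within n a) (sym p≡) (within s′ a∈)) (subst (λ T → shift a ∈ edges T) (sym eq) (part⁺ s′ v′ (inner a∈))))
    , extensional (normal v) (normal v′) (+-cancelˡ-≡ (suc (size S)) _ _
        (trans (cong size eq) (cong (λ n → suc n + size V′) (sym p≡))))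
      (λ {a} a∈ → part-outer⁻ {a = a} s′ v′ (within v a∈)
        (subst₂ (λ n T → relabelEdge (suc n) a ∈ edges T) p≡ eq (part⁺ s v (outer a∈))))
      (λ {a} a∈ → part-outer⁻ {a = a} s v (within v′ a∈)
        (subst₂ (λ n T → relabelEdge (suc n) a ∈ edges T) (sym p≡) (sym eq) (part⁺ s′ v′ (outer a∈))))
    where
    p≡ : size S ≡ size S′
    p≡ = ≤-antisym
      (s≤s⁻¹ (size-lam s v (s≤s z≤n) (subst (λ T → (1 , suc (size S′) + 2) ∈ edges T) (sym eq) (lam-chord s′ v′))))
      (s≤s⁻¹ (size-lam s′ v′ (s≤s z≤n) (subst (λ T → (1 , suc (size S) + 2) ∈ edges T) eq (lam-chord s v))))

  presentation : Presentation triangulations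
  presentation = record
    { e-isObject   = e-isObject
    ; lam-isObject = lam-isObject
    ; ⊕-isObject   = ⊕-isObject
    ; ∣e∣          = refl
    ; ∣lam∣        = λ _ → refl
    ; ∣⊕∣          = λ _ _ → refl
    ; ⊕-assoc      = ⊕-assoc
    ; ⊕-identityˡ  = ⊕-identityˡ
    ; ⊕-identityʳ  = ⊕-identityʳ
    ; decompose    = decompose
    ; cancel       = cancel
    }

  -- The glued edge is listed once, as the image of the side `(1 , 2)` of `V`, so degrees can be
  -- added over the three pieces without correction.
  edges-↭ : ∀ {S V} → IsTriangulation S → IsTriangulation V →
            edges (lam S ⊕ V) ↭ (1 , 2) ∷ map shift (edges S) ++ map (relabelEdge (suc (size S))) (edges V)
  edges-↭ {S} {V} s v = unique-set⇒↭ (edges-unique (⊕-isObject (lam-isObject s) v)) (fresh ∷ unique) (to ∘ part⁻ v) from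
    where
    m : ℕ
    m = suc (size S)
    inner-outer : ∀ {a b} → a ∈ edges S → b ∈ edges V → shift a ≢ relabelEdge m b
    inner-outer a∈ b∈ eq = let (1≤i , i<j , j≤) = within s a∈ ; (1≤c , _) = within v b∈ in
      [ (λ { refl → <⇒≢ (s≤s 1≤i) (sym (proj₁ (,-injective eq))) })
      , (λ m≤ → <⇒≱ (s≤s (≤-trans i<j j≤)) (≤-trans m≤ (≤-reflexive (sym (proj₁ (,-injective eq))))))
      ]′ (relabel-cases m 1≤c)
    unique : Unique (map shift (edges S) ++ map (relabelEdge m) (edges V))
    unique = Unique.++⁺ (Unique.map⁺ (λ eq → cong₂ _,_ (suc-injective (proj₁ (,-injective eq))) (suc-injective (proj₂ (,-injective eq))))
                          (edges-unique s))
               (unique-map (edges-unique v) id)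
               (λ (a∈ , b∈) → let (_ , a∈′ , a≡) = ∈-map⁻ shift a∈ ; (_ , b∈′ , b≡) = ∈-map⁻ (relabelEdge m) b∈ in
                  inner-outer a∈′ b∈′ (trans (sym a≡) b≡))
      where
      relabelEdge-injective : ∀ {a b} → a ∈ edges V → b ∈ edges V → relabelEdge m a ≡ relabelEdge m b → a ≡ b
      relabelEdge-injective a∈ b∈ eq = let (1≤i , i<j , _) = within v a∈ ; (1≤c , c<e , _) = within v b∈ in
        cong₂ _,_ (relabel-injective m 1≤i 1≤c (proj₁ (,-injective eq)))
          (relabel-injective m (≤-trans 1≤i (<⇒≤ i<j)) (≤-trans 1≤c (<⇒≤ c<e)) (proj₂ (,-injective eq)))
      unique-map : ∀ {es} → Unique es → (∀ {a} → a ∈ es → a ∈ edges V) → Unique (map (relabelEdge m) es)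
      unique-map []       ⊆V = []
      unique-map (n ∷ u)  ⊆V = All.map⁺ (All.tabulate (λ b∈ eq →
          lookup n b∈ (relabelEdge-injective (⊆V (here refl)) (⊆V (there b∈)) eq)))
        ∷ unique-map u (⊆V ∘ there)
    fresh : All ((1 , 2) ≢_) (map shift (edges S) ++ map (relabelEdge m) (edges V))
    fresh = All.++⁺
      (All.map⁺ (All.tabulate λ a∈ eq → <⇒≢ (s≤s (proj₁ (within s a∈))) (proj₁ (,-injective eq))))
      (All.map⁺ (All.tabulate λ b∈ eq → let (1≤c , c<e , _) = within v b∈ in
        <⇒≱ (s≤s (m≤n+m 2 (size S))) (≤-trans (relabel-high m (≤-trans (s≤s 1≤c) c<e))
          (≤-reflexive (sym (proj₂ (,-injective eq)))))))
    to : ∀ {a} → Part S V a → a ∈ (1 , 2) ∷ map shift (edges S) ++ map (relabelEdge m) (edges V)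
    to base       = here refl
    to (inner a∈) = there (∈-++⁺ˡ (∈-map⁺ shift a∈))
    to (outer a∈) = there (∈-++⁺ʳ (map shift (edges S)) (∈-map⁺ (relabelEdge m) a∈))
    from : ∀ {a} → a ∈ (1 , 2) ∷ map shift (edges S) ++ map (relabelEdge m) (edges V) → a ∈ edges (lam S ⊕ V)
    from (here refl) = part⁺ s v base
    from (there a∈) with ∈-++⁻ (map shift (edges S)) a∈
    ... | inj₁ a∈S = let (_ , b∈ , eq) = ∈-map⁻ shift a∈S in subst (_∈ edges (lam S ⊕ V)) (sym eq) (part⁺ s v (inner b∈))
    ... | inj₂ a∈V = let (_ , b∈ , eq) = ∈-map⁻ (relabelEdge m) a∈V in subst (_∈ edges (lam S ⊕ V)) (sym eq) (part⁺ s v (outer b∈))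

  -- Vertex degrees in `lam S ⊕ V`.

  Incident : ℕ → Edge → Set
  Incident v (i , j) = i ≡ v ⊎ j ≡ v

  incident? : ∀ v a → Dec (Incident v a)
  incident? v (i , j) = (i ≟ v) ⊎-dec (j ≟ v)

  degree-lam⊕ : ∀ {S V} → IsTriangulation S → IsTriangulation V → ∀ k →
    degree (lam S ⊕ V) k ≡ count (incident? k) ((1 , 2) ∷ []) + (count (incident? k) (map shift (edges S))
                           + count (incident? k) (map (relabelEdge (suc (size S))) (edges V)))
  degree-lam⊕ {S} {V} s v k = trans (count-↭ (incident? k) (edges-↭ s v))
    (trans (count-++ (incident? k) ((1 , 2) ∷ []) _)
      (cong (count (incident? k) ((1 , 2) ∷ []) +_) (count-++ (incident? k) (map shift (edges S)) _)))

  degree-shift-high : ∀ {S k} → IsTriangulation S → suc (size S + 2) < k → count (incident? k) (map shift (edges S)) ≡ 0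
  degree-shift-high {S} {k} s k> = count-≡0 (incident? k) (All.map⁺ (All.tabulate λ a∈ →
    let (_ , i<j , j≤) = within s a∈ in
    λ { (inj₁ refl) → <⇒≱ k> (s≤s (≤-trans (<⇒≤ i<j) j≤)) ; (inj₂ refl) → <⇒≱ k> (s≤s j≤) }))

  degree-shift-1 : ∀ {S} → IsTriangulation S → count (incident? 1) (map shift (edges S)) ≡ 0
  degree-shift-1 {S} s = count-≡0 (incident? 1) (All.map⁺ (All.tabulate λ a∈ →
    let (1≤i , i<j , _) = within s a∈ in
    λ { (inj₁ refl) → <⇒≱ 1≤i z≤n ; (inj₂ refl) → <⇒≱ (≤-trans 1≤i (<⇒≤ i<j)) z≤n }))

  degree-shift : ∀ T k → count (incident? (suc k)) (map shift (edges T)) ≡ degree T k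
  degree-shift T k = sym (count-cong (incident? k) (incident? (suc k)) shift (edges T) (All.tabulate λ _ →
      [ inj₁ ∘ cong suc , inj₂ ∘ cong suc ]′ , [ inj₁ ∘ suc-injective , inj₂ ∘ suc-injective ]′))

  degree-relabel : ∀ {T} m k → IsTriangulation T → 1 ≤ k →
                   count (incident? (relabel m k)) (map (relabelEdge m) (edges T)) ≡ degree T k
  degree-relabel {T} m k t 1≤k = sym (count-cong (incident? k) (incident? (relabel m k)) (relabelEdge m) (edges T)
    (All.tabulate λ a∈ → let (1≤i , i<j , _) = within t a∈ in
        [ inj₁ ∘ cong (relabel m) , inj₂ ∘ cong (relabel m) ]′
      , [ inj₁ ∘ relabel-injective m 1≤i 1≤k , inj₂ ∘ relabel-injective m (≤-trans 1≤i (<⇒≤ i<j)) 1≤k ]′))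

  degree-≥1 : ∀ {T k a} → a ∈ edges T → Incident k a → suc (degree T k ∸ 1) ≡ degree T k
  degree-≥1 {T} {k} a∈ inc = m+[n∸m]≡n (nonempty (∈-filter⁺ (incident? k) a∈ inc))
    where
    nonempty : ∀ {A : Set} {xs : List A} {x} → x ∈ xs → 1 ≤ length xs
    nonempty (here _)  = s≤s z≤n
    nonempty (there _) = s≤s z≤n

  comp-lam⊕ : ∀ {S V} → IsTriangulation S → IsTriangulation V → comp (lam S ⊕ V) ≡ suc (comp V)
  comp-lam⊕ {S} {V} s v = trans
    (cong (_∸ 1) (trans (degree-lam⊕ s v 1) (cong₂ (λ x y → 1 + (x + y)) (degree-shift-1 s) (degree-relabel (suc (size S)) 1 v ≤-refl))))
    (sym (degree-≥1 {V} (base-edge v) (inj₁ refl)))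

  incident-base : ∀ {k} → 2 < k → count (incident? k) ((1 , 2) ∷ []) ≡ 0
  incident-base {k} 2<k = count-no (incident? k) {1 , 2} [] λ { (inj₁ refl) → <⇒≱ 2<k (s≤s z≤n) ; (inj₂ refl) → <-irrefl refl 2<k }

  -- For nonempty `V` the last vertex lies beyond every vertex of `lam S`, so only edges of `V` end
  -- there.
  rcomp-lam⊕ : ∀ {S V} → IsTriangulation S → IsTriangulation V → 1 ≤ size V → rcomp (lam S ⊕ V) ≡ rcomp V
  rcomp-lam⊕ {S} {V} s v 1≤n = cong (_∸ 1) (trans (cong (degree (lam S ⊕ V)) last≡) (trans (degree-lam⊕ s v (relabel m (size V + 2)))
    (cong₂ _+_ (incident-base (subst (2 <_) last≡ (s≤s (m≤n+m 2 (size S + size V)))))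
      (cong₂ _+_ (degree-shift-high s (subst (m + 2 <_) last≡ (+-monoˡ-< 2 (m<m+n m 1≤n))))
                 (degree-relabel m (size V + 2) v (≤-trans (s≤s z≤n) (m≤n+m 2 (size V))))))))
    where
    m : ℕ
    m = suc (size S)
    last≡ : m + size V + 2 ≡ relabel m (size V + 2)
    last≡ = trans (+-assoc m (size V) 2) (sym (relabel-≥2 m (m≤n+m 2 (size V))))

  -- In `lam S ⊕ E` the last vertex keeps its neighbours in `S` and gains 1; the additional edge is
  -- the image of the single edge of `E`.
  rcomp-lam : ∀ {S} → IsTriangulation S → rcomp (lam S) ≡ suc (rcomp S)
  rcomp-lam {S} s = begin
    rcomp (lam S)                       ≡⟨ cong rcomp (sym (⊕-identityʳ (lam-isObject s))) ⟩
    degree (lam S ⊕ E) (m + 0 + 2) ∸ 1  ≡⟨ cong (λ k → degree (lam S ⊕ E) k ∸ 1) (cong (_+ 2) (+-identityʳ m)) ⟩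
    degree (lam S ⊕ E) (m + 2) ∸ 1      ≡⟨ cong (_∸ 1) (trans (degree-lam⊕ s e-isObject (m + 2))
      (cong₂ _+_ (incident-base (s≤s (m≤n+m 2 (size S))))
        (cong₂ _+_ (degree-shift S (size S + 2)) (count-yes (incident? (m + 2)) {1 , m + 2} [] (inj₂ refl))))) ⟩
    degree S (size S + 2) + 1 ∸ 1       ≡⟨ m+n∸n≡m (degree S (size S + 2)) 1 ⟩
    degree S (size S + 2)               ≡⟨ sym (degree-≥1 {S} (last-edge s) (inj₂ refl)) ⟩
    suc (rcomp S)                       ∎
    where
    open ≡-Reasoning
    m : ℕ
    m = suc (size S)

  -- The triangle on the side (i , i+1) has its third vertex before i.
  Apex : PolygonEdges → ℕ → Set
  Apex T i = Any (λ j → (j , i) ∈ edges T × (j , suc i) ∈ edges T) [1⋯ i ∸ 1 ]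

  apex? : ∀ T i → Dec (Apex T i)
  apex? T i = any? (λ j → ((j , i) ∈ₑ? edges T) ×-dec ((j , suc i) ∈ₑ? edges T)) [1⋯ i ∸ 1 ]

  apex⁺ : ∀ {T i j} → IsTriangulation T → (j , i) ∈ edges T → (j , suc i) ∈ edges T → Apex T i
  apex⁺ {i = suc i} t a∈ b∈ = let (1≤j , j<i , _) = within t a∈ in lose (∈-[1⋯]⁺ 1≤j (s≤s⁻¹ j<i)) (a∈ , b∈)
  apex⁺ {i = zero}  t a∈ b∈ = contradiction (proj₁ (proj₂ (within t a∈))) λ ()

  apex⁻ : ∀ {T i} → Apex T i → ∃[ j ] ((j , i) ∈ edges T × (j , suc i) ∈ edges T)
  apex⁻ ap = let (j , _ , p) = find ap in j , p

  -- The side (2 , 3) of lam S, where size S = n, has apex 1 just when S is empty.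
  ear : ℕ → ℕ
  ear zero    = 1
  ear (suc _) = 0

  module _ {S V} (s : IsTriangulation S) (v : IsTriangulation V) where
    private
      m : ℕ
      m = suc (size S)
      U : PolygonEdges
      U = lam S ⊕ V
      u : IsTriangulation U
      u = ⊕-isObject (lam-isObject s) v

    no-chord : ∀ {k} → 2 < k → k < m + 2 → (1 , k) ∉ edges U
    no-chord {k} 2<k k<m a∈ = <⇒≱ k<m (≤-trans (+-monoˡ-≤ 2 (size-lam s v 1≤ (subst (λ k → (1 , k) ∈ edges U) (sym k≡) a∈))) (≤-reflexive k≡))
      where
      k≡ : k ∸ 2 + 2 ≡ k
      k≡ = m∸n+n≡m (<⇒≤ 2<k)
      1≤ : 1 ≤ k ∸ 2
      1≤ = m+n≤o⇒m≤o∸n 1 2<k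

    apex-inner : ∀ k → 1 ≤ k → k ≤ size S → (Apex S (suc k) → Apex U (suc (suc k))) × (Apex U (suc (suc k)) → Apex S (suc k))
    apex-inner k 1≤k k≤ = (λ ap → let (j , a∈ , b∈) = apex⁻ {S} {suc k} ap in apex⁺ u (part⁺ s v (inner a∈)) (part⁺ s v (inner b∈)))
                        , (λ ap → let (j , a∈ , b∈) = apex⁻ {U} {suc (suc k)} ap in back j a∈ b∈)
      where
      k+2< : suc (suc k) < m + 2
      k+2< = s≤s (≤-trans (s≤s (s≤s k≤)) (≤-reflexive (+-comm 2 (size S))))
      back : ∀ j → (j , suc (suc k)) ∈ edges U → (j , suc (suc (suc k))) ∈ edges U → Apex S (suc k)
      back zero          a∈ b∈ = contradiction (proj₁ (within u a∈)) λ ()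
      -- The new vertex 1 cannot be the apex of a side of `S`, as it has no neighbour strictly
      -- between 2 and `m + 2`.
      back (suc zero)    a∈ b∈ = contradiction a∈ (no-chord (s≤s (s≤s 1≤k)) k+2<)
      back (suc (suc j)) a∈ b∈ = let (_ , lt , _) = within u a∈ in
        apex⁺ s (part-inner⁻ s v (s≤s z≤n , s≤s⁻¹ lt , ≤-trans (n≤1+n _) (s≤s⁻¹ k+2<)) a∈)
                (part-inner⁻ s v (s≤s z≤n , m<n⇒m<1+n (s≤s⁻¹ lt) , s≤s⁻¹ k+2<) b∈)

    apex-outer : ∀ k → 1 ≤ k → k ≤ size V → (Apex V (suc k) → Apex U (m + suc k)) × (Apex U (m + suc k) → Apex V (suc k))
    apex-outer k 1≤k k≤ =
        (λ ap → let (j , a∈ , b∈) = apex⁻ {V} {suc k} ap in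
           apex⁺ u (subst (λ i → (relabel m j , i) ∈ edges U) (relabel-≥2 m (s≤s 1≤k)) (part⁺ s v (outer a∈)))
                   (subst (λ i → (relabel m j , i) ∈ edges U) (trans (relabel-≥2 m (s≤s (s≤s z≤n))) (+-suc m (suc k)))
                     (part⁺ s v (outer b∈))))
      , (λ ap → let (j , a∈ , b∈) = apex⁻ {U} {m + suc k} ap in back j a∈ b∈)
      where
      back : ∀ j → (j , m + suc k) ∈ edges U → (j , suc (m + suc k)) ∈ edges U → Apex V (suc k)
      -- That `j` is a vertex of `V` is read off the edge to the farther end of the side: for
      -- `k = 1` the nearer end is `m + 2`, which edges of `S` reach too.
      back j a∈ b∈ = let (j′ , 1≤j′ , j≡) = unrelabel m j (start (part⁻ v b∈) refl) in
        apex⁺ v (outer-edge 1≤j′ j≡ (s≤s 1≤k) a∈)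
                (outer-edge 1≤j′ j≡ (s≤s (s≤s z≤n)) (subst (λ i → (j , i) ∈ edges U) (sym (+-suc m (suc k))) b∈))
        where
        start : ∀ {b} → Part S V b → b ≡ (j , suc (m + suc k)) → j ≡ 1 ⊎ m + 2 ≤ j
        start base       eq = inj₁ (sym (proj₁ (,-injective eq)))
        start (inner c∈) eq = contradiction
          (≤-trans (≤-reflexive (suc-injective (sym (proj₂ (,-injective eq))))) (proj₂ (proj₂ (within s c∈))))
          (<⇒≱ (s≤s (+-monoʳ-≤ (size S) (s≤s 1≤k))))
        start (outer {c , _} c∈) eq = [ (λ { refl → inj₁ (sym (proj₁ (,-injective eq))) })
                                , (λ m≤ → inj₂ (≤-trans m≤ (≤-reflexive (proj₁ (,-injective eq))))) ]′
                                (relabel-cases m (proj₁ (within v c∈)))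
        outer-edge : ∀ {j′ l} → 1 ≤ j′ → j ≡ relabel m j′ → 2 ≤ l → (j , m + l) ∈ edges U → (j′ , l) ∈ edges V
        outer-edge {j′} {l} 1≤j′ j≡ 2≤l c∈ =
          part-outer⁻ s v (within-unrelabel m {size V} {j′ , l} 1≤j′ (<⇒≤ 2≤l) (within u c∈′)) c∈′
          where
          c∈′ : relabelEdge m (j′ , l) ∈ edges U
          c∈′ = subst₂ (λ x y → (x , y) ∈ edges U) j≡ (sym (relabel-≥2 m 2≤l)) c∈

    apex-2 : ∀ n → size S ≡ n → count (apex? U) (2 ∷ []) ≡ ear n
    apex-2 zero    eq = count-yes (apex? U) [] (apex⁺ u (part⁺ s v base)
                    (subst (λ p → (1 , suc p + 2) ∈ edges U) eq (lam-chord s v)))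
    apex-2 (suc p) eq = count-no (apex? U) [] λ ap → let (j , a∈ , b∈) = apex⁻ {U} {2} ap in no-apex j a∈ b∈
      where
      no-apex : ∀ j → (j , 2) ∈ edges U → (j , 3) ∉ edges U
      no-apex zero          a∈ b∈ = contradiction (proj₁ (within u a∈)) λ ()
      no-apex (suc zero)    a∈ b∈ = no-chord (s≤s (s≤s (s≤s z≤n)))
        (subst (λ p → 3 < suc p + 2) (sym eq) (s≤s (s≤s (m≤n+m 2 p)))) b∈
      no-apex (suc (suc j)) a∈ b∈ = <⇒≱ (proj₁ (proj₂ (within u a∈))) (s≤s (s≤s z≤n))

    -- Every side counted in `U` comes from a side counted in `S` or in `V`, except `(2 , 3)`: it
    -- comes from the side `(1 , 2)` of `S`, which `tr` does not inspect.
    tr-lam⊕ : tr U ≡ ear (size S) + (tr S + tr V)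
    tr-lam⊕ = begin
      count (apex? U) (map suc [1⋯ m + size V ])
        ≡⟨ cong (count (apex? U)) candidates ⟩
      count (apex? U) (2 ∷ map (suc ∘ suc) [1⋯ size S ] ++ map (suc ∘ (m +_)) [1⋯ size V ])
        ≡⟨ count-++ (apex? U) (2 ∷ []) _ ⟩
      count (apex? U) (2 ∷ []) + count (apex? U) (map (suc ∘ suc) [1⋯ size S ] ++ map (suc ∘ (m +_)) [1⋯ size V ])
        ≡⟨ cong₂ _+_ (apex-2 (size S) refl) (count-++ (apex? U) (map (suc ∘ suc) [1⋯ size S ]) _) ⟩
      ear (size S) + (count (apex? U) (map (suc ∘ suc) [1⋯ size S ]) + count (apex? U) (map (suc ∘ (m +_)) [1⋯ size V ]))
        ≡⟨ cong (ear (size S) +_) (cong₂ _+_ inner-part outer-part) ⟩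
      ear (size S) + (tr S + tr V) ∎
      where
      open ≡-Reasoning
      candidates : map suc [1⋯ m + size V ] ≡ 2 ∷ map (suc ∘ suc) [1⋯ size S ] ++ map (suc ∘ (m +_)) [1⋯ size V ]
      candidates = trans (cong (map suc) ([1⋯]-++ m (size V))) (trans (List.map-++ suc [1⋯ m ] _)
        (cong₂ _++_ (trans (cong (map suc) ([1⋯suc] (size S))) (cong (2 ∷_) (sym (List.map-∘ [1⋯ size S ]))))
          (sym (List.map-∘ [1⋯ size V ]))))
      inner-part : count (apex? U) (map (suc ∘ suc) [1⋯ size S ]) ≡ tr S
      inner-part = trans
        (sym (count-cong (apex? S ∘ suc) (apex? U) (suc ∘ suc) [1⋯ size S ] (All.tabulate λ k∈ →
          let (1≤k , k≤) = ∈-[1⋯]⁻ k∈ in apex-inner _ 1≤k k≤)))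
        (count-cong (apex? S ∘ suc) (apex? S) suc [1⋯ size S ] (All.tabulate λ _ → id , id))
      outer-part : count (apex? U) (map (suc ∘ (m +_)) [1⋯ size V ]) ≡ tr V
      outer-part = trans
        (sym (count-cong (apex? V ∘ suc) (apex? U) (suc ∘ (m +_)) [1⋯ size V ] (All.tabulate λ {k} k∈ →
          let (1≤k , k≤) = ∈-[1⋯]⁻ k∈ in
          subst (λ i → (Apex V (suc k) → Apex U i) × (Apex U i → Apex V (suc k))) (+-suc m k) (apex-outer _ 1≤k k≤))))
        (count-cong (apex? V ∘ suc) (apex? V) suc [1⋯ size V ] (All.tabulate λ _ → id , id))

  tr-lam : ∀ {S} (s : IsTriangulation S) → tr (lam S) ≡ ear (size S) + tr S
  tr-lam {S} s = trans (cong tr (sym (⊕-identityʳ (lam-isObject s))))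
    (trans (tr-lam⊕ s e-isObject) (cong (ear (size S) +_) (+-identityʳ (tr S))))

  size-0 : ∀ {T} → IsTriangulation T → size T ≡ 0 → T ≡ E
  size-0 t refl = IsCatalan.∣t∣≡0 (FromPresentation.isCatalan presentation) t refl

  tr-≤ : ∀ T → tr T ≤ size T
  tr-≤ T = ≤-trans (List.length-filter (apex? T) (map suc [1⋯ size T ]))
    (≤-reflexive (trans (List.length-map suc [1⋯ size T ]) (length-[1⋯] (size T))))

  tr-lam-≢e : ∀ {S} → IsTriangulation S → S ≢ E → tr (lam S) ≡ tr S
  tr-lam-≢e {S} s S≢E = trans (tr-lam s) (cong (_+ tr S) (no-ear (size S) λ eq → S≢E (size-0 s eq)))
    where
    no-ear : ∀ n → n ≢ 0 → ear n ≡ 0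
    no-ear zero    n≢0 = contradiction refl n≢0
    no-ear (suc _) _   = refl

  laws : StatisticLaws presentation comp tr rcomp nontr
  laws = record
    { a-e      = refl
    ; a-lam⊕   = comp-lam⊕
    ; a′-lam-e = refl
    ; a′-lam   = λ s _ → rcomp-lam s
    ; a′-lam⊕  = λ s v V≢E → rcomp-lam⊕ s v (n≢0⇒n>0 (V≢E ∘ size-0 v))
    ; b-lam-e  = refl
    ; b-lam    = tr-lam-≢e
    ; b-lam⊕   = λ {S} {V} s v _ → trans (tr-lam⊕ s v)
                   (trans (sym (+-assoc (ear (size S)) (tr S) (tr V))) (cong (_+ tr V) (sym (tr-lam s))))
    ; b′-b     = λ {T} _ _ → trans (m∸n+n≡m (≤-trans (tr-≤ T) (m≤m+n (size T) 1))) (+-comm (size T) 1)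
    }

-- 231-avoiding permutations.

module Permutation231Proof where
  open Permutation
  open RawCatalan permutations231 using (IsObject; lam)

  NoDescentBelow : ℕ → ℕ → ℕ → Set
  NoDescentBelow a b c = ¬ (c < a × a < b)

  lam-isObject : ∀ {π} → IsObject π → IsObject (lam π)
  lam-isObject {π} (perm , av) = suc-∷-isPermutation perm ,
    triples⁻ {NoDescentBelow}
      (allPairs (λ b∈ _ (_ , n<b) → <⇒≱ n<b (≤-trans (proj₂ (↭[1⋯]-bounds perm b∈)) (n≤1+n _)))
      , triples⁺ {NoDescentBelow} av)

  ⊕-isObject : ∀ {π₁ π₂} → IsObject π₁ → IsObject π₂ → IsObject (directSum π₁ π₂)
  ⊕-isObject {π₁} {π₂} (perm₁ , av₁) (perm₂ , av₂) = directSum-isPermutation perm₁ perm₂ ,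
    triples⁻ {NoDescentBelow} (triples-++⁺ π₁ (map (length π₁ +_) π₂)
      (λ x∈ _ c∈ (c<x , _) → <-asym c<x (π₁≪π₂ x∈ c∈))
      (λ x∈ _ c∈ (c<x , _) → <-asym c<x (π₁≪π₂ x∈ c∈))
      (triples⁺ {NoDescentBelow} av₁)
      (triples-map⁺ (length π₁ +_)
        (λ av (c<a , a<b) → av (+-cancelˡ-< (length π₁) _ _ c<a , +-cancelˡ-< (length π₁) _ _ a<b))
        π₂ (triples⁺ {NoDescentBelow} av₂)))
    where
    π₁≪π₂ = ++-≪ perm₁ perm₂

  -- With `x` playing the 2 of the pattern, no smaller entry may follow once a larger one has
  -- appeared.
  pivot-split : ∀ x w → AllPairs (NoDescentBelow x) w → x ∉ w →
                ∃₂ λ s q → w ≡ s ++ q × All (_< x) s × All (x <_) q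
  pivot-split x []      _        x∉ = [] , [] , refl , [] , []
  pivot-split x (y ∷ w) (r ∷ rs) x∉ with <-cmp y x
  ... | tri< y<x _ _ =
          let (s , q , eq , s< , q>) = pivot-split x w rs (x∉ ∘ there)
          in y ∷ s , q , cong (y ∷_) eq , y<x ∷ s< , q>
  ... | tri≈ _ y≡x _ = contradiction (here (sym y≡x)) x∉
  ... | tri> _ _ x<y = [] , y ∷ w , refl , [] , x<y ∷ All.tabulate (λ c∈ →
          ≤∧≢⇒< (≮⇒≥ (λ c<x → lookup r c∈ (c<x , x<y))) (λ { refl → x∉ (there c∈) }))

  -- The first entry `x` is the maximum of the first component: by `pivot-split` the smaller entries
  -- follow it directly and all others exceed it. Hence `x` is `suc (length s)`.
  decompose : ∀ {π} → IsObject π → π ≡ [] ⊎ ∃₂ λ s v → IsObject s × IsObject v × π ≡ directSum (lam s) v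
  decompose {[]} _ = inj₁ refl
  decompose {x ∷ w} (perm , av) with triples⁺ {NoDescentBelow} av | ↭[1⋯]-unique perm
  ... | t , ts | x≢ ∷ _ with pivot-split x w t (λ x∈ → lookup x≢ x∈ refl)
  ...   | s , q , refl , s< , q> = inj₂ (s , v , (perm-s , triples⁻ avoid-s) , (perm-v , triples⁻ avoid-v) , eq)
    where
    n : ℕ
    n = length (x ∷ s ++ q)
    split : x ∷ s ↭ [1⋯ x ] × ∃[ v ] (q ≡ map (x +_) v × v ↭ [1⋯ n ∸ x ])
    split = permutation-split {x ∷ s} {q} {x} {n ∸ x}
      (subst (λ k → x ∷ s ++ q ↭ [1⋯ k ]) (sym (m+[n∸m]≡n (proj₂ (↭[1⋯]-bounds perm (here refl))))) perm)
      (≤-refl ∷ All.map <⇒≤ s<) q>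
    v : List ℕ
    v = proj₁ (proj₂ split)
    q≡ : q ≡ map (x +_) v
    q≡ = proj₁ (proj₂ (proj₂ split))
    perm-s : IsPermutation s
    perm-s = proj₁ (max-∷-isPermutation (proj₁ split) s<)
    x≡ : x ≡ suc (length s)
    x≡ = proj₂ (max-∷-isPermutation (proj₁ split) s<)
    perm-v : IsPermutation v
    perm-v = ↭[1⋯]⇒isPermutation (proj₂ (proj₂ (proj₂ split)))
    avoid : Triples NoDescentBelow s × Triples NoDescentBelow q
    avoid = triples-++⁻ s q ts
    avoid-s : Triples NoDescentBelow s
    avoid-s = proj₁ avoid
    avoid-v : Triples NoDescentBelow v
    avoid-v = triples-map⁻ (x +_) (λ r (c<a , a<b) → r (+-monoʳ-< x c<a , +-monoʳ-< x a<b)) v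
                (subst (Triples NoDescentBelow) q≡ (proj₂ avoid))
    eq : x ∷ s ++ q ≡ directSum (lam s) v
    eq = cong₂ _∷_ x≡ (cong (s ++_) (trans q≡ (cong (λ k → map (k +_) v) x≡)))

  presentation : Presentation permutations231
  presentation = record
    { e-isObject   = ↭-refl , λ ()
    ; lam-isObject = lam-isObject
    ; ⊕-isObject   = ⊕-isObject
    ; ∣e∣          = refl
    ; ∣lam∣        = λ _ → refl
    ; ∣⊕∣          = λ {π₁} {π₂} _ _ → length-directSum π₁ π₂
    ; ⊕-assoc      = λ {p} {q} {r} _ _ _ → directSum-assoc p q r
    ; ⊕-identityˡ  = λ {π} _ → List.map-id π
    ; ⊕-identityʳ  = λ {π} _ → List.++-identityʳ π
    ; decompose    = decompose
    ; cancel       = λ {s} {v} {s′} {v′} _ _ _ _ eq →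
        let ∣s∣≡ = suc-injective (List.∷-injectiveˡ eq)
            (s≡ , v≡) = ++-injective s s′ ∣s∣≡ (List.∷-injectiveʳ eq)
        in s≡ , map-+-injective (suc (length s))
                  (trans v≡ (cong (λ k → map (suc k +_) v′) (sym ∣s∣≡)))
    }

  lam-connected : ∀ {π} → IsPermutation π → Connected (lam π)
  lam-connected perm []      q        eq p≢[] q≢[] = contradiction refl p≢[]
  lam-connected perm (x ∷ p) []       eq p≢[] q≢[] = contradiction refl q≢[]
  lam-connected perm (x ∷ p) (y ∷ q)  eq p≢[] q≢[] =
    x , y , here refl , here refl ,
    subst (y <_) (List.∷-injectiveˡ eq)
      (s≤s (proj₂ (↭[1⋯]-bounds perm (subst (y ∈_) (sym (List.∷-injectiveʳ eq)) (∈-++⁺ʳ p (here refl))))))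

  rmax-lam : ∀ {π} → IsPermutation π → rmax (lam π) ≡ suc (rmax π)
  rmax-lam {π} perm = rmax-yes (suc (length π)) π (All.tabulate (s≤s ∘ proj₂ ∘ ↭[1⋯]-bounds perm))

  rmin-lam : ∀ {π} → IsPermutation π → π ≢ [] → rmin (lam π) ≡ rmin π
  rmin-lam {[]}    perm π≢[] = contradiction refl π≢[]
  rmin-lam {x ∷ π} perm π≢[] = rmin-no (suc (length (x ∷ π))) (x ∷ π)
    λ { (n<x ∷ _) → <⇒≱ n<x (≤-trans (proj₂ (↭[1⋯]-bounds perm (here refl))) (n≤1+n _)) }

  laws : StatisticLaws presentation comp rmin rmax nonrmin
  laws = record
    { a-e     = refl
    ; a-lam⊕  = λ {u} p q → comp-directSum (proj₁ (lam-isObject p)) (proj₁ q) (lam-connected (proj₁ p)) (s≤s z≤n)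
    ; a′-lam-e = refl
    ; a′-lam  = λ p _ → rmax-lam (proj₁ p)
    ; a′-lam⊕ = λ p q → rmax-directSum (proj₁ (lam-isObject p)) (proj₁ q)
    ; b-lam-e = refl
    ; b-lam   = rmin-lam ∘ proj₁
    ; b-lam⊕  = λ p q _ → rmin-directSum (proj₁ (lam-isObject p)) (proj₁ q)
    ; b′-b    = λ {t} _ _ → nonrmin+rmin t
    }

-- 321-avoiding permutations.

module Permutation321Proof where
  open Permutation
  open RawCatalan permutations321 using (IsObject)

  NoDescents : ℕ → ℕ → ℕ → Set
  NoDescents a b c = ¬ (c < b × b < a)

  Increasing : List ℕ → Set
  Increasing = AllPairs _<_

  -- Shuffles of two increasing words avoid 321. Conversely an avoiding permutation is such a
  -- shuffle of its right-to-left minima and the remaining entries.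
  data Shuffle : List ℕ → List ℕ → List ℕ → Set where
    []    : Shuffle [] [] []
    left  : ∀ {x A B w} → Shuffle A B w → Shuffle (x ∷ A) B (x ∷ w)
    right : ∀ {x A B w} → Shuffle A B w → Shuffle A (x ∷ B) (x ∷ w)

  shuffle-swap : ∀ {A B w} → Shuffle A B w → Shuffle B A w
  shuffle-swap []        = []
  shuffle-swap (left s)  = right (shuffle-swap s)
  shuffle-swap (right s) = left (shuffle-swap s)

  shuffle-∈ : ∀ {A B w x} → Shuffle A B w → x ∈ w → x ∈ A ⊎ x ∈ B
  shuffle-∈ (left s)  (here refl) = inj₁ (here refl)
  shuffle-∈ (left s)  (there x∈)  = [ inj₁ ∘ there , inj₂ ]′ (shuffle-∈ s x∈)
  shuffle-∈ (right s) (here refl) = inj₂ (here refl)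
  shuffle-∈ (right s) (there x∈)  = [ inj₁ , inj₂ ∘ there ]′ (shuffle-∈ s x∈)

  shuffle-pairs : ∀ {x A B w} → Shuffle A B w → All (x <_) A → Increasing B → AllPairs (NoDescents x) w
  shuffle-pairs []        _         _        = []
  shuffle-pairs (left s)  (x<y ∷ a) b        = All.tabulate (λ _ (_ , y<x) → <-asym y<x x<y) ∷ shuffle-pairs s a b
  shuffle-pairs (right s) a         (lt ∷ b) = All.tabulate (λ c∈ (c<y , y<x) →
      [ (λ c∈A → <-asym (lookup a c∈A) (<-trans c<y y<x)) , (λ c∈B → <-asym (lookup lt c∈B) c<y) ]′ (shuffle-∈ s c∈))
    ∷ shuffle-pairs s a b

  shuffle-avoids : ∀ {A B w} → Shuffle A B w → Increasing A → Increasing B → Triples NoDescents w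
  shuffle-avoids []        _        _        = tt
  shuffle-avoids (left s)  (lt ∷ a) b        = shuffle-pairs s lt b , shuffle-avoids s a b
  shuffle-avoids (right s) a        (lt ∷ b) = shuffle-pairs (shuffle-swap s) lt a , shuffle-avoids s a b

  Min : ℕ → List ℕ → Set
  Min x w = All (x <_) w

  -- B lists the right-to-left minima of w, and A the other entries.
  data Marked : List ℕ → List ℕ → List ℕ → Set where
    []  : Marked [] [] []
    min : ∀ {x w A B} → Min x w → Marked w A B → Marked (x ∷ w) A (x ∷ B)
    non : ∀ {x w A B} → ¬ Min x w → Marked w A B → Marked (x ∷ w) (x ∷ A) B

  mark : ∀ w → ∃₂ (Marked w)
  mark []      = [] , [] , []
  mark (x ∷ w) with mark w | all? (x <?_) w
  ... | A , B , m | yes x< = A , x ∷ B , min x< m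
  ... | A , B , m | no x≮  = x ∷ A , B , non x≮ m

  marked⇒shuffle : ∀ {w A B} → Marked w A B → Shuffle A B w
  marked⇒shuffle []        = []
  marked⇒shuffle (min _ m) = right (marked⇒shuffle m)
  marked⇒shuffle (non _ m) = left (marked⇒shuffle m)

  ¬min⇒smaller : ∀ {x w} → All (x ≢_) w → ¬ Min x w → ∃[ c ] (c ∈ w × c < x)
  ¬min⇒smaller {x} {w} x≢ x≮ with find (All.¬All⇒Any¬ (x <?_) w x≮)
  ... | c , c∈ , x≮c = c , c∈ , ≤∧≢⇒< (≮⇒≥ x≮c) (λ c≡x → lookup x≢ c∈ (sym c≡x))

  marked-minima : ∀ {w A B} → Marked w A B → Increasing B
  marked-minima []         = []
  marked-minima (non _ m)  = marked-minima m
  marked-minima (min {x} x< m) = All.tabulate (λ y∈ → lookup x< (minima-⊆ m y∈)) ∷ marked-minima m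
    where
    minima-⊆ : ∀ {w A B y} → Marked w A B → y ∈ B → y ∈ w
    minima-⊆ (min _ m) (here refl) = here refl
    minima-⊆ (min _ m) (there y∈)  = there (minima-⊆ m y∈)
    minima-⊆ (non _ m) y∈          = there (minima-⊆ m y∈)

  -- If a non-minimum `y` came after a larger entry `x`, then `x`, `y` and some smaller entry after
  -- `y` would form the pattern 321.
  marked-others : ∀ {w A B} → Marked w A B → Unique w → Triples NoDescents w → Increasing A
  marked-others []              _        _        = []
  marked-others (min _ m)       (_ ∷ u)  (_ , ts) = marked-others m u ts
  marked-others (non {x} _ m)   (x≢ ∷ u) (t , ts) = above m u x≢ t ∷ marked-others m u ts
    where
    above : ∀ {w A B} → Marked w A B → Unique w → All (x ≢_) w → AllPairs (NoDescents x) w → All (x <_) A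
    above []           _        _          _       = []
    above (min _ m)    (_ ∷ u)  (_ ∷ x≢)   (_ ∷ t) = above m u x≢ t
    above (non y≮ m)   (y≢ ∷ u) (x≢y ∷ x≢) (s ∷ t) =
      let (c , c∈ , c<y) = ¬min⇒smaller y≢ y≮
      in ≤∧≢⇒< (≮⇒≥ (λ y<x → lookup s c∈ (c<y , y<x))) x≢y ∷ above m u x≢ t

  -- Push m w c w′: adding a slot in front of w and moving every entry that is not
  -- a right-to-left minimum to the preceding free slot, with m entering at the end,
  -- yields c ∷ w′.  For w avoiding 321 this is lam.
  data Push (m : ℕ) : List ℕ → ℕ → List ℕ → Set where
    []  : Push m [] m []
    min : ∀ {x w c w′} → Min x w → Push m w c w′ → Push m (x ∷ w) c (x ∷ w′)
    non : ∀ {x w c w′} → ¬ Min x w → Push m w c w′ → Push m (x ∷ w) x (c ∷ w′)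

  push : ∀ m w → ∃₂ (Push m w)
  push m []      = m , [] , []
  push m (x ∷ w) with push m w | all? (x <?_) w
  ... | c , w′ , p | yes x< = c , x ∷ w′ , min x< p
  ... | c , w′ , p | no x≮  = x , c ∷ w′ , non x≮ p

  push-↭ : ∀ {m w c w′} → Push m w c w′ → c ∷ w′ ↭ m ∷ w
  push-↭ []               = ↭-refl
  push-↭ (min {x} {c = c} _ p) = ↭-trans (swap c x ↭-refl) (↭-trans (prep x (push-↭ p)) (swap x _ ↭-refl))
  push-↭ (non {x} _ p)    = ↭-trans (prep x (push-↭ p)) (swap x _ ↭-refl)

  -- The minima keep their order, and the remaining slots are filled in order by `A ++ m ∷ []`. This
  -- is the cyclic shift that `lam321` performs on boxed values.
  push-shuffle : ∀ {m w c w′ A B} → Push m w c w′ → Marked w A B →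
                 ∃[ A′ ] (A ++ m ∷ [] ≡ c ∷ A′ × Shuffle A′ B w′)
  push-shuffle []        []         = [] , refl , []
  push-shuffle (min _ p) (min _ mk) = let (A′ , eq , s) = push-shuffle p mk in A′ , eq , right s
  push-shuffle (min x p) (non x≮ _) = contradiction x x≮
  push-shuffle (non x≮ p) (min x _) = contradiction x x≮
  push-shuffle (non {x} _ p) (non _ mk) =
    let (A′ , eq , s) = push-shuffle p mk in _ , cong (x ∷_) eq , left s

  -- Agreement of `lam321` with `Push`.

  -- Keeping the part already read in `l` lets the boxing conditions be followed by recursion on the
  -- rest of the word.
  splitsFrom : List ℕ → List ℕ → List (List ℕ × ℕ × List ℕ)
  splitsFrom l []      = []
  splitsFrom l (x ∷ w) = (l , x , w) ∷ splitsFrom (l ++ x ∷ []) w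

  splits-prefix : ∀ l w → map (λ (l′ , y , r) → (l ++ l′ , y , r)) (splits w) ≡ splitsFrom l w
  splits-prefix l []      = refl
  splits-prefix l (x ∷ w) = cong₂ _∷_ (cong (_, x , w) (List.++-identityʳ l))
    (trans (sym (List.map-∘ (splits w)))
    (trans (List.map-cong (λ (l′ , y , r) → cong (_, y , r) (sym (List.++-assoc l (x ∷ []) l′))) (splits w))
           (splits-prefix (l ++ x ∷ []) w)))

  Boxes : List ℕ × ℕ × List ℕ → Set
  Boxes s = 1 ∈ proj₁ s × LRMax s × ¬ RLMin s

  boxes? : ∀ s → Dec (Boxes s)
  boxes? s@(l , x , r) = (1 ∈? l) ×-dec lrMax? s ×-dec ¬? (rlMin? s)

  boxFrom : List ℕ → List ℕ → Boxed
  boxFrom l w = map (λ s → does (boxes? s) , proj₁ (proj₂ s)) (splitsFrom l w)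

  box≡ : ∀ w → box w ≡ boxFrom [] w
  box≡ w = cong (map (λ s → does (boxes? s) , proj₁ (proj₂ s))) (trans (sym (List.map-id (splits w))) (splits-prefix [] w))

  private
    boxed-yes : ∀ {l x r} → Boxes (l , x , r) → does (boxes? (l , x , r)) ≡ true
    boxed-yes {l} {x} {r} b = dec-true (boxes? (l , x , r)) b

    boxed-no : ∀ {l x r} → ¬ Boxes (l , x , r) → does (boxes? (l , x , r)) ≡ false
    boxed-no {l} {x} {r} b = dec-false (boxes? (l , x , r)) b

  -- What an earlier part l of a 321-avoiding permutation says about the rest w.
  Earlier : List ℕ → List ℕ → Set
  Earlier l w = All (λ a → AllPairs (NoDescents a) w × a ∉ w) l

  earlier-∷ : ∀ {l x w} → Earlier l (x ∷ w) → Unique (x ∷ w) → Triples NoDescents (x ∷ w) → Earlier (l ++ x ∷ []) w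
  earlier-∷ e (x≢ ∷ _) (t , _) = All.++⁺ (All.map (λ (p , n) → AllPairs.tail p , n ∘ there) e)
    ((t , (λ x∈ → lookup x≢ x∈ refl)) ∷ [])

  -- A larger entry before `x` and a smaller one after it would give 321. So after 1 the boxed
  -- entries are exactly those that are not right-to-left minima.
  others-are-maxima : ∀ {l x w} → Earlier l (x ∷ w) → All (x ≢_) w → ¬ Min x w → All (_< x) l
  others-are-maxima e x≢ x≮ =
    let (c , c∈ , c<x) = ¬min⇒smaller x≢ x≮
    in All.map (λ { (s ∷ _ , n) → ≤∧≢⇒< (≮⇒≥ (λ x<a → lookup s c∈ (c<x , x<a))) (n ∘ here) }) e

  -- Past the entry 1, boxing and `Push` select the same entries. The list `vs` is what remains of
  -- the rotated values once `c` has filled the preceding boxed slot.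
  boxes-after-1 : ∀ {m w c w′ A B} l → 1 ∈ l → Earlier l w → Unique w → Triples NoDescents w →
                  Marked w A B → Push m w c w′ →
                  boxedValues (boxFrom l w) ≡ A × (∀ vs → A ++ m ∷ [] ≡ c ∷ vs → refill (boxFrom l w) vs ≡ w′)
  boxes-after-1 l 1∈ e u t [] [] = refl , λ _ _ → refl
  boxes-after-1 l 1∈ e u t (min x< _) (non x≮ _) = contradiction x< x≮
  boxes-after-1 l 1∈ e u t (non x≮ _) (min x< _) = contradiction x< x≮
  boxes-after-1 {w = x ∷ w} l 1∈ e u@(_ ∷ u′) t@(_ , t′) (min x< mk) (min _ p)
    rewrite boxed-no {l} {x} {w} (λ (_ , _ , x≮) → x≮ x<)
    = let (bv , rf) = boxes-after-1 (l ++ x ∷ []) (∈-++⁺ˡ 1∈) (earlier-∷ e u t) u′ t′ mk p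
      in bv , λ vs eq → cong (x ∷_) (rf vs eq)
  boxes-after-1 {w = x ∷ w} l 1∈ e u@(x≢ ∷ u′) t@(_ , t′) (non x≮ mk) (non _ p)
    rewrite boxed-yes {l} {x} {w} (1∈ , others-are-maxima e x≢ x≮ , x≮)
    = let (bv , rf) = boxes-after-1 (l ++ x ∷ []) (∈-++⁺ˡ 1∈) (earlier-∷ e u t) u′ t′ mk p
          (A′ , A≡ , _) = push-shuffle p mk
      in cong (x ∷_) bv
       , λ vs eq → trans (cong (λ vs → refill ((true , x) ∷ boxFrom (l ++ x ∷ []) w) vs)
                            (sym (trans (sym A≡) (List.∷-injectiveʳ eq))))
                     (cong (_ ∷_) (rf A′ A≡))

  -- Entries before 1 are not right-to-left minima, so `Push`, with its additional slot in front,
  -- leaves them at their old positions. The first displaced slot is the one directly before 1,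
  -- where `insertBoxed` puts the boxed `m`.
  boxes-up-to-1 : ∀ {m w c w′ A B} l → 1 ∉ l → 1 ∈ w → All (1 ≤_) w → Earlier l w → Unique w → Triples NoDescents w →
                  Marked w A B → Push m w c w′ →
                  ∃[ A₂ ] (boxedValues (insertBoxed m (boxFrom l w)) ≡ m ∷ A₂
                           × refill (insertBoxed m (boxFrom l w)) (A₂ ++ m ∷ []) ≡ c ∷ w′)
  boxes-up-to-1 {m} {x ∷ w} l 1∉ 1∈ (1≤x ∷ 1≤w) e u@(x≢ ∷ u′) t@(_ , t′) mk p
    rewrite boxed-no {l} {x} {w} (λ (1∈l , _) → 1∉ 1∈l) = go (x ≟ 1) 1∈ mk p
    where
    go : ∀ {c w′ A B} → Dec (x ≡ 1) → 1 ∈ x ∷ w → Marked (x ∷ w) A B → Push m (x ∷ w) c w′ →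
         ∃[ A₂ ] (boxedValues (insertBoxed m ((false , x) ∷ boxFrom (l ++ x ∷ []) w)) ≡ m ∷ A₂
           × refill (insertBoxed m ((false , x) ∷ boxFrom (l ++ x ∷ []) w)) (A₂ ++ m ∷ []) ≡ c ∷ w′)
    go (yes refl) _ (non 1≮ _) _ = contradiction (All.zipWith (λ (1≤ , 1≢) → ≤∧≢⇒< 1≤ 1≢) (1≤w , x≢)) 1≮
    go (yes refl) _ (min x< _) (non x≮ _) = contradiction x< x≮
    go (yes refl) _ (min {A = A} _ mk) (min {c = c} _ p) =
      let (bv , rf) = boxes-after-1 (l ++ 1 ∷ []) (∈-++⁺ʳ l (here refl)) (earlier-∷ e u t) u′ t′ mk p
          (A′ , A≡ , _) = push-shuffle p mk
      in A , cong (m ∷_) bv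
         , trans (cong (refill ((true , m) ∷ (false , 1) ∷ boxFrom (l ++ 1 ∷ []) w)) A≡)
                 (cong (λ r → c ∷ 1 ∷ r) (rf A′ A≡))
    go (no x≢1) (here eq)  _ _ = contradiction (sym eq) x≢1
    go (no x≢1) (there 1∈w) (min x< _) _ = contradiction (lookup x< 1∈w) (≤⇒≯ 1≤x)
    go (no x≢1) (there 1∈w) _ (min x< _) = contradiction (lookup x< 1∈w) (≤⇒≯ 1≤x)
    go (no x≢1) (there 1∈w) (non _ mk) (non _ p) rewrite dec-false (x ≟ 1) x≢1 =
      let (A₂ , bv , rf) = boxes-up-to-1 (l ++ x ∷ [])
            (λ 1∈ → [ 1∉ , (λ { (here eq) → x≢1 (sym eq) }) ]′ (∈-++⁻ l 1∈)) 1∈w 1≤w (earlier-∷ e u t) u′ t′ mk p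
      in A₂ , bv , cong (x ∷_) rf

  lam-push : ∀ {w c w′} → IsPermutation w → Triples NoDescents w → Push (suc (length w)) w c w′ → lam321 w ≡ c ∷ w′
  lam-push {[]}        perm t []  = refl
  lam-push {w@(_ ∷ _)} perm t p =
    let (A , B , mk) = mark w
        (A₂ , bv , rf) = boxes-up-to-1 [] (λ ()) (∈-resp-↭ (↭-sym perm) (∈-[1⋯]⁺ ≤-refl (s≤s z≤n)))
          (All.tabulate (proj₁ ∘ ↭[1⋯]-bounds perm)) [] (↭[1⋯]-unique perm) t mk p
    in trans (cong (λ b → cycleBoxed (insertBoxed (suc (length w)) b)) (box≡ w))
      (trans (cong (λ vs → refill (insertBoxed (suc (length w)) (boxFrom [] w)) (rotate vs)) bv) rf)

  record LamView (w : List ℕ) : Set where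
    field
      {c}       : ℕ
      {w′ A B}  : List ℕ
      lam≡      : lam321 w ≡ c ∷ w′
      pushed    : Push (suc (length w)) w c w′
      marked    : Marked w A B
      increasingA : Increasing (A ++ suc (length w) ∷ [])
      increasingB : Increasing B
      below     : All (_< suc (length w)) w
      unique    : Unique w
      perm      : IsPermutation w

  marked-⊆ : ∀ {w A B y} → Marked w A B → y ∈ A → y ∈ w
  marked-⊆ (min _ m) y∈          = there (marked-⊆ m y∈)
  marked-⊆ (non _ m) (here refl) = here refl
  marked-⊆ (non _ m) (there y∈)  = there (marked-⊆ m y∈)

  lamView : ∀ {w} → IsObject w → LamView w
  lamView {w} (perm , av) =
    let (c , w′ , p) = push (suc (length w)) w
        (A , B , mk) = mark w
        t = triples⁺ {NoDescents} av
        u = ↭[1⋯]-unique perm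
        below = All.tabulate (s≤s ∘ proj₂ ∘ ↭[1⋯]-bounds perm)
    in record
      { lam≡ = lam-push perm t p ; pushed = p ; marked = mk
      ; increasingA = AllPairs.++⁺ (marked-others mk u t) ([] ∷ [])
          (All.tabulate (λ y∈ → lookup below (marked-⊆ mk y∈) ∷ []))
      ; increasingB = marked-minima mk ; below = below ; unique = u ; perm = perm }

  lam-↭ : ∀ {w} → IsObject w → lam321 w ↭ suc (length w) ∷ w
  lam-↭ o = ↭-trans (↭-reflexive (LamView.lam≡ v)) (push-↭ (LamView.pushed v))
    where v = lamView o

  lam-length : ∀ {w} → IsObject w → length (lam321 w) ≡ suc (length w)
  lam-length o = ↭-length (lam-↭ o)

  lam-isPermutation : ∀ {w} → IsObject w → IsPermutation (lam321 w)
  lam-isPermutation o = ↭[1⋯]⇒isPermutation (↭-trans (lam-↭ o) (suc-∷-isPermutation (proj₁ o)))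

  lam-isObject : ∀ {w} → IsObject w → IsObject (lam321 w)
  lam-isObject {w} o = lam-isPermutation o , triples⁻ {NoDescents} (subst (Triples NoDescents) (sym V.lam≡)
    (let (A′ , A≡ , s) = push-shuffle V.pushed V.marked
     in shuffle-avoids (left s) (subst Increasing A≡ V.increasingA) V.increasingB))
    where module V = LamView (lamView o)

  ⊕-isObject : ∀ {π₁ π₂} → IsObject π₁ → IsObject π₂ → IsObject (directSum π₁ π₂)
  ⊕-isObject {π₁} {π₂} (perm₁ , av₁) (perm₂ , av₂) = directSum-isPermutation perm₁ perm₂ ,
    triples⁻ {NoDescents} (triples-++⁺ π₁ (map (length π₁ +_) π₂)
      (λ _ b∈ c∈ (c<b , _) → <-asym c<b (π₁≪π₂ b∈ c∈))
      (λ x∈ b∈ _ (_ , b<x) → <-asym b<x (π₁≪π₂ x∈ b∈))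
      (triples⁺ {NoDescents} av₁)
      (triples-map⁺ (length π₁ +_)
        (λ av (c<b , b<a) → av (+-cancelˡ-< (length π₁) _ _ c<b , +-cancelˡ-< (length π₁) _ _ b<a))
        π₂ (triples⁺ {NoDescents} av₂)))
    where
    π₁≪π₂ = ++-≪ perm₁ perm₂

  below-carry : ∀ {m x w c w′} → Min x w → x < m → Push m w c w′ → x < c
  below-carry x< x<m p = lookup (All-resp-↭ (↭-sym (push-↭ p)) (x<m ∷ x<)) (here refl)

  above-carry : ∀ {m x w c w′ A B} → Push m w c w′ → Marked w A B → All (x <_) (A ++ m ∷ []) → x < c
  above-carry p k lt with push-shuffle p k
  ... | _ , A≡ , _ = All.head (subst (All _) A≡ lt)

  -- At a cut just before a minimum, the carried entry exceeds that minimum. At a cut just before a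
  -- refilled slot, the entry moved forward is not a right-to-left minimum and so exceeds something
  -- further on.
  push-connected : ∀ {m w c w′} → Push m w c w′ → Unique w → All (_< m) w → Connected (c ∷ w′)
  push-connected p u w<m [] q eq p≢[] q≢[] = contradiction refl p≢[]
  push-connected p u w<m (a ∷ p₁) q eq p≢[] q≢[] with List.∷-injective eq
  ... | refl , w′≡ = go p u w<m p₁ q w′≡ q≢[]
    where
    lift : ∀ {c x p q} → (∃₂ λ a b → a ∈ c ∷ p × b ∈ q × b < a) → ∃₂ λ a b → a ∈ c ∷ x ∷ p × b ∈ q × b < a
    lift (a , b , here eq   , b∈ , b<a) = a , b , here eq , b∈ , b<a
    lift (a , b , there a∈  , b∈ , b<a) = a , b , there (there a∈) , b∈ , b<a
    lift′ : ∀ {x p q} → (∃₂ λ a b → a ∈ p × b ∈ q × b < a) → ∃₂ λ a b → a ∈ x ∷ p × b ∈ q × b < a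
    lift′ (a , b , a∈ , b∈ , b<a) = a , b , there a∈ , b∈ , b<a
    go : ∀ {m w c w′} → Push m w c w′ → Unique w → All (_< m) w → ∀ p q → w′ ≡ p ++ q → q ≢ [] →
         ∃₂ λ a b → a ∈ c ∷ p × b ∈ q × b < a
    go [] u w<m [] [] eq q≢[] = contradiction refl q≢[]
    go (min x< p) u w<m [] [] eq q≢[] = contradiction refl q≢[]
    go (min {x} x< p) u (x<m ∷ w<m) [] (y ∷ q) eq q≢[] =
      _ , x , here refl , here (List.∷-injectiveˡ eq) , below-carry x< x<m p
    go (min x< p) (_ ∷ u) (_ ∷ w<m) (y ∷ p₁) q eq q≢[] = lift (go p u w<m p₁ q (List.∷-injectiveʳ eq) q≢[])
    go (non {x} x≮ p) (x≢ ∷ u) w<m [] q eq q≢[] =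
      let (b , b∈ , b<x) = ¬min⇒smaller x≢ x≮
      in x , b , here refl , subst (b ∈_) eq (∈-resp-↭ (↭-sym (push-↭ p)) (there b∈)) , b<x
    go (non x≮ p) (_ ∷ u) (_ ∷ w<m) (y ∷ p₁) q eq q≢[] with List.∷-injective eq
    ... | refl , eq′ = lift′ (go p u w<m p₁ q eq′ q≢[])

  lam-connected : ∀ {w} → IsObject w → Connected (lam321 w)
  lam-connected o = subst Connected (sym V.lam≡) (push-connected V.pushed V.unique V.below)
    where module V = LamView (lamView o)

  -- The first two entries of the output tell the last constructor apart: they form a descent for
  -- `min`, by `below-carry`, and an ascent for `non`, by `above-carry`.
  push-injective : ∀ {m w v c u A B A′ B′} → Push m w c u → Push m v c u → Marked w A B → Marked v A′ B′ →
                   Increasing (A ++ m ∷ []) → Increasing (A′ ++ m ∷ []) → All (_< m) w → All (_< m) v → w ≡ v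
  push-injective []         []         _          _          _        _        _         _         = refl
  push-injective (min _ p)  (min _ p′) (min _ k)  (min _ k′) a        a′       (_ ∷ l)   (_ ∷ l′)  =
    cong (_ ∷_) (push-injective p p′ k k′ a a′ l l′)
  push-injective (non _ p)  (non _ p′) (non _ k)  (non _ k′) (_ ∷ a)  (_ ∷ a′) (_ ∷ l)   (_ ∷ l′)  =
    cong (_ ∷_) (push-injective p p′ k k′ a a′ l l′)
  push-injective (min x< p) (non _ p′) _ (non _ k′) _ (lt ∷ _) (x<m ∷ _) _ =
    contradiction (below-carry x< x<m p) (<⇒≯ (above-carry p′ k′ lt))
  push-injective (non _ p) (min x< p′) (non _ k) _ (lt ∷ _) _ _ (x<m ∷ _) =
    contradiction (below-carry x< x<m p′) (<⇒≯ (above-carry p k lt))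
  push-injective (min x< _) _ (non x≮ _) _ _ _ _ _ = contradiction x< x≮
  push-injective (non x≮ _) _ (min x< _) _ _ _ _ _ = contradiction x< x≮
  push-injective _ (min x< _) _ (non x≮ _) _ _ _ _ = contradiction x< x≮
  push-injective _ (non x≮ _) _ (min x< _) _ _ _ _ = contradiction x< x≮

  lam-injective : ∀ {w v} → IsObject w → IsObject v → lam321 w ≡ lam321 v → w ≡ v
  lam-injective {w} {v} o o′ eq = push-injective V.pushed pushed′ V.marked V′.marked V.increasingA
    (subst (λ n → Increasing (V′.A ++ suc n ∷ [])) (sym ∣w∣≡) V′.increasingA)
    V.below (subst (λ n → All (_< suc n) v) (sym ∣w∣≡) V′.below)
    where
    module V = LamView (lamView o)
    module V′ = LamView (lamView o′)
    ∣w∣≡ : length w ≡ length v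
    ∣w∣≡ = suc-injective (trans (sym (lam-length o)) (trans (cong length eq) (lam-length o′)))
    lam≡ : V.c ∷ V.w′ ≡ V′.c ∷ V′.w′
    lam≡ = trans (sym V.lam≡) (trans eq V′.lam≡)
    pushed′ : Push (suc (length w)) v V.c V.w′
    pushed′ = subst (λ n → Push (suc n) v V.c V.w′) (sym ∣w∣≡)
      (subst₂ (Push (suc (length v)) v) (sym (List.∷-injectiveˡ lam≡)) (sym (List.∷-injectiveʳ lam≡)) V′.pushed)

  cancel : ∀ {s v s′ v′} → IsObject s → IsObject v → IsObject s′ → IsObject v′ →
           directSum (lam321 s) v ≡ directSum (lam321 s′) v′ → s ≡ s′ × v ≡ v′
  cancel {s} {v} {s′} {v′} ps pv ps′ pv′ eq =
    let ∣lam∣≡ = connected-length (lam-isPermutation ps) (proj₁ pv) (lam-isPermutation ps′) (proj₁ pv′)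
                   (lam-connected ps) (lam-connected ps′) (lam-≢[] ps) (lam-≢[] ps′) eq
        (lam≡ , v≡) = ++-injective (lam321 s) (lam321 s′) ∣lam∣≡ eq
    in lam-injective ps ps′ lam≡
     , map-+-injective (length (lam321 s)) (trans v≡ (cong (λ k → map (k +_) v′) (sym ∣lam∣≡)))
    where
    lam-≢[] : ∀ {s} → IsObject s → lam321 s ≢ []
    lam-≢[] o eq = 1+n≢0 (trans (sym (lam-length o)) (cong length eq))

  -- The inverse of Push is a pass of bubble sort, with c as the entry being carried.
  unpush : ∀ {A B u c} → Shuffle A B u → Increasing (c ∷ A) → Increasing B → Unique (c ∷ u) → Connected (c ∷ u) →
           ∃₂ λ m s → ∃[ A′ ] (Push m s c u × Shuffle A′ B s × A′ ++ m ∷ [] ≡ c ∷ A × All (_< m) s)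
  unpush {c = c} [] _ _ _ _ = c , [] , [] , [] , [] , refl , []
  unpush {c = c} (left {x} {A} {B} {w} sh) ((c<x ∷ c<A) ∷ a) b ((_ ∷ _) ∷ u) conn =
    let (m , s , A′ , p , sh′ , A≡ , s<m) = unpush sh a b u conn′
        c<m = lookup (c<x ∷ c<A) (subst (m ∈_) A≡ (∈-++⁺ʳ A′ (here refl)))
        -- The first cut supplies an entry below `c`. It is not `m`, which exceeds `c`, so it lies
        -- in `s`, and `c` is no right-to-left minimum there.
        (_ , y , c≡ , y∈ , y<) = conn (c ∷ []) (x ∷ w) refl (λ ()) (λ ())
        y<c = subst (y <_) (singleton c≡) y<
        c≮ = λ c<s → <-asym y<c (lookup (c<m ∷ c<s) (∈-resp-↭ (push-↭ p) y∈))
    in m , c ∷ s , c ∷ A′ , non c≮ p , left sh′ , cong (c ∷_) A≡ , c<m ∷ s<m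
    where
    singleton : ∀ {a} → a ∈ c ∷ [] → a ≡ c
    singleton (here eq) = eq
    conn′ : Connected (x ∷ w)
    conn′ []      q eq p≢[] q≢[] = contradiction refl p≢[]
    conn′ (z ∷ p) q eq p≢[] q≢[] with conn (c ∷ z ∷ p) q (cong (c ∷_) eq) (λ ()) q≢[]
    ... | a , b , there a∈  , b∈ , b<a = a , b , a∈ , b∈ , b<a
    ... | a , b , here refl , b∈ , b<c = x , b , here (List.∷-injectiveˡ eq) , b∈ , <-trans b<c c<x
  unpush {c = c} (right {x} {A} {B} {w} sh) (c<A ∷ a) (x<B ∷ b) ((_ ∷ c≢) ∷ _ ∷ u) conn =
    let (m , s , A′ , p , sh′ , A≡ , s<m) = unpush sh (c<A ∷ a) b (c≢ ∷ u) conn′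
        c≤ = All.++⁻ A′ (subst (All (c ≤_)) (sym A≡) (≤-refl ∷ All.map <⇒≤ c<A))
        x<m = <-≤-trans x<c (All.head (proj₂ c≤))
        x<s = All.tabulate λ y∈ → [ (λ y∈A → <-≤-trans x<c (lookup (proj₁ c≤) y∈A)) , lookup x<B ]′ (shuffle-∈ sh′ y∈)
    in m , x ∷ s , A′ , min x<s p , right sh′ , A≡ , x<m ∷ s<m
    where
    x<c : x < c
    x<c with conn (c ∷ []) (x ∷ w) refl (λ ()) (λ ())
    ... | _ , y , here refl , here refl , y<c = y<c
    ... | _ , y , here refl , there y∈  , y<c =
          [ (λ y∈A → contradiction y<c (<⇒≯ (lookup c<A y∈A))) , (λ y∈B → <-trans (lookup x<B y∈B) y<c) ]′ (shuffle-∈ sh y∈)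
    conn′ : Connected (c ∷ w)
    conn′ []      q eq p≢[] q≢[] = contradiction refl p≢[]
    conn′ (z ∷ p) q eq p≢[] q≢[] with List.∷-injective eq
    ... | refl , w≡ with conn (c ∷ x ∷ p) q (cong (λ l → c ∷ x ∷ l) w≡) (λ ()) q≢[]
    ...   | a , b , here refl         , b∈ , b<a = a , b , here refl , b∈ , b<a
    ...   | a , b , there (here refl) , b∈ , b<x = c , b , here refl , b∈ , <-trans b<x x<c
    ...   | a , b , there (there a∈)  , b∈ , b<a = a , b , there a∈ , b∈ , b<a

  -- In a connected word with at least two entries the first is not a right-to-left minimum, so it
  -- can be the entry carried at the start of `unpush`. The entry carried out at the end exceeds all
  -- of `s`, hence is `suc (length s)`.
  connected⇒lam : ∀ {w} → IsObject w → w ≢ [] → Connected w → ∃[ s ] (IsObject s × w ≡ lam321 s)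
  connected⇒lam {[]} o w≢[] conn = contradiction refl w≢[]
  connected⇒lam {c ∷ []} (perm , _) w≢[] conn with ↭[1⋯]-bounds perm (here refl)
  ... | s≤s z≤n , s≤s z≤n = [] , (↭-refl , λ ()) , refl
  connected⇒lam {c ∷ u@(_ ∷ _)} (perm , av) w≢[] conn with mark (c ∷ u)
  ... | A , _ , min c< _ = let (_ , y , c≡ , y∈ , y<) = conn (c ∷ []) u refl (λ ()) (λ ())
                           in contradiction (lookup c< y∈) (<⇒≯ (subst (y <_) (singleton c≡) y<))
    where
    singleton : ∀ {a} → a ∈ c ∷ [] → a ≡ c
    singleton (here eq) = eq
  ... | c ∷ A , B , mk@(non _ mk′) =
    let unique = ↭[1⋯]-unique perm
        increasing = marked-others mk unique (triples⁺ {NoDescents} av)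
        (m , s , A′ , p , sh , A≡ , s<m) = unpush (marked⇒shuffle mk′) increasing (marked-minima mk) unique conn
        (perm-s , m≡) = max-∷-isPermutation (↭-trans (↭-sym (push-↭ p)) perm) s<m
        t = shuffle-avoids sh (increasing-++ˡ A′ (subst Increasing (sym A≡) increasing)) (marked-minima mk)
    in s , (perm-s , triples⁻ {NoDescents} t) , sym (lam-push perm-s t (subst (λ k → Push k s c u) m≡ p))
    where
    increasing-++ˡ : ∀ p {q} → Increasing (p ++ q) → Increasing p
    increasing-++ˡ []      _        = []
    increasing-++ˡ (x ∷ p) (l ∷ ls) = All.++⁻ˡ p l ∷ increasing-++ˡ p ls

  decompose : ∀ {w} → IsObject w → w ≡ [] ⊎ ∃₂ λ s v → IsObject s × IsObject v × w ≡ directSum (lam321 s) v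
  decompose {[]}    _ = inj₁ refl
  decompose {w@(_ ∷ _)} (perm , av) =
    let (p , v , perm-p , perm-v , p≢[] , conn , w≡) = first-component perm (λ ())
        (tp , tv) = triples-++⁻ p (map (length p +_) v) (subst (Triples NoDescents) w≡ (triples⁺ {NoDescents} av))
        tv′ = triples-map⁻ (length p +_) (λ r (c<b , b<a) → r (+-monoʳ-< (length p) c<b , +-monoʳ-< (length p) b<a)) v tv
        (s , os , p≡) = connected⇒lam (perm-p , triples⁻ {NoDescents} tp) p≢[] conn
    in inj₂ (s , v , os , (perm-v , triples⁻ {NoDescents} tv′) , trans w≡ (cong (λ p → directSum p v) p≡))

  presentation : Presentation permutations321
  presentation = record
    { e-isObject   = ↭-refl , λ ()
    ; lam-isObject = lam-isObject
    ; ⊕-isObject   = ⊕-isObject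
    ; ∣e∣          = refl
    ; ∣lam∣        = lam-length
    ; ∣⊕∣          = λ {π₁} {π₂} _ _ → length-directSum π₁ π₂
    ; ⊕-assoc      = λ {p} {q} {r} _ _ _ → directSum-assoc p q r
    ; ⊕-identityˡ  = λ {π} _ → List.map-id π
    ; ⊕-identityʳ  = λ {π} _ → List.++-identityʳ π
    ; decompose    = decompose
    ; cancel       = cancel
    }

  push-length : ∀ {m w c w′} → Push m w c w′ → length w′ ≡ length w
  push-length p = suc-injective (↭-length (push-↭ p))

  same-length-≢[] : ∀ {w w′ : List ℕ} → length w′ ≡ length w → w ≢ [] → w′ ≢ []
  same-length-≢[] {[]}    _  w≢[] _    = w≢[] refl
  same-length-≢[] {_ ∷ _} () w≢[] refl

  -- The last entry of a word is always a right-to-left minimum, and those are not moved.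
  push-last : ∀ {m w c w′} → Push m w c w′ → w ≢ [] → lastEntry (c ∷ w′) ≡ lastEntry w
  push-last [] w≢[] = contradiction refl w≢[]
  push-last (min {w = []} _ []) _ = refl
  push-last (min {x} {w@(y ∷ _)} {c} {w′} _ p) _ = begin
    lastEntry (x ∷ w′)   ≡⟨ lastEntry-∷ x w′≢[] ⟩
    lastEntry w′         ≡⟨ sym (lastEntry-∷ c w′≢[]) ⟩
    lastEntry (c ∷ w′)   ≡⟨ push-last p (λ ()) ⟩
    lastEntry w          ∎
    where
    open ≡-Reasoning
    w′≢[] : w′ ≢ []
    w′≢[] = same-length-≢[] {w} (push-length p) (λ ())
  push-last (non {w = []} x≮ p) _ = contradiction [] x≮
  push-last (non {w = _ ∷ _} _ p) _ = push-last p (λ ())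

  -- Right-to-left minima stay such, and no refilled slot becomes one. The second component records
  -- this for the carried entry, as the induction requires.
  push-rmin : ∀ {m w c w′} → Push m w c w′ → All (_< m) w → w ≢ [] →
              rmin (c ∷ w′) ≡ rmin w × ¬ Min c w′
  push-rmin [] _ w≢[] = contradiction refl w≢[]
  push-rmin {m} (min {x} {[]} _ []) (x<m ∷ _) _ = rmin-no m (x ∷ []) m≮ , m≮
    where
    m≮ : ¬ Min m (x ∷ [])
    m≮ (m<x ∷ _) = <-asym m<x x<m
  push-rmin (min {x} {w@(_ ∷ _)} {c} {w′} x< p) (x<m ∷ w<m) _ =
    let (ih , c≮w′) = push-rmin p w<m (λ ())
        x<cw′ = All-resp-↭ (↭-sym (push-↭ p)) (x<m ∷ x<)
        c≮ = λ { (c<x ∷ _) → <-asym c<x (All.head x<cw′) }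
    in trans (rmin-no c (x ∷ w′) c≮)
       (trans (rmin-yes x w′ (All.tail x<cw′))
       (trans (cong suc (trans (sym (rmin-no c w′ c≮w′)) ih)) (sym (rmin-yes x w x<)))) , c≮
  push-rmin (non {w = []} x≮ p) _ _ = contradiction [] x≮
  push-rmin (non {x} {w@(_ ∷ _)} {c} {w′} x≮ p) (_ ∷ w<m) _ =
    let x≮cw′ = λ x< → x≮ (All.tail (All-resp-↭ (push-↭ p) x<))
    in trans (rmin-no x (c ∷ w′) x≮cw′) (trans (proj₁ (push-rmin p w<m (λ ()))) (sym (rmin-no x w x≮))) , x≮cw′

  rmin-lam : ∀ {w} → IsObject w → w ≢ [] → rmin (lam321 w) ≡ rmin w
  rmin-lam o w≢[] = trans (cong rmin V.lam≡) (proj₁ (push-rmin V.pushed V.below w≢[]))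
    where module V = LamView (lamView o)

  lastEntry-≤length : ∀ {w} → IsPermutation w → w ≢ [] → lastEntry w ≤ length w
  lastEntry-≤length perm w≢[] = proj₂ (↭[1⋯]-bounds perm (lastEntry-∈ w≢[]))

  rcomp-lam : ∀ {w} → IsObject w → w ≢ [] → rcomp (lam321 w) ≡ suc (rcomp w)
  rcomp-lam {w} o w≢[] = cong (_+ 1) (trans
    (cong₂ _∸_ (lam-length o) (trans (cong lastEntry V.lam≡) (push-last V.pushed w≢[])))
    (+-∸-assoc 1 (lastEntry-≤length (proj₁ o) w≢[])))
    where module V = LamView (lamView o)

  rcomp-⊕ : ∀ p q → q ≢ [] → rcomp (directSum p q) ≡ rcomp q
  rcomp-⊕ p q q≢[] = cong (_+ 1) (trans
    (cong₂ _∸_ (length-directSum p q)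
      (trans (lastEntry-++ p (map-≢[] q≢[])) (lastEntry-map (length p +_) q≢[])))
    ([m+n]∸[m+o]≡n∸o (length p) (length q) (lastEntry q)))

  laws : StatisticLaws presentation comp rmin rcomp nonrmin
  laws = record
    { a-e      = refl
    ; a-lam⊕   = λ p q → comp-directSum (lam-isPermutation p) (proj₁ q) (lam-connected p)
                   (≤-trans (s≤s z≤n) (≤-reflexive (sym (lam-length p))))
    ; a′-lam-e = refl
    ; a′-lam   = rcomp-lam
    ; a′-lam⊕  = λ {u} {v} _ _ → rcomp-⊕ (lam321 u) v
    ; b-lam-e  = refl
    ; b-lam    = rmin-lam
    ; b-lam⊕   = λ p q _ → rmin-directSum (lam-isPermutation p) (proj₁ q)
    ; b′-b     = λ {t} _ _ → nonrmin+rmin t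
    }

-- Standard Young tableaux with two rows.

module TableauProof where
  open Tableau
  open Dyck using (Step; u; d; _≟ₛ_; #u; #d; IsDyck; factors)
  open Tableau.Tableau
  open IsStandard
  module D = DyckProof
  open D using (Path; []; up; down; path⇒dyck; dyck⇒path; leading)

  pos : Step → ℕ → List Step → List ℕ
  pos x k []      = []
  pos x k (y ∷ w) = if does (x ≟ₛ y) then k ∷ pos x (suc k) w else pos x (suc k) w

  tab : List Step → Tableau
  tab w = tableau (pos u 1 w) (pos d 1 w)

  pos-≥ : ∀ x k w → All (k ≤_) (pos x k w)
  pos-≥ x k []      = []
  pos-≥ x k (y ∷ w) with does (x ≟ₛ y)
  ... | true  = ≤-refl ∷ All.map <⇒≤ (pos-≥ x (suc k) w)
  ... | false = All.map <⇒≤ (pos-≥ x (suc k) w)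

  pos-sorted : ∀ x k w → AllPairs _<_ (pos x k w)
  pos-sorted x k []      = []
  pos-sorted x k (y ∷ w) with does (x ≟ₛ y)
  ... | true  = pos-≥ x (suc k) w ∷ pos-sorted x (suc k) w
  ... | false = pos-sorted x (suc k) w

  pos-length : ∀ x k w → length (pos x k w) ≡ count (x ≟ₛ_) w
  pos-length x k []      = refl
  pos-length u k (u ∷ w) = cong suc (pos-length u (suc k) w)
  pos-length u k (d ∷ w) = pos-length u (suc k) w
  pos-length d k (u ∷ w) = pos-length d (suc k) w
  pos-length d k (d ∷ w) = cong suc (pos-length d (suc k) w)

  pos-++ : ∀ x k w v → pos x k (w ++ v) ≡ pos x k w ++ pos x (k + length w) v
  pos-++ x k []      v = cong (λ j → pos x j v) (sym (+-identityʳ k))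
  pos-++ x k (y ∷ w) v with does (x ≟ₛ y)
  ... | true  = cong (k ∷_) (trans (pos-++ x (suc k) w v)
                  (cong (λ j → pos x (suc k) w ++ pos x j v) (sym (+-suc k (length w)))))
  ... | false = trans (pos-++ x (suc k) w v)
                  (cong (λ j → pos x (suc k) w ++ pos x j v) (sym (+-suc k (length w))))

  pos-shift : ∀ x m k w → pos x (m + k) w ≡ map (m +_) (pos x k w)
  pos-shift x m k []      = refl
  pos-shift x m k (y ∷ w) with does (x ≟ₛ y)
  ... | true  = cong (m + k ∷_) (trans (cong (λ j → pos x j w) (sym (+-suc m k))) (pos-shift x m (suc k) w))
  ... | false = trans (cong (λ j → pos x j w) (sym (+-suc m k))) (pos-shift x m (suc k) w)

  interval-suc : ∀ k m → map (k +_) [1⋯ suc m ] ≡ suc k ∷ map (suc k +_) [1⋯ m ]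
  interval-suc k m = trans (cong (map (k +_)) ([1⋯suc] m))
    (cong₂ _∷_ (+-comm k 1) (trans (sym (List.map-∘ [1⋯ m ])) (List.map-cong (λ x → +-suc k x) [1⋯ m ])))

  pos-entries : ∀ k w → pos u (suc k) w ++ pos d (suc k) w ↭ map (k +_) [1⋯ length w ]
  pos-entries k []      = ↭-refl
  pos-entries k (u ∷ w) = ↭-trans (prep _ (pos-entries (suc k) w)) (↭-reflexive (sym (interval-suc k (length w))))
  pos-entries k (d ∷ w) = ↭-trans (Perm.shift (suc k) (pos u (suc (suc k)) w) (pos d (suc (suc k)) w))
    (↭-trans (prep _ (pos-entries (suc k) w)) (↭-reflexive (sym (interval-suc k (length w)))))

  length-steps : ∀ w → length w ≡ #u w + #d w
  length-steps []      = refl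
  length-steps (u ∷ w) = cong suc (length-steps w)
  length-steps (d ∷ w) = trans (cong suc (length-steps w)) (sym (+-suc (#u w) (#d w)))

  dyck-length : ∀ {w} → IsDyck w → length w ≡ 2 * #u w
  dyck-length {w} (eq , _) = trans (length-steps w) (cong (#u w +_) (trans (sym eq) (sym (+-identityʳ _))))

  dyck-length-columns : ∀ {w} → IsDyck w → length w ≡ 2 * columns (tab w)
  dyck-length-columns {w} o = trans (dyck-length o) (cong (2 *_) (sym (pos-length u 1 w)))

  -- The columns of tab w match each d with the u that has been waiting longest;
  -- q lists the positions of the u's still waiting at height j.
  path⇒columns : ∀ {j k w} q → length q ≡ j → All (_< k) q → Path j w →
                 Pointwise _<_ (q ++ pos u k w) (pos d k w)
  path⇒columns []      _  _          []       = []
  path⇒columns (_ ∷ _) () _          []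
  path⇒columns {k = k} q l q< (up {w = w} p) = subst (λ l → Pointwise _<_ l _) (List.++-assoc q (k ∷ []) _)
    (path⇒columns (q ++ k ∷ []) (trans (List.length-++ q) (trans (+-comm (length q) 1) (cong suc l)))
      (All.++⁺ (All.map m<n⇒m<1+n q<) (≤-refl ∷ [])) p)
  path⇒columns []      () _          (down p)
  path⇒columns (a ∷ q) l  (a<k ∷ q<) (down p) =
    a<k ∷ path⇒columns q (suc-injective l) (All.map m<n⇒m<1+n q<) p

  columns⇒path : ∀ {k} w q → Pointwise _<_ (q ++ pos u k w) (pos d k w) → Path (length q) w
  columns⇒path []      []      _ = []
  columns⇒path {k} (u ∷ w) q p = up (subst (λ j → Path j w) (trans (List.length-++ q) (+-comm (length q) 1))
    (columns⇒path w (q ++ k ∷ []) (subst (λ l → Pointwise _<_ l _) (sym (List.++-assoc q (k ∷ []) _)) p)))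
  columns⇒path {k} (d ∷ w) (a ∷ q) (_ ∷ p) = down (columns⇒path w q p)
  -- With no `u` waiting, the column of the `d` at position `k` would have a top entry beyond `k`.
  columns⇒path {k} (d ∷ w) [] p with pos u (suc k) w | pos-≥ u (suc k) w
  columns⇒path {k} (d ∷ w) [] (lt ∷ _) | _ ∷ _ | ge ∷ _ = contradiction lt (<⇒≯ ge)

  tab-isObject : ∀ {w} → IsDyck w → IsStandard (tab w)
  tab-isObject {w} o = record
    { columnsIncrease = path⇒columns [] refl [] (dyck⇒path o)
    ; topIncreases    = pos-sorted u 1 w
    ; bottomIncreases = pos-sorted d 1 w
    ; entries         = ↭-trans (pos-entries 0 w)
        (↭-reflexive (trans (List.map-id _) (cong [1⋯_] (dyck-length-columns o))))
    }

  min-head : ∀ {t x} → AllPairs _<_ t → x ∈ t → (∀ {y} → y ∈ t → x ≤ y) → ∃[ t′ ] (t ≡ x ∷ t′)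
  min-head {t = y ∷ t} _        (here refl) f = t , refl
  min-head {t = y ∷ t} (lt ∷ _) (there x∈)  f = contradiction (f (here refl)) (<⇒≱ (lookup lt x∈))

  -- The least remaining number heads one of the two increasing rows, and the row it heads
  -- determines the next letter.
  merge : ∀ m k t b → AllPairs _<_ t → AllPairs _<_ b → t ++ b ↭ map (k +_) [1⋯ m ] →
          ∃[ w ] (t ≡ pos u (suc k) w × b ≡ pos d (suc k) w)
  merge zero    k []      []      _  _  _ = [] , refl , refl
  merge zero    k []      (_ ∷ _) _  _  p = contradiction p Perm.¬x∷xs↭[]
  merge zero    k (_ ∷ _) b       _  _  p = contradiction p Perm.¬x∷xs↭[]
  merge (suc m) k t       b       st sb p = go (∈-++⁻ t (∈-resp-↭ (↭-sym p′) (here refl)))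
    where
    p′ : t ++ b ↭ suc k ∷ map (suc k +_) [1⋯ m ]
    p′ = ↭-trans p (↭-reflexive (interval-suc k m))
    ≥k+1 : ∀ {y} → y ∈ t ++ b → suc k ≤ y
    ≥k+1 y∈ with ∈-map⁻ (k +_) (∈-resp-↭ p y∈)
    ... | i , i∈ , refl = m<m+n k (proj₁ (∈-[1⋯]⁻ i∈))
    go : suc k ∈ t ⊎ suc k ∈ b → ∃[ w ] (t ≡ pos u (suc k) w × b ≡ pos d (suc k) w)
    go (inj₁ k∈t) with min-head st k∈t (≥k+1 ∘ ∈-++⁺ˡ)
    ... | t′ , refl =
      let (w , t≡ , b≡) = merge m (suc k) t′ b (AllPairs.tail st) sb (drop-∷ p′) in u ∷ w , cong (suc k ∷_) t≡ , b≡
    go (inj₂ k∈b) with min-head sb k∈b (≥k+1 ∘ ∈-++⁺ʳ t)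
    ... | b′ , refl =
      let (w , t≡ , b≡) = merge m (suc k) t b′ st (AllPairs.tail sb)
            (drop-∷ (↭-trans (↭-sym (Perm.shift (suc k) t b′)) p′))
      in d ∷ w , t≡ , cong (suc k ∷_) b≡

  tab-surjective : ∀ {T} → IsStandard T → ∃[ w ] (IsDyck w × T ≡ tab w)
  tab-surjective {T} std with merge (2 * columns T) 0 (top T) (bottom T) (topIncreases std) (bottomIncreases std)
                                (↭-trans (entries std) (↭-reflexive (sym (List.map-id _))))
  ... | w , refl , refl = w , path⇒dyck (columns⇒path w [] (columnsIncrease std)) , refl

  pos-injective : ∀ k w v → pos u k w ≡ pos u k v → pos d k w ≡ pos d k v → w ≡ v
  pos-injective k []      []      _  _  = refl
  pos-injective k []      (u ∷ v) () _
  pos-injective k []      (d ∷ v) _  ()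
  pos-injective k (u ∷ w) []      () _
  pos-injective k (d ∷ w) []      _  ()
  pos-injective k (u ∷ w) (u ∷ v) eq eq′ = cong (u ∷_) (pos-injective (suc k) w v (List.∷-injectiveʳ eq) eq′)
  pos-injective k (d ∷ w) (d ∷ v) eq eq′ = cong (d ∷_) (pos-injective (suc k) w v eq (List.∷-injectiveʳ eq′))
  pos-injective k (u ∷ w) (d ∷ v) eq _ =
    contradiction (lookup (pos-≥ u (suc k) v) (subst (k ∈_) eq (here refl))) (<-irrefl refl)
  pos-injective k (d ∷ w) (u ∷ v) eq _ =
    contradiction (lookup (pos-≥ u (suc k) w) (subst (k ∈_) (sym eq) (here refl))) (<-irrefl refl)

  private module Tab = RawCatalan tableaux

  tab-lam : ∀ {w} → IsDyck w → tab (u ∷ w ++ d ∷ []) ≡ Tab.lam (tab w)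
  tab-lam {w} o = cong₂ tableau
    (cong (1 ∷_) (trans (pos-++ u 2 w (d ∷ [])) (trans (List.++-identityʳ _) (pos-shift u 1 1 w))))
    (trans (pos-++ d 2 w (d ∷ [])) (cong₂ _++_ (pos-shift d 1 1 w)
      (cong (_∷ []) (trans (+-comm 2 (length w)) (cong (_+ 2) (dyck-length-columns o))))))

  tab-⊕ : ∀ {w v} → IsDyck w → tab (w ++ v) ≡ tab w Tab.⊕ tab v
  tab-⊕ {w} {v} o = cong₂ tableau (half u) (half d)
    where
    half : ∀ x → pos x 1 (w ++ v) ≡ pos x 1 w ++ map (2 * columns (tab w) +_) (pos x 1 v)
    half x = trans (pos-++ x 1 w v) (cong (pos x 1 w ++_)
      (trans (cong (λ j → pos x j v) (trans (+-comm 1 (length w)) (cong (_+ 1) (dyck-length-columns o))))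
             (pos-shift x (2 * columns (tab w)) 1 v)))

  lam-isObject : ∀ {T} → IsStandard T → IsStandard (Tab.lam T)
  lam-isObject std with tab-surjective std
  ... | w , o , refl = subst IsStandard (tab-lam o) (tab-isObject (Presentation.lam-isObject D.presentation o))

  ⊕-isObject : ∀ {T V} → IsStandard T → IsStandard V → IsStandard (T Tab.⊕ V)
  ⊕-isObject std std′ with tab-surjective std | tab-surjective std′
  ... | w , o , refl | v , o′ , refl =
        subst IsStandard (tab-⊕ o) (tab-isObject (Presentation.⊕-isObject D.presentation o o′))

  presentation : Presentation tableaux
  presentation = Correspondence.Along.presentation D.presentation (λ T w → T ≡ tab w)
    (tab-isObject (path⇒dyck [])) lam-isObject ⊕-isObject tab-surjective
    (λ { {w = w} {v} _ _ refl eq → pos-injective 1 w v (cong top eq) (cong bottom eq) })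
    (λ _ _ p q → trans p (sym q))
    (λ { {w = w} _ refl → pos-length u 1 w }) refl
    (λ { o refl → sym (tab-lam o) }) (λ { o _ refl refl → sym (tab-⊕ o) })

  pos-tail : ∀ {x i} k y w → k < i → i ∈ pos x k (y ∷ w) → i ∈ pos x (suc k) w
  pos-tail {x} k y w k<i i∈ with does (x ≟ₛ y)
  pos-tail {x} k y w k<i (here refl) | true = contradiction k<i (<-irrefl refl)
  pos-tail {x} k y w k<i (there i∈)  | true = i∈
  pos-tail {x} k y w k<i i∈          | false = i∈

  pos-there : ∀ {x i} k y w → i ∈ pos x (suc k) w → i ∈ pos x k (y ∷ w)
  pos-there {x} k y w i∈ with does (x ≟ₛ y)
  ... | true  = there i∈
  ... | false = i∈

  -- `D` is a whole row and stays fixed while the recursion passes to suffixes of the word. The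
  -- hypothesis therefore compares `D` with the positions in the suffix only from `k` on.
  count-factors : ∀ {D} (dec : ∀ i → Dec (suc i ∈ D)) x k w →
                  (∀ i → k ≤ i → (i ∈ D → i ∈ pos x k w) × (i ∈ pos x k w → i ∈ D)) →
                  count dec (pos u k w) ≡ factors u x w
  count-factors {D} dec x k w hyp = go x k w hyp
    where
    Hyp : Step → ℕ → List Step → Set
    Hyp x k w = ∀ i → k ≤ i → (i ∈ D → i ∈ pos x k w) × (i ∈ pos x k w → i ∈ D)
    tail : ∀ x k y w → Hyp x k (y ∷ w) → Hyp x (suc k) w
    tail x k y w hyp i k<i = let (to , from) = hyp i (<⇒≤ k<i) in
      pos-tail {x} k y w k<i ∘ to , from ∘ pos-there {x} k y w
    absent : ∀ x k z w → pos x k (z ∷ w) ≡ pos x (suc k) w → Hyp x k (z ∷ w) → k ∉ D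
    absent x k z w eq hyp k∈ = <-irrefl refl
      (lookup (pos-≥ x (suc k) w) (subst (k ∈_) eq (proj₁ (hyp k ≤-refl) k∈)))
    go : ∀ x k w → Hyp x k w → count dec (pos u k w) ≡ factors u x w
    go x k []          hyp = refl
    go x k (d ∷ [])    hyp = refl
    go x k (d ∷ w@(_ ∷ _)) hyp = go x (suc k) w (tail x k d w hyp)
    go x k (u ∷ [])    hyp = count-no dec [] λ k∈ → case proj₁ (tail x k u [] hyp (suc k) ≤-refl) k∈ of λ ()
    go x k (u ∷ w@(z ∷ w′)) hyp = next x z w′ (tail x k u w hyp) (go x (suc k) w (tail x k u w hyp))
      where
      next : ∀ x z w → Hyp x (suc k) (z ∷ w) → count dec (pos u (suc k) (z ∷ w)) ≡ factors u x (z ∷ w) →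
             count dec (pos u k (u ∷ z ∷ w)) ≡ factors u x (u ∷ z ∷ w)
      next u u w hyp ih = trans (count-yes dec _ (proj₂ (hyp (suc k) ≤-refl) (here refl))) (cong suc ih)
      next d d w hyp ih = trans (count-yes dec _ (proj₂ (hyp (suc k) ≤-refl) (here refl))) (cong suc ih)
      next u d w hyp ih = trans (count-no dec _ (absent u (suc k) d w refl hyp)) ih
      next d u w hyp ih = trans (count-no dec _ (absent d (suc k) u w refl hyp)) ih

  noncons-tab : ∀ w → noncons (tab w) ≡ Dyck.peak w
  noncons-tab w = count-factors _ d 1 w (λ _ _ → id , id)

  cons-tab : ∀ w → cons (tab w) ≡ Dyck.nonpeak w
  cons-tab w = cong suc (count-factors _ u 1 w (λ _ _ → id , id))

  largest-≡ : ∀ {P : Pred ℕ 0ℓ} (P? : Decidable P) n r → r ≤ n → P r →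
              (∀ k → r < k → k ≤ n → ¬ P k) → largest P? n ≡ r
  largest-≡ P? zero    .zero z≤n _ _ = refl
  largest-≡ P? (suc n) r r≤n pr ¬p with m≤n⇒m<n∨m≡n r≤n
  ... | inj₂ refl rewrite dec-true (P? (suc n)) pr = refl
  ... | inj₁ r<n  rewrite dec-false (P? (suc n)) (¬p (suc n) r<n ≤-refl) =
          largest-≡ P? n r (s≤s⁻¹ r<n) pr (λ k r<k k≤n → ¬p k r<k (≤-trans k≤n (n≤1+n n)))

  -- The positions of the d's in a reversed word, from right to left.
  downs : List Step → List ℕ
  downs []      = []
  downs (u ∷ v) = downs v
  downs (d ∷ v) = suc (length v) ∷ downs v

  reverse-pos : ∀ v → reverse (pos d 1 (reverse v)) ≡ downs v
  reverse-pos []      = refl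
  reverse-pos (y ∷ v) = begin
    reverse (pos d 1 (reverse (y ∷ v)))
      ≡⟨ cong (reverse ∘ pos d 1) (List.unfold-reverse y v) ⟩
    reverse (pos d 1 (reverse v ++ y ∷ []))
      ≡⟨ cong reverse (pos-++ d 1 (reverse v) (y ∷ [])) ⟩
    reverse (pos d 1 (reverse v) ++ pos d (suc (length (reverse v))) (y ∷ []))
      ≡⟨ List.reverse-++ (pos d 1 (reverse v)) _ ⟩
    reverse (pos d (suc (length (reverse v))) (y ∷ [])) ++ reverse (pos d 1 (reverse v))
      ≡⟨ cong₂ _++_ (cong (λ n → reverse (pos d (suc n) (y ∷ []))) (List.length-reverse v)) (reverse-pos v) ⟩
    reverse (pos d (suc (length v)) (y ∷ [])) ++ downs v
      ≡⟨ last y ⟩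
    downs (y ∷ v) ∎
    where
    open ≡-Reasoning
    last : ∀ y → reverse (pos d (suc (length v)) (y ∷ [])) ++ downs v ≡ downs (y ∷ v)
    last u = refl
    last d = refl

  downs-≤ : ∀ v → All (_≤ length v) (downs v)
  downs-≤ []      = []
  downs-≤ (u ∷ v) = All.map (λ le → ≤-trans le (n≤1+n _)) (downs-≤ v)
  downs-≤ (d ∷ v) = ≤-refl ∷ All.map (λ le → ≤-trans le (n≤1+n _)) (downs-≤ v)

  leading-≤ : ∀ v → leading v ≤ length (downs v)
  leading-≤ []      = z≤n
  leading-≤ (u ∷ v) = z≤n
  leading-≤ (d ∷ v) = s≤s (leading-≤ v)

  take-downs : ∀ v → take (leading v) (downs v) ≡ applyUpTo (length v ∸_) (leading v)
  take-downs []      = refl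
  take-downs (u ∷ v) = refl
  take-downs (d ∷ v) = cong (suc (length v) ∷_) (take-downs v)

  -- Once the run has stopped at a `u`, all remaining positions are at most the length of what
  -- follows it, and the entry required next is one more.
  take-downs-≢ : ∀ v k → leading v < k → k ≤ length (downs v) → take k (downs v) ≢ applyUpTo (length v ∸_) k
  take-downs-≢ []      (suc k) _        ()
  take-downs-≢ (d ∷ v) (suc k) (s≤s lt) (s≤s le) eq = take-downs-≢ v k lt le (List.∷-injectiveʳ eq)
  take-downs-≢ (u ∷ v) (suc k) _        le       eq with downs v | downs-≤ v
  ... | x ∷ xs | x≤ ∷ _ = <-irrefl (List.∷-injectiveˡ eq) (s≤s x≤)

  rcomp-tab : ∀ {w} → IsDyck w → rcomp (tab w) ≡ Dyck.rcomp w
  rcomp-tab {w} o = largest-≡ _ (columns (tab w)) (leading v)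
    (≤-trans (leading-≤ v) (≤-reflexive ∣downs∣))
    (trans (cong (take (leading v)) bottom≡) (trans (take-downs v) (sym (target (leading v)))))
    (λ k lt le eq → take-downs-≢ v k lt (≤-trans le (≤-reflexive (sym ∣downs∣)))
      (trans (cong (take k) (sym bottom≡)) (trans eq (target k))))
    where
    v : List Step
    v = reverse w
    bottom≡ : reverse (pos d 1 w) ≡ downs v
    bottom≡ = trans (cong (reverse ∘ pos d 1) (sym (List.reverse-involutive w))) (reverse-pos v)
    ∣downs∣ : length (downs v) ≡ columns (tab w)
    ∣downs∣ = trans (cong length (sym bottom≡)) (trans (List.length-reverse (pos d 1 w))
      (trans (pos-length d 1 w) (trans (sym (proj₁ o)) (sym (pos-length u 1 w)))))
    target : ∀ k → map (2 * columns (tab w) ∸_) (upTo k) ≡ applyUpTo (length v ∸_) k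
    target k = trans (List.map-upTo (2 * columns (tab w) ∸_) k)
      (cong (λ n → applyUpTo (n ∸_) k) (trans (sym (dyck-length-columns o)) (sym (List.length-reverse w))))

  column : ∀ {t b} j → Pointwise _<_ t b → j < length t → ∃₂ λ x y → x ∈ drop j t × y ∈ take (suc j) b × x < y
  column zero    (x<y ∷ _)  _        = _ , _ , here refl , here refl , x<y
  column (suc j) (_ ∷ cols) (s≤s lt) =
    let (x , y , x∈ , y∈ , x<y) = column j cols lt in x , y , x∈ , there y∈ , x<y

  -- By a column of T, an entry of lam T outside the first k columns is smaller than one inside.
  lam-¬cut : ∀ {T} → IsStandard T → ∀ k → 1 ≤ k → k < columns (Tab.lam T) →
             ¬ SameSet (take k (top (Tab.lam T)) ++ take k (bottom (Tab.lam T))) [1⋯ 2 * k ]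
  lam-¬cut {T} std (suc j) _ (s≤s j<n) (to , from) =
    -- The 1 prepended to the top row moves the top entry of this column one place to the right, out
    -- of the first `suc j` columns, while its bottom entry stays inside them.
    let (x , y , x∈ , y∈ , x<y) = column j (columnsIncrease std) j<∣T∣
        x∈drop = subst (suc x ∈_) (sym (List.drop-map {f = suc} j (top T))) (∈-map⁺ suc x∈)
        y∈take = subst (suc y ∈_) (sym take-bottom) (∈-map⁺ suc y∈)
        y≤ = proj₂ (∈-[1⋯]⁻ (lookup to (∈-++⁺ʳ (take (suc j) (top lamT)) y∈take)))
    in [ (λ x∈take → unique-++-disjoint (take (suc j) (top lamT))
           (subst Unique (sym (List.take++drop≡id (suc j) (top lamT))) (AllPairs.map <⇒≢ (topIncreases stdL)))
           x∈take x∈drop)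
       , (λ x∈take → unique-++-disjoint (top lamT) (↭[1⋯]-unique (entries stdL))
           (∈-drop (suc j) {top lamT} x∈drop) (∈-take (suc j) x∈take))
       ]′ (∈-++⁻ (take (suc j) (top lamT)) (lookup from (∈-[1⋯]⁺ (s≤s z≤n) (≤-trans (<⇒≤ (s≤s x<y)) y≤))))
    where
    lamT : Tableau
    lamT = Tab.lam T
    stdL : IsStandard lamT
    stdL = lam-isObject std
    j<∣T∣ : j < length (top T)
    j<∣T∣ = ≤-trans j<n (≤-reflexive (List.length-map suc (top T)))
    take-bottom : take (suc j) (bottom lamT) ≡ map suc (take (suc j) (bottom T))
    take-bottom = trans (take-++-≤ (map suc (bottom T)) (suc j) (≤-trans j<∣T∣ (≤-reflexive
        (trans (Pointwise-length (columnsIncrease std)) (sym (List.length-map suc (bottom T)))))))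
      (List.take-map {f = suc} (suc j) (bottom T))

  ++-interchange : ∀ (a b c e : List ℕ) → (a ++ b) ++ (c ++ e) ↭ (a ++ c) ++ (b ++ e)
  ++-interchange a b c e = ↭-trans (↭-reflexive (List.++-assoc a b (c ++ e)))
    (↭-trans (Perm.++⁺ˡ a (Perm.shifts b c)) (↭-reflexive (sym (List.++-assoc a c (b ++ e)))))

  comp-⊕ : ∀ {L V} → IsStandard L → IsStandard V → 1 ≤ columns L →
           (∀ k → 1 ≤ k → k < columns L → ¬ SameSet (take k (top L) ++ take k (bottom L)) [1⋯ 2 * k ]) →
           comp (L Tab.⊕ V) ≡ suc (comp V)
  comp-⊕ {L} {V} stdL stdV 1≤m ¬cut = trans
    (cong (λ n → count (cut? (L Tab.⊕ V)) [1⋯ n ])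
      (trans (List.length-++ (top L)) (cong (m +_) (List.length-map _ (top V)))))
    (count-cuts (cut? (L Tab.⊕ V)) (cut? V) m (columns V) 1≤m before at after)
    where
    Cut : Tableau → ℕ → Set
    Cut T k = SameSet (take k (top T) ++ take k (bottom T)) [1⋯ 2 * k ]
    cut? : ∀ T k → Dec (Cut T k)
    cut? T k = sameSet? (take k (top T) ++ take k (bottom T)) [1⋯ 2 * k ]
    m : ℕ
    m = columns L
    shift : List ℕ → List ℕ
    shift = map (2 * m +_)
    bottom-length : length (bottom L) ≡ m
    bottom-length = sym (Pointwise-length (columnsIncrease stdL))
    low : ∀ k → k ≤ m → take k (top (L Tab.⊕ V)) ++ take k (bottom (L Tab.⊕ V)) ≡ take k (top L) ++ take k (bottom L)
    low k k≤m = cong₂ _++_ (take-++-≤ (top L) k k≤m)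
      (take-++-≤ (bottom L) k (≤-trans k≤m (≤-reflexive (sym bottom-length))))
    before : ∀ k → 1 ≤ k → k < m → ¬ Cut (L Tab.⊕ V) k
    before k 1≤k k<m cut = ¬cut k 1≤k k<m (subst (λ l → SameSet l [1⋯ 2 * k ]) (low k (<⇒≤ k<m)) cut)
    at : Cut (L Tab.⊕ V) m
    at = subst (λ l → SameSet l [1⋯ 2 * m ])
      (sym (trans (low m ≤-refl) (cong₂ _++_ (List.take-all m (top L) ≤-refl)
        (List.take-all m (bottom L) (≤-reflexive bottom-length)))))
      (↭⇒SameSet (entries stdL))
    after : ∀ k → 1 ≤ k → k ≤ columns V → (Cut (L Tab.⊕ V) (m + k) → Cut V k) × (Cut V k → Cut (L Tab.⊕ V) (m + k))
    after k _ _ = (λ cut → to (SameSet-resp-↭ rearrange (subst (SameSet _) interval cut)))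
                , (λ cut → subst (SameSet _) (sym interval) (SameSet-resp-↭ (↭-sym rearrange) (from cut)))
      where
      interval : [1⋯ 2 * (m + k) ] ≡ [1⋯ 2 * m ] ++ shift [1⋯ 2 * k ]
      interval = trans (cong [1⋯_] (*-distribˡ-+ 2 m k)) ([1⋯]-++ (2 * m) (2 * k))
      inner : List ℕ
      inner = take k (top V) ++ take k (bottom V)
      rearrange : take (m + k) (top (L Tab.⊕ V)) ++ take (m + k) (bottom (L Tab.⊕ V)) ↭
                  (top L ++ bottom L) ++ shift inner
      rearrange = ↭-trans (↭-reflexive (cong₂ _++_
          (trans (take-++-+ (top L) k) (cong (top L ++_) (List.take-map {f = 2 * m +_} k (top V))))
          (trans (cong (λ n → take (n + k) (bottom L ++ shift (bottom V))) (sym bottom-length))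
            (trans (take-++-+ (bottom L) k) (cong (bottom L ++_) (List.take-map {f = 2 * m +_} k (bottom V)))))))
        (↭-trans (++-interchange (top L) (shift (take k (top V))) (bottom L) (shift (take k (bottom V))))
        (↭-reflexive (cong ((top L ++ bottom L) ++_) (sym (List.map-++ (2 * m +_) (take k (top V)) (take k (bottom V)))))))
      positive : All (1 ≤_) inner
      positive = let pos = All.tabulate (proj₁ ∘ ↭[1⋯]-bounds (entries stdV))
                 in All.++⁺ (All.take⁺ k (All.++⁻ˡ (top V) pos)) (All.take⁺ k (All.++⁻ʳ (top V) pos))
      shifted = sameSet-shift (entries stdL) positive (All.tabulate (proj₁ ∘ ∈-[1⋯]⁻ {2 * k}))
      to = proj₁ shifted
      from = proj₂ shifted

  rcomp-lam : ∀ {T} → IsStandard T → rcomp (Tab.lam T) ≡ suc (rcomp T)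
  rcomp-lam std with tab-surjective std
  ... | w , o , refl = trans (cong rcomp (sym (tab-lam o)))
        (trans (rcomp-tab (Presentation.lam-isObject D.presentation o))
        (trans (D.rcomp-lam w) (cong suc (sym (rcomp-tab o)))))

  rcomp-⊕ : ∀ {T V} → IsStandard T → IsStandard V → V ≢ tableau [] [] → rcomp (T Tab.⊕ V) ≡ rcomp V
  rcomp-⊕ std std′ V≢e with tab-surjective std | tab-surjective std′
  ... | w , o , refl | v , o′ , refl = trans (cong rcomp (sym (tab-⊕ o)))
        (trans (rcomp-tab (Presentation.⊕-isObject D.presentation o o′))
        (trans (D.rcomp-++ w (dyck⇒path o′) (λ { refl → V≢e refl })) (sym (rcomp-tab o′))))

  noncons-lam : ∀ {T} → IsStandard T → T ≢ tableau [] [] → noncons (Tab.lam T) ≡ noncons T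
  noncons-lam std T≢e with tab-surjective std
  ... | w , o , refl = trans (cong noncons (sym (tab-lam o)))
        (trans (noncons-tab (u ∷ w ++ d ∷ []))
        (trans (D.peak-lam (dyck⇒path o) (λ { refl → T≢e refl })) (sym (noncons-tab w))))

  noncons-⊕ : ∀ {T V} → IsStandard T → IsStandard V → T ≢ tableau [] [] → noncons (T Tab.⊕ V) ≡ noncons T + noncons V
  noncons-⊕ std std′ T≢e with tab-surjective std | tab-surjective std′
  ... | w , o , refl | v , o′ , refl = trans (cong noncons (sym (tab-⊕ o)))
        (trans (noncons-tab (w ++ v))
        (trans (D.peak-++ v (dyck⇒path o) (λ { refl → T≢e refl })) (sym (cong₂ _+_ (noncons-tab w) (noncons-tab v)))))

  cons+noncons : ∀ {T} → IsStandard T → cons T + noncons T ≡ suc (columns T)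
  cons+noncons std with tab-surjective std
  ... | w , o , refl = trans (cong₂ _+_ (cons-tab w) (noncons-tab w))
        (cong suc (trans (D.uu+ud (dyck⇒path o)) (sym (pos-length u 1 w))))

  laws : StatisticLaws presentation comp noncons rcomp cons
  laws = record
    { a-e      = refl
    ; a-lam⊕   = λ p q → comp-⊕ (lam-isObject p) q (s≤s z≤n) (lam-¬cut p)
    ; a′-lam-e = refl
    ; a′-lam   = λ p _ → rcomp-lam p
    ; a′-lam⊕  = λ p q → rcomp-⊕ (lam-isObject p) q
    ; b-lam-e  = refl
    ; b-lam    = noncons-lam
    ; b-lam⊕   = λ p q _ → noncons-⊕ (lam-isObject p) q λ ()
    ; b′-b     = λ p _ → cons+noncons p
    }

-- Non-crossing partitions.

module PartitionProof where
  open Partition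
  open IsNonCrossing
  open RawCatalan partitions using (_⊕_)
  module P₂₃₁ = Permutation231Proof
  open P₂₃₁ using (NoDescentBelow)

  lastEntry-≤ : ∀ {B} → AllPairs _>_ B → ∀ {x} → x ∈ B → lastEntry B ≤ x
  lastEntry-≤ {x ∷ []}    _        (here refl) = ≤-refl
  lastEntry-≤ {x ∷ y ∷ B} (gt ∷ _) (here refl) = <⇒≤ (lookup gt (lastEntry-∈ λ ()))
  lastEntry-≤ {x ∷ y ∷ B} (_ ∷ dec) (there x∈) = lastEntry-≤ dec x∈

  bounds : ∀ {P} → IsNonCrossing P → ∀ {B x} → B ∈ P → x ∈ B → 1 ≤ x × x ≤ size P
  bounds nc B∈ x∈ = ↭[1⋯]-bounds (partition nc) (∈-concat⁺′ x∈ B∈)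

  concat-lam : ∀ P → concat (lamBlocks P) ≡ suc (size P) ∷ concat P
  concat-lam []      = refl
  concat-lam (_ ∷ _) = refl

  concat-⊕ : ∀ P Q → concat (P ⊕ Q) ≡ Permutation.directSum (concat P) (concat Q)
  concat-⊕ P Q = trans (sym (List.concat-++ P _)) (cong (concat P ++_) (List.concat-map Q))

  lam-isObject : ∀ {P} → IsNonCrossing P → IsNonCrossing (lamBlocks P)
  lam-isObject {[]} nc = record
    { nonEmpty    = (λ ()) ∷ []
    ; decreasing  = ([] ∷ []) ∷ []
    ; sorted      = [] ∷ []
    ; partition   = ↭-refl
    ; nonCrossing = λ { (here refl) (here refl) _ _ _ _ _ _ _ → refl }
    }
  lam-isObject {P@(B ∷ Bs)} nc with nonEmpty nc | sorted nc
  ... | B≢[] ∷ Bs≢[] | B<Bs ∷ srt = record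
    { nonEmpty    = (λ ()) ∷ Bs≢[]
    ; decreasing  = (All.tabulate (s≤s ∘ proj₂ ∘ bounds nc (here refl)) ∷ All.head (decreasing nc))
                    ∷ All.tail (decreasing nc)
    ; sorted      = All.map (subst (_< _) (sym (lastEntry-∷ _ B≢[]))) B<Bs ∷ srt
    ; partition   = suc-∷-isPermutation (partition nc)
    ; nonCrossing = nc′
    }
    where
    n : ℕ
    n = size P
    below : ∀ {C x} → C ∈ P → x ∈ C → x < suc n
    below C∈ x∈ = s≤s (proj₂ (bounds nc C∈ x∈))
    tail : ∀ {x y} → x ∈ suc n ∷ B → x < y → y ≤ n → x ∈ B
    tail (here refl) lt le = contradiction lt (≤⇒≯ (≤-trans le (n≤1+n n)))
    tail (there x∈)  lt le = x∈
    B≢ : ∀ {C} → C ∈ Bs → B ≢ C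
    B≢ C∈ refl = <-irrefl refl (lookup B<Bs C∈)
    nc′ : ∀ {X Y a b c e} → X ∈ (suc n ∷ B) ∷ Bs → Y ∈ (suc n ∷ B) ∷ Bs →
          a ∈ X → b ∈ Y → c ∈ X → e ∈ Y → a < b → b < c → c < e → X ≡ Y
    nc′ (here refl) (here refl) a∈ b∈ c∈ e∈ a<b b<c c<e = refl
    -- Here `e` belongs to an old block, so the smaller entries `a` and `c` are not the new one and
    -- lie in `B`.
    nc′ (here refl) (there Y∈)  a∈ b∈ c∈ e∈ a<b b<c c<e =
      let e≤n = proj₂ (bounds nc (there Y∈) e∈)
          b≤n = ≤-trans (<⇒≤ (<-trans b<c c<e)) e≤n
      in contradiction (nonCrossing nc (here refl) (there Y∈) (tail a∈ a<b b≤n) b∈ (tail c∈ c<e e≤n) e∈ a<b b<c c<e)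
                       (B≢ Y∈)
    -- Here the crossing is at min B, a, b, c: e may be the new entry.
    nc′ (there X∈) (here refl)  a∈ b∈ c∈ e∈ a<b b<c c<e =
      contradiction (nonCrossing nc (here refl) (there X∈) (lastEntry-∈ B≢[]) a∈
                       (tail b∈ b<c (proj₂ (bounds nc (there X∈) c∈))) c∈
                       (<-≤-trans (lookup B<Bs X∈) (lastEntry-≤ (lookup (decreasing nc) (there X∈)) a∈)) a<b b<c)
                    (B≢ X∈)
    nc′ (there X∈) (there Y∈)   a∈ b∈ c∈ e∈ a<b b<c c<e =
      nonCrossing nc (there X∈) (there Y∈) a∈ b∈ c∈ e∈ a<b b<c c<e

  ⊕-isObject : ∀ {P Q} → IsNonCrossing P → IsNonCrossing Q → IsNonCrossing (P ⊕ Q)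
  ⊕-isObject {P} {Q} ncP ncQ = record
    { nonEmpty    = All.++⁺ (nonEmpty ncP) (All.map⁺ (All.map map-≢[] (nonEmpty ncQ)))
    ; decreasing  = All.++⁺ (decreasing ncP)
                      (All.map⁺ (All.map (λ dec → AllPairs.map⁺ (AllPairs.map (+-monoʳ-< n) dec)) (decreasing ncQ)))
    ; sorted      = AllPairs.++⁺ (sorted ncP) sortedQ
                      (All.tabulate (λ B∈ → All.map⁺ (All.tabulate (λ C∈ → cross B∈ C∈))))
    ; partition   = ↭-trans (↭-reflexive (concat-⊕ P Q))
                    (↭-trans (directSum-isPermutation (partition ncP) (partition ncQ))
                    (↭-reflexive (cong (λ w → [1⋯ length w ]) (sym (concat-⊕ P Q)))))
    ; nonCrossing = nc′
    }
    where
    n : ℕ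
    n = size P
    min≡ : ∀ {B} → B ∈ Q → lastEntry (map (n +_) B) ≡ n + lastEntry B
    min≡ B∈ = lastEntry-map (n +_) (lookup (nonEmpty ncQ) B∈)
    sortedQ : AllPairs (λ B C → lastEntry B < lastEntry C) (map (map (n +_)) Q)
    sortedQ = AllPairs.map⁺ (go (nonEmpty ncQ) (sorted ncQ))
      where
      go : ∀ {Q} → All (_≢ []) Q → AllPairs (λ B C → lastEntry B < lastEntry C) Q →
           AllPairs (λ B C → lastEntry (map (n +_) B) < lastEntry (map (n +_) C)) Q
      go []        []         = []
      go (B≢ ∷ Q≢) (lt ∷ srt) =
        All.zipWith (λ (C≢ , l) → subst₂ _<_ (sym (lastEntry-map (n +_) B≢)) (sym (lastEntry-map (n +_) C≢)) (+-monoʳ-< n l)) (Q≢ , lt)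
        ∷ go Q≢ srt
    cross : ∀ {B C} → B ∈ P → C ∈ Q → lastEntry B < lastEntry (map (n +_) C)
    cross B∈ C∈ = subst (_ <_) (sym (min≡ C∈)) (≤-<-trans
      (proj₂ (bounds ncP B∈ (lastEntry-∈ (lookup (nonEmpty ncP) B∈))))
      (m<m+n n (proj₁ (bounds ncQ C∈ (lastEntry-∈ (lookup (nonEmpty ncQ) C∈))))))
    low : ∀ {B x} → B ∈ P → x ∈ B → x ≤ n
    low B∈ x∈ = proj₂ (bounds ncP B∈ x∈)
    high : ∀ {B x} → B ∈ map (map (n +_)) Q → x ∈ B → n < x
    high B∈ x∈ with ∈-map⁻ (map (n +_)) B∈
    ... | C , C∈ , refl with ∈-map⁻ (n +_) x∈
    ...   | y , y∈ , refl = m<m+n n (proj₁ (bounds ncQ C∈ y∈))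
    nc′ : ∀ {X Y a b c e} → X ∈ P ⊕ Q → Y ∈ P ⊕ Q →
          a ∈ X → b ∈ Y → c ∈ X → e ∈ Y → a < b → b < c → c < e → X ≡ Y
    nc′ X∈ Y∈ a∈ b∈ c∈ e∈ a<b b<c c<e with ∈-++⁻ P X∈ | ∈-++⁻ P Y∈
    ... | inj₁ X∈P | inj₁ Y∈P = nonCrossing ncP X∈P Y∈P a∈ b∈ c∈ e∈ a<b b<c c<e
    ... | inj₁ X∈P | inj₂ Y∈Q = contradiction (<-trans (high Y∈Q b∈) b<c) (≤⇒≯ (low X∈P c∈))
    ... | inj₂ X∈Q | inj₁ Y∈P = contradiction (<-trans (high X∈Q a∈) a<b) (≤⇒≯ (low Y∈P b∈))
    ... | inj₂ X∈Q | inj₂ Y∈Q with ∈-map⁻ (map (n +_)) X∈Q | ∈-map⁻ (map (n +_)) Y∈Q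
    ...   | B , B∈ , refl | C , C∈ , refl
            with ∈-map⁻ (n +_) a∈ | ∈-map⁻ (n +_) b∈ | ∈-map⁻ (n +_) c∈ | ∈-map⁻ (n +_) e∈
    ...     | a , a∈ , refl | b , b∈ , refl | c , c∈ , refl | e , e∈ , refl =
              cong (map (n +_)) (nonCrossing ncQ B∈ C∈ a∈ b∈ c∈ e∈
                (+-cancelˡ-< n _ _ a<b) (+-cancelˡ-< n _ _ b<c) (+-cancelˡ-< n _ _ c<e))

  -- If a ∈ B and b ∈ C with a < b and min B < min C, then the minimum of C is
  -- at least a, since B and C do not cross.
  avoids : ∀ {P} → IsNonCrossing P → Triples NoDescentBelow (concat P)
  avoids {P} nc = blocks⁺ P id (sorted nc)
    where
    uncrossed : ∀ {B C a b c} → B ∈ P → C ∈ P → lastEntry B < lastEntry C → a ∈ B → b ∈ C → lastEntry C ≤ c →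
         NoDescentBelow a b c
    uncrossed B∈ C∈ B<C a∈ b∈ ≤c (c<a , a<b) =
      <-irrefl (cong lastEntry (nonCrossing nc B∈ C∈ (lastEntry-∈ (lookup (nonEmpty nc) B∈))
                  (lastEntry-∈ (lookup (nonEmpty nc) C∈)) a∈ b∈ B<C (≤-<-trans ≤c c<a) a<b)) B<C
    pairs : ∀ {B a} → B ∈ P → a ∈ B → ∀ Cs → (∀ {C} → C ∈ Cs → C ∈ P) →
            All (λ C → lastEntry B < lastEntry C) Cs →
            AllPairs (λ C D → lastEntry C < lastEntry D) Cs → AllPairs (NoDescentBelow a) (concat Cs)
    pairs B∈ a∈ []       ⊆P _          _          = []
    pairs {B} {a} B∈ a∈ (C ∷ Cs) ⊆P (B<C ∷ lt) (C<Cs ∷ srt) = AllPairs.++⁺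
      (allPairs (λ b∈ c∈ → uncrossed B∈ C∈ B<C a∈ b∈ (lastEntry-≤ (lookup (decreasing nc) C∈) c∈)))
      (pairs B∈ a∈ Cs (⊆P ∘ there) lt srt)
      (All.tabulate λ b∈ → All.tabulate λ c∈ → later b∈ (∈-concat⁻′ Cs c∈))
      where
      C∈ : C ∈ P
      C∈ = ⊆P (here refl)
      later : ∀ {b c} → b ∈ C → ∃[ D ] (c ∈ D × D ∈ Cs) → NoDescentBelow a b c
      later b∈ (D , c∈ , D∈) = uncrossed B∈ C∈ B<C a∈ b∈
        (≤-trans (<⇒≤ (lookup C<Cs D∈)) (lastEntry-≤ (lookup (decreasing nc) (⊆P (there D∈))) c∈))
    block : ∀ B w → AllPairs _>_ B → (∀ {x} → x ∈ B → AllPairs (NoDescentBelow x) w) →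
            Triples NoDescentBelow w → Triples NoDescentBelow (B ++ w)
    block []      w _          f t = t
    block (x ∷ B) w (gt ∷ dec) f t =
      AllPairs.++⁺ (allPairs (λ b∈ _ (_ , x<b) → <-asym x<b (lookup gt b∈))) (f (here refl))
        (All.tabulate (λ b∈ → All.tabulate (λ _ (_ , x<b) → <-asym x<b (lookup gt b∈))))
      , block B w dec (f ∘ there) t
    blocks⁺ : ∀ Bs → (∀ {C} → C ∈ Bs → C ∈ P) → AllPairs (λ C D → lastEntry C < lastEntry D) Bs →
              Triples NoDescentBelow (concat Bs)
    blocks⁺ []       ⊆P _           = tt
    blocks⁺ (B ∷ Bs) ⊆P (lt ∷ srt) =
      block B (concat Bs) (lookup (decreasing nc) (⊆P (here refl)))
        (λ x∈ → pairs (⊆P (here refl)) x∈ Bs (⊆P ∘ there) lt srt) (blocks⁺ Bs (⊆P ∘ there) srt)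

  -- The blocks are the maximal decreasing runs of the flattened form.
  concat-injective : ∀ {P Q} → IsNonCrossing P → IsNonCrossing Q → concat P ≡ concat Q → P ≡ Q
  concat-injective ncP ncQ =
    runs (nonEmpty ncP) (decreasing ncP) (sorted ncP) (nonEmpty ncQ) (decreasing ncQ) (sorted ncQ)
    where
    Sorted : Blocks → Set
    Sorted = AllPairs (λ B C → lastEntry B < lastEntry C)

    Above : ℕ → List ℕ → Set
    Above x w = ∀ {y w′} → w ≡ y ∷ w′ → x < y

    above : ∀ {B Bs} → All (_≢ []) Bs → All (AllPairs _>_) Bs → All (λ C → lastEntry B < lastEntry C) Bs →
            Above (lastEntry B) (concat Bs)
    above {Bs = []}             _        _         _         ()
    above {Bs = [] ∷ Bs}        (n ∷ _)  _         _         _    = contradiction refl n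
    above {Bs = (x ∷ C) ∷ Bs}   (n ∷ _)  (dec ∷ _) (B<C ∷ _) refl = <-≤-trans B<C (lastEntry-≤ dec (here refl))

    first-run : ∀ B C {w w′} → B ≢ [] → C ≢ [] → AllPairs _>_ B → AllPairs _>_ C →
                Above (lastEntry B) w → Above (lastEntry C) w′ → B ++ w ≡ C ++ w′ → B ≡ C × w ≡ w′
    first-run []          C            n m _ _ _ _ eq = contradiction refl n
    first-run (x ∷ B)     []           n m _ _ _ _ eq = contradiction refl m
    first-run (x ∷ [])    (y ∷ [])     n m _ _ _ _ eq = cong (_∷ []) (List.∷-injectiveˡ eq) , List.∷-injectiveʳ eq
    first-run (x ∷ [])    (.x ∷ z ∷ C) n m _ ((z<x ∷ _) ∷ _) up _ refl = contradiction (up refl) (<-asym z<x)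
    first-run (x ∷ z ∷ B) (.x ∷ [])    n m ((z<x ∷ _) ∷ _) _ _ up refl = contradiction (up refl) (<-asym z<x)
    first-run (x ∷ z ∷ B) (y ∷ z′ ∷ C) n m (_ ∷ dB) (_ ∷ dC) up up′ eq =
      let (B≡ , w≡) = first-run (z ∷ B) (z′ ∷ C) (λ ()) (λ ()) dB dC up up′ (List.∷-injectiveʳ eq)
      in cong₂ _∷_ (List.∷-injectiveˡ eq) B≡ , w≡

    runs : ∀ {P Q} → All (_≢ []) P → All (AllPairs _>_) P → Sorted P →
           All (_≢ []) Q → All (AllPairs _>_) Q → Sorted Q → concat P ≡ concat Q → P ≡ Q
    runs {[]}         {[]}         _       _ _ _       _ _ eq = refl
    runs {[]}         {[] ∷ Q}     _       _ _ (n ∷ _) _ _ eq = contradiction refl n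
    runs {[] ∷ P}     {Q}          (n ∷ _) _ _ _       _ _ eq = contradiction refl n
    runs {(x ∷ B) ∷ P} {[] ∷ Q}    _       _ _ (n ∷ _) _ _ eq = contradiction refl n
    runs {B@(_ ∷ _) ∷ P} {C@(_ ∷ _) ∷ Q} (n ∷ ns) (dB ∷ dP) (B< ∷ sP) (m ∷ ms) (dC ∷ dQ) (C< ∷ sQ) eq =
      let (B≡ , w≡) = first-run B C n m dB dC (above {B} ns dP B<) (above {C} ms dQ C<) eq
      in cong₂ _∷_ B≡ (runs ns dP sP ms dQ sQ w≡)

  presentation : Presentation partitions
  presentation = Correspondence.Along.presentation P₂₃₁.presentation (λ P w → concat P ≡ w)
    (record { nonEmpty = [] ; decreasing = [] ; sorted = [] ; partition = ↭-refl ; nonCrossing = λ () })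
    lam-isObject ⊕-isObject
    (λ {P} nc → concat P , (partition nc , triples⁻ (avoids nc)) , refl)
    (λ _ _ p q → trans (sym p) q)
    (λ ncP ncQ p q → concat-injective ncP ncQ (trans p (sym q)))
    (λ _ p → cong length p) refl
    (λ { {P} _ refl → concat-lam P }) (λ { {P} {Q} _ _ refl refl → concat-⊕ P Q })

  Cut : ℕ → Blocks → Set
  Cut k P = All (λ B → All (_≤ k) B ⊎ All (k <_) B) P

  -- The first block contains both 1 and the maximum, so no proper nonempty initial interval is a
  -- union of blocks.
  lam-¬cut : ∀ {P} → IsNonCrossing P → ∀ k → 1 ≤ k → k < size (lamBlocks P) → ¬ Cut k (lamBlocks P)
  lam-¬cut {[]}         nc k 1≤k k<1 _ = <⇒≱ k<1 1≤k
  lam-¬cut {P@(B ∷ Bs)} nc k 1≤k (s≤s k≤n) (inj₁ (n≤k ∷ _) ∷ _) = <⇒≱ (s≤s k≤n) n≤k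
  lam-¬cut {P@(B ∷ Bs)} nc k 1≤k (s≤s k≤n) (inj₂ (_ ∷ k<B) ∷ _) =
    <⇒≱ (lookup k<B (lastEntry-∈ (All.head (nonEmpty nc)))) (≤-trans min≤1 1≤k)
    where
    min≤ : ∀ {C} → C ∈ P → lastEntry B ≤ lastEntry C
    min≤ (here refl) = ≤-refl
    min≤ (there C∈)  = <⇒≤ (lookup (AllPairs.head (sorted nc)) C∈)
    min≤1 : lastEntry B ≤ 1
    min≤1 =
      let (C , 1∈C , C∈) = ∈-concat⁻′ P (∈-resp-↭ (↭-sym (partition nc)) (∈-[1⋯]⁺ ≤-refl (≤-trans 1≤k k≤n)))
      in ≤-trans (min≤ C∈) (lastEntry-≤ (lookup (decreasing nc) C∈) 1∈C)

  size-⊕ : ∀ P Q → size (P ⊕ Q) ≡ size P + size Q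
  size-⊕ P Q = trans (cong length (concat-⊕ P Q)) (length-directSum (concat P) (concat Q))

  comp-lam⊕ : ∀ {P Q} → IsNonCrossing P → IsNonCrossing Q → comp (lamBlocks P ⊕ Q) ≡ suc (comp Q)
  comp-lam⊕ {P} {Q} ncP ncQ = trans
    (cong (λ n → count (cut? (lamBlocks P ⊕ Q)) [1⋯ n ]) (size-⊕ (lamBlocks P) Q))
    (count-cuts (cut? (lamBlocks P ⊕ Q)) (cut? Q) m (size Q)
      (subst (1 ≤_) (sym (cong length (concat-lam P))) (s≤s z≤n))
      (λ k 1≤k k<m cut → lam-¬cut ncP k 1≤k k<m (All.++⁻ˡ (lamBlocks P) cut))
      (All.++⁺ (low ≤-refl) (All.map⁺ (All.tabulate λ B∈ → inj₂ (All.map⁺ (All.tabulate λ x∈ →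
        m<m+n m (proj₁ (bounds ncQ B∈ x∈)))))))
      (λ k _ _ →
        (λ cut → All.map
           [ inj₁ ∘ All.map (+-cancelˡ-≤ m _ _) ∘ All.map⁻ , inj₂ ∘ All.map (+-cancelˡ-< m _ _) ∘ All.map⁻ ]′
           (All.map⁻ (All.++⁻ʳ (lamBlocks P) cut)))
        , (λ cut → All.++⁺ (low (m≤m+n m k)) (All.map⁺ (All.map
           [ inj₁ ∘ All.map⁺ ∘ All.map (+-monoʳ-≤ m) , inj₂ ∘ All.map⁺ ∘ All.map (+-monoʳ-< m) ]′ cut)))))
    where
    m : ℕ
    m = size (lamBlocks P)
    cut? : ∀ P k → Dec (Cut k P)
    cut? P k = all? (λ B → all? (_≤? k) B ⊎-dec all? (k <?_) B) P
    low : ∀ {k} → m ≤ k → Cut k (lamBlocks P)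
    low m≤k = All.tabulate λ B∈ → inj₁ (All.tabulate λ x∈ →
      ≤-trans (proj₂ (bounds (lam-isObject ncP) B∈ x∈)) m≤k)

  rcomp-lam : ∀ {P} → IsNonCrossing P → rcomp (lamBlocks P) ≡ suc (rcomp P)
  rcomp-lam {P} nc = trans (cong Permutation.rmax (concat-lam P)) (P₂₃₁.rmax-lam (partition nc))

  concat≢[] : ∀ {P} → IsNonCrossing P → P ≢ [] → concat P ≢ []
  concat≢[] {[]}            nc P≢[] _ = P≢[] refl
  concat≢[] {[] ∷ _}        nc P≢[] _ = All.head (nonEmpty nc) refl
  concat≢[] {(_ ∷ _) ∷ _}   nc P≢[] ()

  rcomp-⊕ : ∀ {P Q} → IsNonCrossing P → IsNonCrossing Q → Q ≢ [] → rcomp (P ⊕ Q) ≡ rcomp Q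
  rcomp-⊕ {P} {Q} ncP ncQ Q≢[] = trans (cong Permutation.rmax (concat-⊕ P Q))
    (rmax-directSum (partition ncP) (partition ncQ) (concat≢[] ncQ Q≢[]))

  blocks≤size : ∀ {P} → All (_≢ []) P → blocks P ≤ size P
  blocks≤size {[]}          _        = z≤n
  blocks≤size {[] ∷ P}      (n ∷ _)  = contradiction refl n
  blocks≤size {(x ∷ B) ∷ P} (_ ∷ ns) = s≤s (≤-trans (blocks≤size ns)
    (≤-trans (m≤n+m _ (length B)) (≤-reflexive (sym (List.length-++ B)))))

  blocks-lam : ∀ P → P ≢ [] → blocks (lamBlocks P) ≡ blocks P
  blocks-lam []      P≢[] = contradiction refl P≢[]
  blocks-lam (_ ∷ _) P≢[] = refl

  laws : StatisticLaws presentation comp blocks rcomp nonmin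
  laws = record
    { a-e     = refl
    ; a-lam⊕  = comp-lam⊕
    ; a′-lam-e = refl
    ; a′-lam  = λ p _ → rcomp-lam p
    ; a′-lam⊕ = λ p q → rcomp-⊕ (lam-isObject p) q
    ; b-lam-e = refl
    ; b-lam   = λ {P} _ → blocks-lam P
    ; b-lam⊕  = λ {P} {Q} _ _ _ → trans (List.length-++ (lamBlocks P)) (cong (blocks (lamBlocks P) +_) (List.length-map _ Q))
    ; b′-b    = λ {P} nc _ → trans (m∸n+n≡m (≤-trans (blocks≤size (nonEmpty nc)) (m≤m+n (size P) 1))) (+-comm (size P) 1)
    }

mainTheorem2 : (n : ℕ) → n ≥ 1 →
    HSendsPair dyck n (Dyck.comp , Dyck.peak) (Dyck.rcomp , Dyck.nonpeak)
    × HSendsPair triangulations n (Triangulation.comp , Triangulation.tr) (Triangulation.rcomp , Triangulation.nontr)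
    × HSendsPair permutations231 n (Permutation.comp , Permutation.rmin) (Permutation.rmax , Permutation.nonrmin)
    × HSendsPair permutations321 n (Permutation.comp , Permutation.rmin) (Permutation.rcomp , Permutation.nonrmin)
    × HSendsPair binaryTrees n (BinaryTree.comp , BinaryTree.redge) (BinaryTree.rcomp , BinaryTree.ledge)
    × HSendsPair tableaux n (Tableau.comp , Tableau.noncons) (Tableau.rcomp , Tableau.cons)
    × HSendsPair partitions n (Partition.comp , Partition.blocks) (Partition.rcomp , Partition.nonmin)
mainTheorem2 n n≥1 =
    sendsPair DyckProof.presentation DyckProof.laws n n≥1
  , sendsPair TriangulationProof.presentation TriangulationProof.laws n n≥1
  , sendsPair Permutation231Proof.presentation Permutation231Proof.laws n n≥1
  , sendsPair Permutation321Proof.presentation Permutation321Proof.laws n n≥1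
  , sendsPair BinaryTreeProof.presentation BinaryTreeProof.laws n n≥1
  , sendsPair TableauProof.presentation TableauProof.laws n n≥1
  , sendsPair PartitionProof.presentation PartitionProof.laws n n≥1
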